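{- Let $G$ be a graph and let $H$ be a full subdivision of $G$. Then: (i) if $G$ is planar, then $H$ is an $\{\mathrm{L}\}$-graph; (ii) for any graph $G$, the complement of $H$ is a $B_2$-VPG-graph.
   Context: A full subdivision of a graph $G$ is a graph obtained from $G$ by replacing each edge by a path with at least one internal vertex (i.e., every edge is subdivided at least once). An $\mathrm{L}$-shape (in the rotation $\mathrm{L}$) is the union of a vertical segment and a horizontal segment in the plane such that the lower endpoint of the vertical segment coincides with the left endpoint of the horizontal segment (a shape like the letter L, not rotated; arm lengths arbitrary). A graph is an $\{\mathrm{L}\}$-graph if one can assign to each of its vertices such an $\mathrm{L}$-shape so that two distinct vertices are adjacent iff their $\mathrm{L}$-shapes intersect. For an integer $k\ge0$, a $k$-bend path is a simple polygonal path in the plane made of axis-parallel segments whose direction changes between horizontal and vertical at most $k$ times; a graph is a $B_k$-VPG-graph if one can assign to each vertex a $k$-bend path so that two distinct vertices are adjacent iff their paths intersect. The complement of a graph has the same vertex set, with two distinct vertices adjacent iff they are non-adjacent in the original graph.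
   Formalization: Planarity is taken as having a plane drawing with polygonal arcs whose vertices and bends have rational coordinates, and the L-shapes and 2-bend paths are likewise in the rational plane. -}

module Defs where

open import Data.Bool using (Bool; true; false)
open import Data.Nat as ℕ using (ℕ; zero; suc)
open import Data.Fin as F using (Fin; toℕ; inject₁; fromℕ)
open import Data.Rational as Q using (ℚ; 0ℚ; 1ℚ; _+_; _*_; _-_)
open import Data.Product using (Σ; Σ-syntax; ∃; ∃-syntax; _×_; _,_; proj₁; proj₂)
open import Data.Sum using (_⊎_; inj₁; inj₂)
open import Data.Empty using (⊥)
open import Relation.Nullary using (¬_)
open import Relation.Binary.PropositionalEquality using (_≡_; _≢_)
open import Function.Bundles using (_⇔_)

record SimpleGraph : Set where
  field
    n      : ℕ
    adj    : Fin n → Fin n → Bool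
    sym    : ∀ u v → adj u v ≡ adj v u
    irrefl : ∀ u → adj u u ≡ false
open SimpleGraph public

-- An edge {u,v} of G, represented once, by its ordered pair with u < v.
Edge : SimpleGraph → Set
Edge G = Σ[ uv ∈ Fin (n G) × Fin (n G) ]
           (proj₁ uv F.< proj₂ uv) × (adj G (proj₁ uv) (proj₂ uv) ≡ true)

src tgt : {G : SimpleGraph} → Edge G → Fin (n G)
src e = proj₁ (proj₁ e)
tgt e = proj₂ (proj₁ e)

record Graph : Set₁ where
  field
    V   : Set
    _~_ : V → V → Set
open Graph public

Complement : Graph → Graph
Complement H = record { V = V H ; _~_ = λ x y → x ≢ y × ¬ (_~_ H x y) }

-- Subdivision of G in which edge e is replaced by a path with k e internal
-- vertices: src e - (e,0) - (e,1) - ... - (e, k e - 1) - tgt e.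
-- It is a *full* subdivision when k e ≥ 1 for every edge e.

SubV : (G : SimpleGraph) → (Edge G → ℕ) → Set
SubV G k = Fin (n G) ⊎ Σ[ e ∈ Edge G ] Fin (k e)

EndAdj : (G : SimpleGraph) (k : Edge G → ℕ) → Fin (n G) → (e : Edge G) → Fin (k e) → Set
EndAdj G k w e i = (w ≡ src {G} e × toℕ i ≡ 0) ⊎ (w ≡ tgt {G} e × suc (toℕ i) ≡ k e)

SubAdj : (G : SimpleGraph) (k : Edge G → ℕ) → SubV G k → SubV G k → Set
SubAdj G k (inj₁ u) (inj₁ v) = ⊥
SubAdj G k (inj₁ w) (inj₂ (e , i)) = EndAdj G k w e i
SubAdj G k (inj₂ (e , i)) (inj₁ w) = EndAdj G k w e i
SubAdj G k (inj₂ (e , i)) (inj₂ (e' , j)) =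
  src {G} e ≡ src {G} e' × tgt {G} e ≡ tgt {G} e' × (suc (toℕ i) ≡ toℕ j ⊎ suc (toℕ j) ≡ toℕ i)

Subdivision : (G : SimpleGraph) → (Edge G → ℕ) → Graph
Subdivision G k = record { V = SubV G k ; _~_ = SubAdj G k }

Point : Set
Point = ℚ × ℚ

OnSeg : Point → Point → Point → Set
OnSeg (px , py) (ax , ay) (bx , by) =
  Σ[ t ∈ ℚ ] (0ℚ Q.≤ t) × (t Q.≤ 1ℚ) ×
    (px ≡ ax + t * (bx - ax)) × (py ≡ ay + t * (by - ay))

record Polyline : Set where
  field
    m  : ℕ
    pt : Fin (suc (suc m)) → Point
open Polyline public

segA segB : (P : Polyline) → Fin (suc (m P)) → Point
segA P i = pt P (inject₁ i)
segB P i = pt P (F.suc i)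

startP endP : Polyline → Point
startP P = pt P F.zero
endP P = pt P (fromℕ (suc (m P)))

OnPoly : Point → Polyline → Set
OnPoly p P = ∃[ i ] OnSeg p (segA P i) (segB P i)

SimplePoly : Polyline → Set
SimplePoly P =
  (∀ i → segA P i ≢ segB P i) ×
  (∀ i j → suc (toℕ i) ≡ toℕ j → ∀ p →
     OnSeg p (segA P i) (segB P i) → OnSeg p (segA P j) (segB P j) → p ≡ segB P i) ×
  (∀ i j → suc (toℕ i) ℕ.< toℕ j → ∀ p →
     OnSeg p (segA P i) (segB P i) → ¬ OnSeg p (segA P j) (segB P j))

Interior : Point → Polyline → Set
Interior p P = OnPoly p P × p ≢ startP P × p ≢ endP P

-- Planarity (plane drawing with polygonal arcs, as in Diestel)

record PlaneDrawing (G : SimpleGraph) : Set where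
  field
    pos      : Fin (n G) → Point
    pos-inj  : ∀ u v → pos u ≡ pos v → u ≡ v
    arc      : Edge G → Polyline
    arc-simple : ∀ e → SimplePoly (arc e)
    arc-start  : ∀ e → startP (arc e) ≡ pos (src {G} e)
    arc-end    : ∀ e → endP (arc e) ≡ pos (tgt {G} e)
    no-vertex  : ∀ e w p → Interior p (arc e) → p ≢ pos w
    no-cross   : ∀ e e' → ¬ (src {G} e ≡ src {G} e' × tgt {G} e ≡ tgt {G} e') →
                 ∀ p → Interior p (arc e) → ¬ OnPoly p (arc e')

Planar : SimpleGraph → Set
Planar G = PlaneDrawing G

-- corner (x,y), vertical arm up to (x, y+h), horizontal arm right to (x+w, y)
record LShape : Set where
  field
    corner : Point
    h w    : ℚ
    h>0    : 0ℚ Q.< h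
    w>0    : 0ℚ Q.< w
open LShape public

OnL : Point → LShape → Set
OnL p L = OnSeg p (corner L) (proj₁ (corner L) , proj₂ (corner L) + h L)
        ⊎ OnSeg p (corner L) (proj₁ (corner L) + w L , proj₂ (corner L))

LIntersect : LShape → LShape → Set
LIntersect L L' = ∃[ p ] OnL p L × OnL p L'

IsLGraph : Graph → Set
IsLGraph H = Σ[ s ∈ (V H → LShape) ]
  (∀ x y → x ≢ y → (_~_ H x y ⇔ LIntersect (s x) (s y)))

Horizontal : Point → Point → Set
Horizontal a b = proj₂ a ≡ proj₂ b

Vertical : Point → Point → Set
Vertical a b = proj₁ a ≡ proj₁ b

-- number of bends of a list of segment orientations (true = horizontal)
changes : Bool → (k : ℕ) → (Fin k → Bool) → ℕ
changes b zero o = 0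
changes b (suc k) o with b Data.Bool.≟ o F.zero
... | Relation.Nullary.yes _ = changes (o F.zero) k (λ i → o (F.suc i))
... | Relation.Nullary.no _  = suc (changes (o F.zero) k (λ i → o (F.suc i)))

record KBendPath (k : ℕ) : Set where
  field
    path   : Polyline
    simple : SimplePoly path
    horiz  : Fin (suc (m path)) → Bool
    orient : ∀ i → (horiz i ≡ true → Horizontal (segA path i) (segB path i))
                 × (horiz i ≡ false → Vertical (segA path i) (segB path i))
    bends  : changes (horiz F.zero) (m path) (λ i → horiz (F.suc i)) ℕ.≤ k
open KBendPath public

IsBkVPG : ℕ → Graph → Set
IsBkVPG k H = Σ[ s ∈ (V H → KBendPath k) ]
  (∀ x y → x ≢ y →
     (_~_ H x y ⇔ (∃[ p ] OnPoly p (path (s x)) × OnPoly p (path (s y)))))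

{-# OPTIONS --safe #-}
-- (i) Call a function on the darts of G antisymmetric and conserved at every vertex a circulation.  In a plane
-- drawing two circulations c and c' cross algebraically zero times: shear the drawing so that distinct points
-- have distinct heights, weight each pair of segments with the product of the two flows and record which of
-- them passes on the left.  For a single pair the changes of this record cancel; in the sum over all pairs the
-- contributions of ends lying strictly beside another segment cancel by conservation, which leaves
-- Σ_v ω_v(c , c') = 0, where ω_v is the sum of c_i c'_j - c'_i c_j over i < j in the rotation at v.
-- This identity survives contracting an edge and deleting the edges parallel to it.  If a set U of vertices has
-- been contracted and x y x y (with x ≠ y) occurs among the far ends of the edges leaving U in cyclic order, two
-- circulations through x and y cross with ω = 2.  So these far ends are non-crossing, some vertex occupies a
-- contiguous block, and it can be added to U next.  Read from bottom to top this order draws the vertices as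
-- horizontal bars and the edges as vertical strips; a strip is filled with a staircase of L-shapes.
--
-- (ii) Every vertex becomes a path (0,b) - (c,b) - (c,r) - (R,r), where all b are smaller than all r.  Two such
-- paths with c < c' meet iff c' ≤ R and r ≤ r', or b ≤ b'.  The parameters are words of natural numbers in
-- lexicographic order.
module Submission where

open import Data.Empty using (⊥; ⊥-elim)
open import Data.Product using (Σ; Σ-syntax; ∃; ∃₂; ∃-syntax; _×_; _,_; proj₁; proj₂)
open import Data.Sum using (_⊎_; inj₁; inj₂)
open import Relation.Binary.PropositionalEquality
  using (_≡_; _≢_; refl; trans; cong; cong₂; subst; subst₂; module ≡-Reasoning) renaming (sym to ≡sym)
open import Relation.Nullary using (¬_; Dec; yes; no)

-- In (i) the obstacle is to extract combinatorics from a polygonal drawing without the Jordan curve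
-- theorem, faces or Euler's formula. That circulations cross algebraically zero times is the
-- homological form of genus zero: the intersection form of the sphere vanishes. It is bilinear,
-- makes sense for disconnected graphs and can be checked one pair of segments at a time. It
-- survives a contraction because a circulation of the contracted graph extends over the contracted
-- edge by the value that conservation forces, the parallel edges carrying 0.
--
-- Bars and strips form a weak visibility representation: bars of non-adjacent vertices may see each
-- other, since bars are joined by staircases only. Each strip keeps an interval on its right in
-- reserve; the bar that ends a block extends into the reserve of its last strip, and new strips
-- start there, clear of the old ones.
--
-- In (ii) adjacency in the subdivision has to become disjointness. A path is a permutation graph,
-- so consecutive path vertices can be reversed between the orders of c and r; disjointness also
-- requires b to be reversed against c, which is why b zigzags along the path.

-- Ordered-field arithmetic and points on axis-parallel segments.

module Rationals where

  open import Defs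
  open import Data.Rational as Q using (ℚ; 0ℚ; 1ℚ; _+_; _*_; _-_; -_; _≤_; _<_)
  import Data.Rational.Properties as QP
  open import Relation.Nullary.Decidable using (dec⇒maybe)
  open import Tactic.RingSolver.Core.AlmostCommutativeRing using (AlmostCommutativeRing; fromCommutativeRing)
  open import Tactic.RingSolver using (solve-∀)

  ℚ-ring : AlmostCommutativeRing _ _
  ℚ-ring = fromCommutativeRing QP.+-*-commutativeRing (λ x → dec⇒maybe (0ℚ QP.≟ x))

  p+[q-p] : ∀ p q → p + (q - p) ≡ q
  p+[q-p] = solve-∀ ℚ-ring

  ≤⇒0≤- : ∀ {p q} → p ≤ q → 0ℚ ≤ q - p
  ≤⇒0≤- {p} {q} p≤q = subst (_≤ q - p) (QP.+-inverseʳ p) (QP.+-monoˡ-≤ (- p) p≤q)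

  <⇒0<- : ∀ {p q} → p < q → 0ℚ < q - p
  <⇒0<- {p} {q} p<q = subst (_< q - p) (QP.+-inverseʳ p) (QP.+-monoˡ-< (- p) p<q)

  -- The standard route to inequalities here: the difference is exhibited as a product of
  -- nonnegative factors, which leaves an equation for the ring solver.
  by-diff-≤ : ∀ {p q d} → 0ℚ ≤ d → p + d ≡ q → p ≤ q
  by-diff-≤ {p} {q} 0≤d eq = subst₂ _≤_ (QP.+-identityʳ p) eq (QP.+-monoʳ-≤ p 0≤d)

  by-diff-< : ∀ {p q d} → 0ℚ < d → p + d ≡ q → p < q
  by-diff-< {p} {q} 0<d eq = subst₂ _<_ (QP.+-identityʳ p) eq (QP.+-monoʳ-< p 0<d)

  0≤* : ∀ {p q} → 0ℚ ≤ p → 0ℚ ≤ q → 0ℚ ≤ p * q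
  0≤* {p} {q} 0≤p 0≤q =
    subst (_≤ p * q) (QP.*-zeroʳ p) (QP.*-monoˡ-≤-nonNeg p {{Q.nonNegative 0≤p}} 0≤q)

  0<* : ∀ {p q} → 0ℚ < p → 0ℚ < q → 0ℚ < p * q
  0<* {p} {q} 0<p 0<q =
    subst (_< p * q) (QP.*-zeroʳ p) (QP.*-monoʳ-<-pos p {{Q.positive 0<p}} 0<q)

  inv : ∀ {p} → 0ℚ < p → Σ[ r ∈ ℚ ] (0ℚ < r) × (r * p ≡ 1ℚ)
  inv {p} 0<p = (Q.1/ p) {{nz}} , QP.positive⁻¹ _ {{QP.1/pos⇒pos p {{Q.positive 0<p}}}} , QP.*-inverseˡ p {{nz}}
    where nz = QP.pos⇒nonZero p {{Q.positive 0<p}}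

  ratio : ∀ {a b x} → a < b → a ≤ x → x ≤ b →
          Σ[ t ∈ ℚ ] (0ℚ ≤ t) × (t ≤ 1ℚ) × (t * (b - a) ≡ x - a)
  ratio {a} {b} {x} a<b a≤x x≤b =
    let (r , 0<r , eq) = inv (<⇒0<- a<b) in
    (x - a) * r , 0≤* (≤⇒0≤- a≤x) (QP.<⇒≤ 0<r) ,
    by-diff-≤ (0≤* (≤⇒0≤- x≤b) (QP.<⇒≤ 0<r)) (trans (l₁ a b x r) eq) ,
    trans (l₂ a b x r) (trans (cong ((x - a) *_) eq) (QP.*-identityʳ _))
    where
    l₁ : ∀ a b x r → (x - a) * r + (b - x) * r ≡ r * (b - a)
    l₁ = solve-∀ ℚ-ring
    l₂ : ∀ a b x r → (x - a) * r * (b - a) ≡ (x - a) * (r * (b - a))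
    l₂ = solve-∀ ℚ-ring

  convex-≤ : ∀ {a b t} → a ≤ b → 0ℚ ≤ t → t ≤ 1ℚ → (a ≤ a + t * (b - a)) × (a + t * (b - a) ≤ b)
  convex-≤ {a} {b} {t} a≤b 0≤t t≤1 =
    by-diff-≤ (0≤* 0≤t (≤⇒0≤- a≤b)) refl ,
    by-diff-≤ (0≤* (≤⇒0≤- t≤1) (≤⇒0≤- a≤b)) (l a b t 1ℚ (QP.*-identityˡ (b - a)))
    where
    l' : ∀ a b t o → a + t * (b - a) + (o - t) * (b - a) ≡ a + o * (b - a)
    l' = solve-∀ ℚ-ring
    l : ∀ a b t o → o * (b - a) ≡ b - a → a + t * (b - a) + (o - t) * (b - a) ≡ b
    l a b t o e = trans (l' a b t o) (trans (cong (a +_) e) (p+[q-p] a b))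

  constant : ∀ y t → y + t * (y - y) ≡ y
  constant y t = trans (cong (λ z → y + t * z) (QP.+-inverseʳ y)) (trans (cong (y +_) (QP.*-zeroʳ t)) (QP.+-identityʳ y))

  affine : ∀ {a b x t} → t * (b - a) ≡ x - a → x ≡ a + t * (b - a)
  affine {a} {b} {x} {t} eq = ≡sym (trans (cong (λ z → a + z) {t * (b - a)} {x - a} eq) (p+[q-p] a x))

  onH : ∀ {a b x y} → a < b → a ≤ x → x ≤ b → OnSeg (x , y) (a , y) (b , y)
  onH {a} {b} {x} {y} a<b a≤x x≤b =
    let (t , 0≤t , t≤1 , eq) = ratio a<b a≤x x≤b
    in t , 0≤t , t≤1 , affine {a} {b} {x} {t} eq , ≡sym (constant y t)

  onV : ∀ {a b x y} → a < b → a ≤ y → y ≤ b → OnSeg (x , y) (x , a) (x , b)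
  onV {a} {b} {x} {y} a<b a≤y y≤b =
    let (t , 0≤t , t≤1 , eq) = ratio a<b a≤y y≤b
    in t , 0≤t , t≤1 , ≡sym (constant x t) , affine {a} {b} {y} {t} eq

  fromH : ∀ {p a b y} → a ≤ b → OnSeg p (a , y) (b , y) → (a ≤ proj₁ p) × (proj₁ p ≤ b) × (proj₂ p ≡ y)
  fromH {p} {a} {b} {y} a≤b (t , 0≤t , t≤1 , ex , ey) =
    subst (a ≤_) (≡sym ex) (proj₁ (convex-≤ a≤b 0≤t t≤1)) ,
    subst (_≤ b) (≡sym ex) (proj₂ (convex-≤ a≤b 0≤t t≤1)) , trans ey (constant y t)

  fromV : ∀ {p a b x} → a ≤ b → OnSeg p (x , a) (x , b) → (a ≤ proj₂ p) × (proj₂ p ≤ b) × (proj₁ p ≡ x)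
  fromV {p} {a} {b} {x} a≤b (t , 0≤t , t≤1 , ex , ey) =
    subst (a ≤_) (≡sym ey) (proj₁ (convex-≤ a≤b 0≤t t≤1)) ,
    subst (_≤ b) (≡sym ey) (proj₂ (convex-≤ a≤b 0≤t t≤1)) , trans ex (constant x t)

  <⇒≱ : ∀ {p q : ℚ} → p < q → ¬ (q ≤ p)
  <⇒≱ p<q q≤p = QP.<-irrefl refl (QP.<-≤-trans p<q q≤p)

-- Order embedding of words of natural numbers into the rationals.

module LexEmbedding where

  open Rationals
  open import Data.Nat as ℕ using (ℕ; zero; suc)
  open import Data.Vec using (Vec; []; _∷_)
  open import Data.Rational using (ℚ; 0ℚ; 1ℚ; _+_; _*_; _-_; -_; _≤_; _<_)
  import Data.Rational.Properties as QP
  open import Tactic.RingSolver using (solve-∀)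

  ι : ℕ → ℚ
  ι zero = 0ℚ
  ι (suc a) = 1ℚ + ι a

  0<1 : 0ℚ < 1ℚ
  0<1 = QP.positive⁻¹ 1ℚ

  ι<ι-suc : ∀ a → ι a < ι (suc a)
  ι<ι-suc a = by-diff-< 0<1 (QP.+-comm (ι a) 1ℚ)

  0≤ι : ∀ a → 0ℚ ≤ ι a
  0≤ι zero = QP.≤-refl
  0≤ι (suc a) = QP.≤-trans (0≤ι a) (QP.<⇒≤ (ι<ι-suc a))

  ι-mono-≤ : ∀ {a b} → a ℕ.≤ b → ι a ≤ ι b
  ι-mono-≤ {b = b} ℕ.z≤n = 0≤ι b
  ι-mono-≤ (ℕ.s≤s a≤b) = QP.+-monoʳ-≤ 1ℚ (ι-mono-≤ a≤b)

  ι-mono-< : ∀ {a b} → a ℕ.< b → ι a < ι b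
  ι-mono-< {a} a<b = QP.<-≤-trans (ι<ι-suc a) (ι-mono-≤ a<b)

  0<1+ : ∀ {p} → 0ℚ ≤ p → 0ℚ < 1ℚ + p
  0<1+ {p} 0≤p = QP.<-≤-trans 0<1 (by-diff-≤ 0≤p refl)

  -- p / (1 + p)
  frac : ∀ {p} → 0ℚ ≤ p → ℚ
  frac {p} 0≤p = proj₁ (inv (0<1+ 0≤p)) * p

  0≤frac : ∀ {p} (0≤p : 0ℚ ≤ p) → 0ℚ ≤ frac 0≤p
  0≤frac 0≤p = 0≤* (QP.<⇒≤ (proj₁ (proj₂ (inv (0<1+ 0≤p))))) 0≤p

  frac<1 : ∀ {p} (0≤p : 0ℚ ≤ p) → frac 0≤p < 1ℚ
  frac<1 {p} 0≤p = by-diff-< {frac 0≤p} {1ℚ} {r} (proj₁ (proj₂ (inv (0<1+ 0≤p))))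
                     (trans (trans (cong (r * p +_) (≡sym (QP.*-identityʳ r))) (l r p 1ℚ)) (proj₂ (proj₂ (inv (0<1+ 0≤p)))))
    where
    r = proj₁ (inv (0<1+ 0≤p))
    l : ∀ r p o → r * p + r * o ≡ r * (o + p)
    l = solve-∀ ℚ-ring

  -- The difference q/(1+q) - p/(1+p) equals (q-p)/((1+p)(1+q)), with `r` and `s` the two inverses.
  frac-mono : ∀ {p q} (0≤p : 0ℚ ≤ p) (0≤q : 0ℚ ≤ q) → p < q → frac 0≤p < frac 0≤q
  frac-mono {p} {q} 0≤p 0≤q p<q =
    by-diff-< {frac 0≤p} {frac 0≤q} {r * s * (q - p)}
      (0<* (0<* (proj₁ (proj₂ (inv (0<1+ 0≤p)))) (proj₁ (proj₂ (inv (0<1+ 0≤q))))) (<⇒0<- p<q))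
      (trans (l r s p q (frac 0≤p)) (trans (cong₂ (λ a b → s * q * a - r * p * b + r * p) er es) (l₂ (s * q) (r * p))))
    where
    r = proj₁ (inv (0<1+ 0≤p))
    s = proj₁ (inv (0<1+ 0≤q))
    er = proj₂ (proj₂ (inv (0<1+ 0≤p)))
    es = proj₂ (proj₂ (inv (0<1+ 0≤q)))
    l : ∀ r s p q z → z + r * s * (q - p) ≡ s * q * (r * (1ℚ + p)) - r * p * (s * (1ℚ + q)) + z
    l = solve-∀ ℚ-ring
    l₂ : ∀ a b → a * 1ℚ - b * 1ℚ + b ≡ a
    l₂ = solve-∀ ℚ-ring

  opaque
    mutual
      -- The tail is squeezed into [0,1) by a strictly increasing map, so it can only decide between
      -- words with the same first digit; this is what makes the embedding lexicographic.
      emb : ∀ {m} → Vec ℕ m → ℚ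
      emb [] = 0ℚ
      emb (a ∷ v) = ι a + frac (0≤emb v)

      0≤emb : ∀ {m} (v : Vec ℕ m) → 0ℚ ≤ emb v
      0≤emb [] = QP.≤-refl
      0≤emb (a ∷ v) = QP.≤-trans (0≤ι a) (by-diff-≤ (0≤frac (0≤emb v)) refl)

  infix 4 _⊏_ _⊑_

  data _⊏_ : ∀ {m} → Vec ℕ m → Vec ℕ m → Set where
    here : ∀ {m a b} {v w : Vec ℕ m} → a ℕ.< b → (a ∷ v) ⊏ (b ∷ w)
    next : ∀ {m a} {v w : Vec ℕ m} → v ⊏ w → (a ∷ v) ⊏ (a ∷ w)

  _⊑_ : ∀ {m} → Vec ℕ m → Vec ℕ m → Set
  v ⊑ w = v ⊏ w ⊎ v ≡ w

  opaque
    unfolding emb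

    emb-< : ∀ {m} {v w : Vec ℕ m} → v ⊏ w → emb v < emb w
    emb-< {v = a ∷ v} {b ∷ w} (here a<b) =
      QP.<-≤-trans (QP.+-monoʳ-< (ι a) (frac<1 (0≤emb v)))
        (QP.≤-trans (QP.≤-reflexive (QP.+-comm (ι a) 1ℚ))
          (QP.≤-trans (ι-mono-≤ a<b) (by-diff-≤ (0≤frac (0≤emb w)) refl)))
    emb-< {v = a ∷ v} {a ∷ w} (next v<w) = QP.+-monoʳ-< (ι a) (frac-mono (0≤emb v) (0≤emb w) (emb-< v<w))

  emb-≤ : ∀ {m} {v w : Vec ℕ m} → v ⊑ w → emb v ≤ emb w
  emb-≤ (inj₁ v<w) = QP.<⇒≤ (emb-< v<w)
  emb-≤ (inj₂ refl) = QP.≤-refl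

-- Two-bend paths starting on a common vertical line, and when they meet.

module ZShapes where

  open import Defs
  open Rationals
  open import Data.Bool using (true; false)
  open import Data.Nat as ℕ using (ℕ; zero; suc)
  import Data.Nat.Properties as ℕP
  open import Data.Fin as F using (Fin; zero; suc)
  open import Data.Rational using (ℚ; 0ℚ; _≤_; _<_)
  import Data.Rational.Properties as QP

  <⇒≢′ : ∀ {p q : ℚ} → p < q → p ≢ q
  <⇒≢′ p<q refl = QP.<-irrefl refl p<q

  record Z : Set where
    field
      c r b R : ℚ
      0<c : 0ℚ < c
      c<R : c < R
      b<r : b < r

  module _ (z : Z) where
    open Z z

    corner4 : Fin 4 → Point
    corner4 zero = 0ℚ , b
    corner4 (suc zero) = c , b
    corner4 (suc (suc zero)) = c , r
    corner4 (suc (suc (suc zero))) = R , r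

    zline : Polyline
    zline = record { m = 2 ; pt = corner4 }

    zpath : KBendPath 2
    zpath = record
      { path = zline
      ; simple = distinct , consecutive , apart
      ; horiz = λ { zero → true ; (suc zero) → false ; (suc (suc zero)) → true }
      ; orient = λ { zero → (λ _ → refl) , λ ()
                   ; (suc zero) → (λ ()) , λ _ → refl
                   ; (suc (suc zero)) → (λ _ → refl) , λ () }
      ; bends = ℕP.≤-refl }
      where
      distinct : ∀ i → segA zline i ≢ segB zline i
      distinct zero e = <⇒≢′ 0<c (cong proj₁ e)
      distinct (suc zero) e = <⇒≢′ b<r (cong proj₂ e)
      distinct (suc (suc zero)) e = <⇒≢′ c<R (cong proj₁ e)
      consecutive : ∀ i j → suc (F.toℕ i) ≡ F.toℕ j → ∀ p →
        OnSeg p (segA zline i) (segB zline i) → OnSeg p (segA zline j) (segB zline j) → p ≡ segB zline i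
      consecutive zero (suc zero) _ p s t =
        cong₂ _,_ (proj₂ (proj₂ (fromV (QP.<⇒≤ b<r) t))) (proj₂ (proj₂ (fromH (QP.<⇒≤ 0<c) s)))
      consecutive (suc zero) (suc (suc zero)) _ p s t =
        cong₂ _,_ (proj₂ (proj₂ (fromV (QP.<⇒≤ b<r) s))) (proj₂ (proj₂ (fromH (QP.<⇒≤ c<R) t)))
      apart : ∀ i j → suc (F.toℕ i) ℕ.< F.toℕ j → ∀ p →
        OnSeg p (segA zline i) (segB zline i) → ¬ OnSeg p (segA zline j) (segB zline j)
      apart zero (suc (suc zero)) _ p s t =
        <⇒≢′ b<r (trans (≡sym (proj₂ (proj₂ (fromH (QP.<⇒≤ 0<c) s)))) (proj₂ (proj₂ (fromH (QP.<⇒≤ c<R) t))))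
      apart zero (suc zero) (ℕ.s≤s ()) p s t
      apart (suc zero) (suc (suc zero)) (ℕ.s≤s (ℕ.s≤s ())) p s t
      apart (suc zero) (suc zero) (ℕ.s≤s ()) p s t
      apart (suc (suc zero)) (suc (suc zero)) (ℕ.s≤s (ℕ.s≤s ())) p s t
      apart (suc (suc zero)) (suc zero) (ℕ.s≤s ()) p s t

    onZ : ∀ {p} → OnPoly p zline →
          ((proj₁ p ≤ c) × (proj₂ p ≡ b)) ⊎ ((b ≤ proj₂ p) × (proj₂ p ≤ r) × (proj₁ p ≡ c)) ⊎
          ((c ≤ proj₁ p) × (proj₁ p ≤ R) × (proj₂ p ≡ r))
    onZ (zero , s) = inj₁ (proj₂ (fromH (QP.<⇒≤ 0<c) s))
    onZ (suc zero , s) = inj₂ (inj₁ (fromV (QP.<⇒≤ b<r) s))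
    onZ (suc (suc zero) , s) = inj₂ (inj₂ (fromH (QP.<⇒≤ c<R) s))

  record Meet (z z' : Z) : Set where
    constructor common
    field
      point : ∃[ p ] OnPoly p (zline z) × OnPoly p (zline z')

  meet-sym : ∀ {z z'} → Meet z z' → Meet z' z
  meet-sym (common (p , s , t)) = common (p , t , s)

  module _ (z z' : Z) where
    private
      module Z₁ = Z z
      module Z₂ = Z z'

    -- In the first case the upper arm of `z` crosses the vertical part of `z'`; in the second the
    -- lower arm of `z'`, coming from x = 0, crosses the vertical part of `z`.
    meet : Z₂.b < Z₁.r → Z₁.c ≤ Z₂.c → (Z₂.c ≤ Z₁.R × Z₁.r ≤ Z₂.r) ⊎ (Z₁.b ≤ Z₂.b) →
           Meet z z'
    meet bz cc (inj₁ (cR , rr)) =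
      common ((Z₂.c , Z₁.r) , (suc (suc zero) , onH Z₁.c<R cc cR) , (suc zero , onV Z₂.b<r (QP.<⇒≤ bz) rr))
    meet bz cc (inj₂ bb) =
      common ((Z₁.c , Z₂.b) , (suc zero , onV Z₁.b<r bb (QP.<⇒≤ bz)) , (zero , onH Z₂.0<c (QP.<⇒≤ Z₁.0<c) cc))

    -- Once `z'` starts below `z` and turns further right, only the upper arm of `z` could still
    -- reach `z'`. The last hypothesis makes this arm stop before the column of `z'` or run above
    -- all of `z'`.
    disjoint : Z₁.b < Z₂.r → Z₁.c < Z₂.c → Z₂.b < Z₁.b → Z₁.R < Z₂.c ⊎ Z₂.r < Z₁.r →
               ¬ Meet z z'
    disjoint br cc bb alt (common (p , s , t)) = go (onZ z s) (onZ z' t) alt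
      where
      bad : ∀ {x y z w : ℚ} → x ≡ y → x ≡ z → y ≡ w → w < z → ⊥
      bad refl refl refl lt = QP.<-irrefl refl lt
      go : _ → _ → _ → ⊥
      go (inj₁ (x≤ , y≡)) (inj₁ (_ , y≡')) _ = bad refl y≡ y≡' bb
      go (inj₁ (x≤ , y≡)) (inj₂ (inj₁ (_ , _ , x≡'))) _ = QP.<-irrefl x≡' (QP.≤-<-trans x≤ cc)
      go (inj₁ (x≤ , y≡)) (inj₂ (inj₂ (_ , _ , y≡'))) _ = bad refl y≡' y≡ br
      go (inj₂ (inj₁ (b≤ , _ , x≡))) (inj₁ (_ , y≡')) _ = QP.<-irrefl (≡sym y≡') (QP.<-≤-trans bb b≤)
      go (inj₂ (inj₁ (_ , _ , x≡))) (inj₂ (inj₁ (_ , _ , x≡'))) _ = bad refl x≡' x≡ cc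
      go (inj₂ (inj₁ (_ , _ , x≡))) (inj₂ (inj₂ (c≤ , _ , _))) _ = QP.<-irrefl (≡sym x≡) (QP.<-≤-trans cc c≤)
      go (inj₂ (inj₂ (_ , _ , y≡))) (inj₁ (_ , y≡')) _ = bad refl y≡ y≡' (QP.<-trans bb Z₁.b<r)
      go (inj₂ (inj₂ (_ , ≤R , _))) (inj₂ (inj₁ (_ , _ , x≡'))) (inj₁ lt) = QP.<-irrefl x≡' (QP.≤-<-trans ≤R lt)
      go (inj₂ (inj₂ (_ , _ , y≡))) (inj₂ (inj₁ (_ , y≤ , _))) (inj₂ lt) = QP.<-irrefl y≡ (QP.≤-<-trans y≤ lt)
      go (inj₂ (inj₂ (_ , ≤R , _))) (inj₂ (inj₂ (c≤ , _ , _))) (inj₁ lt) = QP.<-irrefl refl (QP.<-≤-trans lt (QP.≤-trans c≤ ≤R))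
      go (inj₂ (inj₂ (_ , _ , y≡))) (inj₂ (inj₂ (_ , _ , y≡'))) (inj₂ lt) = bad refl y≡ y≡' lt

-- Part (ii): encoding the vertices of the subdivision by words.

module ComplementVPG where

  open import Defs
  open LexEmbedding
  open ZShapes
  open import Axiom.UniquenessOfIdentityProofs.WithK using (uip)
  open import Data.Nat as ℕ using (ℕ; zero; suc; _≤_; _<_; z≤n; s≤s)
  import Data.Nat.Properties as ℕP
  open import Data.Fin using (Fin; zero; suc; toℕ)
  import Data.Fin.Properties as FP
  open import Data.Vec using (Vec; []; _∷_)
  import Data.Rational as Q
  import Data.Rational.Properties as QP
  open import Function.Bundles using (mk⇔)
  open import Relation.Binary using (tri<; tri≈; tri>)

  edge-≡ : {G : SimpleGraph} (e f : Edge G) → src {G} e ≡ src {G} f → tgt {G} e ≡ tgt {G} f → e ≡ f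
  edge-≡ ((u , v) , p , a) ((u , v) , p' , a') refl refl =
    cong₂ (λ p a → (u , v) , p , a) (ℕP.<-irrelevant p p') (uip a a')

  -- the ranks of the i-th path vertex in two linear orders whose inversions are the consecutive pairs
  rank₁ rank₂ : ℕ → ℕ
  rank₁ 0 = 3
  rank₁ 1 = 2
  rank₁ (suc (suc i)) = 4 ℕ.+ rank₁ i
  rank₂ 0 = 0
  rank₂ 1 = 5
  rank₂ (suc (suc i)) = 4 ℕ.+ rank₂ i

  rank₁-mono : ∀ {i j} → 2 ℕ.+ i ≤ j → rank₁ i ≤ rank₁ j
  rank₁-mono {0} (s≤s (s≤s _)) = s≤s (s≤s (s≤s z≤n))
  rank₁-mono {1} (s≤s (s≤s _)) = s≤s (s≤s z≤n)
  rank₁-mono {suc (suc i)} (s≤s (s≤s le)) = ℕP.+-monoʳ-≤ 4 (rank₁-mono le)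

  rank₂-mono : ∀ {i j} → 2 ℕ.+ i ≤ j → rank₂ i ≤ rank₂ j
  rank₂-mono {0} _ = z≤n
  rank₂-mono {1} (s≤s (s≤s {n = j} 1≤j)) = ℕP.+-monoʳ-≤ 4 (pos j 1≤j)
    where
    pos : ∀ j → 1 ≤ j → 1 ≤ rank₂ j
    pos 1 _ = s≤s z≤n
    pos (suc (suc j)) _ = s≤s z≤n
  rank₂-mono {suc (suc i)} (s≤s (s≤s le)) = ℕP.+-monoʳ-≤ 4 (rank₂-mono le)

  -- the value at inner path vertices alternates between 0 (even) and t (odd)
  inner : ℕ → ℕ → ℕ
  inner t 0 = 0
  inner t 1 = t
  inner t (suc (suc i)) = inner t i

  -- The ranks run 3 2 7 6 11 10 ... and 0 5 4 9 8 ...: the first reverses the pairs starting at an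
  -- even position, the second those starting at an odd one. The zigzag of `inner` keeps step with
  -- them, because disjointness needs a third parameter to be reversed as well.
  alternate : ∀ t i →
    (rank₁ (suc i) < rank₁ i × rank₂ i < rank₂ (suc i) × inner t i ≡ 0 × inner t (suc i) ≡ t) ⊎
    (rank₁ i < rank₁ (suc i) × rank₂ (suc i) < rank₂ i × inner t i ≡ t × inner t (suc i) ≡ 0 × 1 ≤ i)
  alternate t 0 = inj₁ (ℕP.≤-refl , s≤s z≤n , refl , refl)
  alternate t 1 = inj₂ (ℕP.m≤n+m 3 4 , ℕP.≤-refl , refl , refl , s≤s z≤n)
  alternate t (suc (suc i)) with alternate t i
  ... | inj₁ (p , q , e , f) = inj₁ (ℕP.+-monoʳ-< 4 p , ℕP.+-monoʳ-< 4 q , e , f)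
  ... | inj₂ (p , q , e , f , _) = inj₂ (ℕP.+-monoʳ-< 4 p , ℕP.+-monoʳ-< 4 q , e , f , s≤s z≤n)

  module _ (m : ℕ) where

    private
      lift : ∀ {a : ℕ} {k} {v w : Vec ℕ k} → v ⊑ w → (a ∷ v) ⊑ (a ∷ w)
      lift (inj₁ lt) = inj₁ (next lt)
      lift (inj₂ refl) = inj₂ refl

      head-≤ : ∀ {a b : ℕ} {k} {v w : Vec ℕ k} → a ≤ b → v ⊏ w → (a ∷ v) ⊏ (b ∷ w)
      head-≤ {a} {b} a≤b lt with ℕP.m≤n⇒m<n∨m≡n a≤b
      ... | inj₁ a<b = here a<b
      ... | inj₂ refl = next lt

      o₃ : Vec ℕ 3
      o₃ = 0 ∷ 0 ∷ 0 ∷ []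

      o₄ : Vec ℕ 4
      o₄ = 0 ∷ o₃

    -- `y` and `x` are the codes 1, ..., m of the vertices adjacent to the path vertex, with 0 and m
    -- + 1 standing for none. `u` and `v` identify the edge, `s` and `t` the position on it in the
    -- two orders.
    record Code : Set where
      constructor code
      field
        y x u v s t : ℕ
        y≤x : y ≤ x

    -- The second digits 3 here and 1, 2 in `pathZ` order the values with a common first digit:
    -- column of a path vertex, its right end, column of the vertex. The leading 0 and 1 put every
    -- `b` below every `r`. The digit m + 2 takes the upper arm past every column, as columns begin
    -- with at most m.
    vertexZ : (a : ℕ) → a ≤ m → Z
    vertexZ a a≤m = record
      { c = emb (a ∷ 3 ∷ o₃) ; R = emb (suc (suc m) ∷ o₄)
      ; b = emb (0 ∷ a ∷ o₄) ; r = emb (1 ∷ a ∷ o₄)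
      ; 0<c = QP.≤-<-trans (0≤emb (a ∷ 0 ∷ o₃)) (emb-< (next (here (s≤s z≤n))))
      ; c<R = emb-< (here (s≤s (ℕP.m≤n⇒m≤1+n a≤m)))
      ; b<r = emb-< (here (s≤s z≤n)) }

    pathZ : Code → Z
    pathZ (code y x u v s t y≤x) = record
      { c = emb (y ∷ 1 ∷ u ∷ v ∷ s ∷ []) ; R = emb (x ∷ 2 ∷ o₃)
      ; b = emb (0 ∷ x ∷ 1 ∷ o₃) ; r = emb (1 ∷ y ∷ 1 ∷ u ∷ v ∷ t ∷ [])
      ; 0<c = QP.≤-<-trans (0≤emb (y ∷ 0 ∷ o₃)) (emb-< (next (here (s≤s z≤n))))
      ; c<R = emb-< (head-≤ y≤x (here (s≤s (s≤s z≤n))))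
      ; b<r = emb-< (here (s≤s z≤n)) }

    b<r : ∀ {k} {v w : Vec ℕ k} → emb (0 ∷ v) Q.< emb (1 ∷ w)
    b<r = emb-< (here (s≤s z≤n))

    vertices-meet : ∀ {a a'} p p' → a ≤ a' → Meet (vertexZ a p) (vertexZ a' p')
    vertices-meet {a} {a'} p p' a≤a' = meet (vertexZ a p) (vertexZ a' p') b<r
      (emb-≤ (le a≤a')) (inj₂ (emb-≤ (lift (le a≤a'))))
      where
      le : ∀ {a b k} {v : Vec ℕ k} → a ≤ b → (a ∷ v) ⊑ (b ∷ v)
      le a≤b with ℕP.m≤n⇒m<n∨m≡n a≤b
      ... | inj₁ a<b = inj₁ (here a<b)
      ... | inj₂ refl = inj₂ refl

    vertex-path-meet : ∀ {a} p (d : Code) → Code.y d ≤ m → a ≢ Code.y d → a ≢ Code.x d →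
                       Meet (vertexZ a p) (pathZ d)
    vertex-path-meet {a} p d y≤m a≢y a≢x with ℕP.<-cmp a (Code.y d)
    ... | tri< a<y _ _ = meet (vertexZ a p) (pathZ d) b<r (emb-≤ (inj₁ (here a<y)))
            (inj₁ (emb-≤ (inj₁ (here (s≤s (ℕP.m≤n⇒m≤1+n y≤m)))) , emb-≤ (inj₁ (next (here a<y)))))
    ... | tri≈ _ a≡y _ = ⊥-elim (a≢y a≡y)
    ... | tri> _ _ y<a with ℕP.<-cmp a (Code.x d)
    ...   | tri< a<x _ _ = meet-sym (meet (pathZ d) (vertexZ a p) b<r (emb-≤ (inj₁ (here y<a)))
              (inj₁ (emb-≤ (inj₁ (here a<x)) , emb-≤ (inj₁ (next (here y<a))))))
    ...   | tri≈ _ a≡x _ = ⊥-elim (a≢x a≡x)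
    ...   | tri> _ _ x<a = meet-sym (meet (pathZ d) (vertexZ a p) b<r (emb-≤ (inj₁ (here y<a)))
              (inj₂ (emb-≤ (inj₁ (next (here x<a))))))

    -- Each end of an edge uses its own way of being disjoint. If a = y, the third digit 1 lifts the
    -- upper arm of the path vertex just above the vertex path; if a = x, this arm stops just before
    -- the column of the vertex.
    vertex-path-disjoint : ∀ {a} p (d : Code) → a ≡ Code.y d ⊎ a ≡ Code.x d →
                           ¬ Meet (pathZ d) (vertexZ a p)
    vertex-path-disjoint p d (inj₁ refl) = disjoint (pathZ d) (vertexZ _ p) b<r
      (emb-< (next (here (s≤s (s≤s z≤n))))) (emb-< (next (head-≤ (Code.y≤x d) (here (s≤s z≤n)))))
      (inj₂ (emb-< (next (next (here (s≤s z≤n))))))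
    vertex-path-disjoint p d (inj₂ refl) = disjoint (pathZ d) (vertexZ _ p) b<r
      (emb-< (head-≤ (Code.y≤x d) (here (s≤s (s≤s z≤n))))) (emb-< (next (next (here (s≤s z≤n)))))
      (inj₁ (emb-< (next (here (s≤s (s≤s (s≤s z≤n)))))))

    paths-meet-y : (d d' : Code) → Code.y d < Code.y d' → Code.y d' ≤ Code.x d ⊎ Code.x d < Code.x d' →
                   Meet (pathZ d) (pathZ d')
    paths-meet-y d d' y<y' alt = meet (pathZ d) (pathZ d') b<r (emb-≤ (inj₁ (here y<y'))) (cond alt)
      where
      cond : _ → _
      cond (inj₁ y'≤x) = inj₁ (emb-≤ (inj₁ (head-≤ y'≤x (here (s≤s (s≤s z≤n))))) , emb-≤ (inj₁ (next (here y<y'))))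
      cond (inj₂ x<x') = inj₂ (emb-≤ (inj₁ (next (here x<x'))))

    paths-meet-uv : ∀ {y x x' u u' v v' s s' t t' p p'} →
      (u ∷ v ∷ s ∷ []) ⊑ (u' ∷ v' ∷ s' ∷ []) → (u ∷ v ∷ t ∷ []) ⊑ (u' ∷ v' ∷ t' ∷ []) →
      Meet (pathZ (code y x u v s t p)) (pathZ (code y x' u' v' s' t' p'))
    paths-meet-uv {p = p} les let' = meet (pathZ _) (pathZ _) b<r (emb-≤ (lift (lift les)))
      (inj₁ (emb-≤ (inj₁ (head-≤ p (here (s≤s (s≤s z≤n))))) , emb-≤ (lift (lift (lift let')))))

    paths-disjoint : ∀ {y x x' u v s s' t t' p p'} → s < s' → t' < t → x' < x →
      ¬ Meet (pathZ (code y x u v s t p)) (pathZ (code y x' u v s' t' p'))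
    paths-disjoint s< t> x> = disjoint (pathZ _) (pathZ _) b<r
      (emb-< (next (next (next (next (here s<)))))) (emb-< (next (here x>)))
      (inj₂ (emb-< (next (next (next (next (next (here t>))))))))

  -- The inner values 0 and m + 1 lie below and above all vertex codes, so the codes at both ends of
  -- the path continue the zigzag whatever their size and the parity of k. Two vertex codes are
  -- neighbours only for k = 2, where u < v decides.
  xOf : (m k u v i : ℕ) → ℕ
  xOf m k u v zero with k ℕ.≟ 1
  ... | yes _ = suc v
  ... | no _ = suc u
  xOf m k u v (suc i) with suc (suc i) ℕ.≟ k
  ... | yes _ = suc v
  ... | no _ = inner (suc m) (suc i)

  -- Only a path with a single inner vertex has to be disjoint from both ends at once; then `y`
  -- stands for the lower end and `x` for the upper one. Otherwise `y` is 0, the code of no vertex.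
  yOf : (k u : ℕ) → ℕ
  yOf k u with k ℕ.≟ 1
  ... | yes _ = suc u
  ... | no _ = 0

  y≤xOf : ∀ m k u v i → i < k → u < v → yOf k u ≤ xOf m k u v i
  y≤xOf m k u v zero _ u<v with k ℕ.≟ 1
  ... | yes _ = s≤s (ℕP.<⇒≤ u<v)
  ... | no _ = z≤n
  y≤xOf m k u v (suc i) i<k u<v with k ℕ.≟ 1
  y≤xOf m .1 u v (suc i) (s≤s ()) u<v | yes refl
  ... | no _ = z≤n

  y<xOf : ∀ m k u v i → i < k → u < v → 1 ≤ yOf k u → yOf k u < xOf m k u v i
  y<xOf m k u v zero _ u<v _ with k ℕ.≟ 1
  ... | yes _ = s≤s u<v
  y<xOf m k u v zero _ u<v () | no _
  y<xOf m k u v (suc i) i<k u<v 1≤ with k ℕ.≟ 1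
  y<xOf m .1 u v (suc i) (s≤s ()) u<v _ | yes refl
  y<xOf m k u v (suc i) i<k u<v () | no _

  yOf≤ : ∀ {m} k u → u < m → yOf k u ≤ m
  yOf≤ k u u<m with k ℕ.≟ 1
  ... | yes _ = u<m
  ... | no _ = z≤n

  end⇒ : ∀ m k u v i w → i < k → (w ≡ u × i ≡ 0) ⊎ (w ≡ v × suc i ≡ k) →
         suc w ≡ yOf k u ⊎ suc w ≡ xOf m k u v i
  end⇒ m k u v zero w _ e with k ℕ.≟ 1
  end⇒ m k u v zero w _ (inj₁ (refl , _)) | yes p = inj₁ refl
  end⇒ m k u v zero w _ (inj₂ (refl , _)) | yes p = inj₂ refl
  end⇒ m k u v zero w _ (inj₁ (refl , _)) | no p = inj₂ refl
  end⇒ m k u v zero w _ (inj₂ (_ , 1≡k)) | no p = ⊥-elim (p (≡sym 1≡k))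
  end⇒ m k u v (suc i) w _ (inj₂ (refl , e)) with suc (suc i) ℕ.≟ k
  ... | yes p = inj₂ refl
  ... | no p = ⊥-elim (p e)

  inner-cases : ∀ t i → inner t i ≡ 0 ⊎ inner t i ≡ t
  inner-cases t i with alternate t i
  ... | inj₁ (_ , _ , e , _) = inj₁ e
  ... | inj₂ (_ , _ , e , _ , _) = inj₂ e

  end⇐ : ∀ m k u v i w → i < k → w < m → suc w ≡ yOf k u ⊎ suc w ≡ xOf m k u v i →
         (w ≡ u × i ≡ 0) ⊎ (w ≡ v × suc i ≡ k)
  end⇐ m k u v zero w _ w<m e with k ℕ.≟ 1
  end⇐ m k u v zero w _ w<m (inj₁ refl) | yes p = inj₁ (refl , refl)
  end⇐ m k u v zero w _ w<m (inj₂ refl) | yes p = inj₂ (refl , ≡sym p)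
  end⇐ m k u v zero w _ w<m (inj₂ refl) | no p = inj₁ (refl , refl)
  end⇐ m k u v (suc i) w i<k w<m e with k ℕ.≟ 1
  end⇐ m .1 u v (suc i) w (s≤s ()) w<m e | yes refl
  end⇐ m k u v (suc i) w i<k w<m (inj₂ e) | no p with suc (suc i) ℕ.≟ k
  end⇐ m k u v (suc i) w i<k w<m (inj₂ refl) | no p | yes q = inj₂ (refl , q)
  ... | no q with inner-cases (suc m) (suc i)
  ...   | inj₁ z = case-0 (trans e z)
    where
    case-0 : suc w ≡ 0 → _
    case-0 ()
  ...   | inj₂ z = ⊥-elim (ℕP.<-irrefl (ℕP.suc-injective (trans e z)) w<m)

  consecutive-x : ∀ m k u v i → suc i < k → u < v → v < m →
    (rank₁ (suc i) < rank₁ i × rank₂ i < rank₂ (suc i) × xOf m k u v i < xOf m k u v (suc i)) ⊎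
    (rank₁ i < rank₁ (suc i) × rank₂ (suc i) < rank₂ i × xOf m k u v (suc i) < xOf m k u v i)
  consecutive-x m k u v zero i<k u<v v<m with k ℕ.≟ 1
  consecutive-x m .1 u v zero (s≤s ()) u<v v<m | yes refl
  ... | no _ with 2 ℕ.≟ k
  ...   | yes _ = inj₁ (ℕP.≤-refl , s≤s z≤n , s≤s u<v)
  ...   | no _ = inj₁ (ℕP.≤-refl , s≤s z≤n , s≤s (ℕP.<-trans u<v v<m))
  consecutive-x m k u v (suc i) i<k u<v v<m with suc (suc i) ℕ.≟ k
  ... | yes p = ⊥-elim (ℕP.<-irrefl p i<k)
  ... | no _ with suc (suc (suc i)) ℕ.≟ k | alternate (suc m) (suc i)
  ...   | yes _ | inj₁ (p , q , e , f) = inj₁ (p , q , subst (_< suc v) (≡sym e) (s≤s z≤n))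
  ...   | yes _ | inj₂ (p , q , e , f , _) = inj₂ (p , q , subst (suc v <_) (≡sym e) (s≤s v<m))
  ...   | no _ | inj₁ (p , q , e , f) = inj₁ (p , q , subst₂ _<_ (≡sym e) (≡sym f) (s≤s z≤n))
  ...   | no _ | inj₂ (p , q , e , f , _) = inj₂ (p , q , subst₂ _<_ (≡sym f) (≡sym e) (s≤s z≤n))

  module _ (G : SimpleGraph) (k : Edge G → ℕ) where

    private
      M = n G
      H = Subdivision G k

      s[_] t[_] : Edge G → ℕ
      s[ e ] = toℕ (src {G} e)
      t[ e ] = toℕ (tgt {G} e)

      kind : (e : Edge G) → Fin (k e) → Code M
      kind e i = code (yOf (k e) s[ e ]) (xOf M (k e) s[ e ] t[ e ] (toℕ i)) s[ e ] t[ e ] (rank₁ (toℕ i)) (rank₂ (toℕ i))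
                   (y≤xOf M (k e) s[ e ] t[ e ] (toℕ i) (FP.toℕ<n i) (proj₁ (proj₂ e)))

      shape : SubV G k → Z
      shape (inj₁ w) = vertexZ M (suc (toℕ w)) (FP.toℕ<n w)
      shape (inj₂ (e , i)) = pathZ M (kind e i)

      Met : SubV G k → SubV G k → Set
      Met p q = Meet (shape p) (shape q)

      end-index : ∀ {w e i} → EndAdj G k w e i → (toℕ w ≡ s[ e ] × toℕ i ≡ 0) ⊎ (toℕ w ≡ t[ e ] × suc (toℕ i) ≡ k e)
      end-index (inj₁ (refl , q)) = inj₁ (refl , q)
      end-index (inj₂ (refl , q)) = inj₂ (refl , q)

      index-end : ∀ {w e i} → (toℕ w ≡ s[ e ] × toℕ i ≡ 0) ⊎ (toℕ w ≡ t[ e ] × suc (toℕ i) ≡ k e) → EndAdj G k w e i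
      index-end (inj₁ (p , q)) = inj₁ (FP.toℕ-injective p , q)
      index-end (inj₂ (p , q)) = inj₂ (FP.toℕ-injective p , q)

      vertex-path : ∀ w e i → ¬ EndAdj G k w e i → Met (inj₁ w) (inj₂ (e , i))
      vertex-path w e i ¬adj = vertex-path-meet M (FP.toℕ<n w) (kind e i) (yOf≤ (k e) s[ e ] (FP.toℕ<n (src {G} e)))
        (λ q → ¬adj (index-end (end⇐ M (k e) s[ e ] t[ e ] (toℕ i) (toℕ w) (FP.toℕ<n i) (FP.toℕ<n w) (inj₁ q))))
        (λ q → ¬adj (index-end (end⇐ M (k e) s[ e ] t[ e ] (toℕ i) (toℕ w) (FP.toℕ<n i) (FP.toℕ<n w) (inj₂ q))))

      ¬vertex-path : ∀ w e i → EndAdj G k w e i → ¬ Met (inj₂ (e , i)) (inj₁ w)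
      ¬vertex-path w e i adj = vertex-path-disjoint M (FP.toℕ<n w) (kind e i)
        (end⇒ M (k e) s[ e ] t[ e ] (toℕ i) (toℕ w) (FP.toℕ<n i) (end-index adj))

      path-path-y : ∀ e i f j → Code.y (kind e i) < Code.y (kind f j) → Met (inj₂ (e , i)) (inj₂ (f , j))
      path-path-y e i f j y<y' = paths-meet-y M (kind e i) (kind f j) y<y' (alt (Code.y (kind f j) ℕ.≤? Code.x (kind e i)))
        where
        alt : Dec _ → _
        alt (yes p) = inj₁ p
        -- Here y' is positive, so f has a single inner vertex and x < y' < x'.
        alt (no p) = inj₂ (ℕP.<-trans (ℕP.≰⇒> p)
          (y<xOf M (k f) s[ f ] t[ f ] (toℕ j) (FP.toℕ<n j) (proj₁ (proj₂ f)) (ℕP.≤-trans (s≤s z≤n) y<y')))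

      same-path : ∀ e (i j : Fin (k e)) → toℕ i < toℕ j → suc (toℕ i) ≢ toℕ j → Met (inj₂ (e , i)) (inj₂ (e , j))
      same-path e i j i<j 1+i≢j = paths-meet-uv M (third (rank₁-mono 2+i≤j)) (third (rank₂-mono 2+i≤j))
        where
        2+i≤j = ℕP.≤∧≢⇒< i<j 1+i≢j
        third : ∀ {u v s s' : ℕ} → s ≤ s' → (u ∷ v ∷ s ∷ []) ⊑ (u ∷ v ∷ s' ∷ [])
        third s≤ with ℕP.m≤n⇒m<n∨m≡n s≤
        ... | inj₁ s< = inj₁ (next (next (here s<)))
        ... | inj₂ refl = inj₂ refl

      lower : ∀ {y y' x x' u u' v v' s s' t t' p p'} → y ≡ y' →
        (u ∷ v ∷ s ∷ []) ⊑ (u' ∷ v' ∷ s' ∷ []) → (u ∷ v ∷ t ∷ []) ⊑ (u' ∷ v' ∷ t' ∷ []) →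
        Meet (pathZ M (code y x u v s t p)) (pathZ M (code y' x' u' v' s' t' p'))
      lower refl = paths-meet-uv M

      lower-v : ∀ {y y' x x' u u' v v' s s' t t' p p'} → y ≡ y' → u ≡ u' → v < v' →
        Meet (pathZ M (code y x u v s t p)) (pathZ M (code y' x' u' v' s' t' p'))
      lower-v refl refl lt = paths-meet-uv M (inj₁ (next (here lt))) (inj₁ (next (here lt)))

      -- The words compare `y`, then the ends of the edge, then the position. Only two vertices on
      -- one edge get as far as the position, so the reversals of `rank₁` against `rank₂` separate
      -- no other pair.
      path-path : ∀ e i f j → _≢_ {A = SubV G k} (inj₂ (e , i)) (inj₂ (f , j)) →
                  ¬ SubAdj G k (inj₂ (e , i)) (inj₂ (f , j)) → Met (inj₂ (e , i)) (inj₂ (f , j))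
      path-path e i f j ne ¬adj with ℕP.<-cmp (yOf (k e) s[ e ]) (yOf (k f) s[ f ])
                                  | ℕP.<-cmp s[ e ] s[ f ] | ℕP.<-cmp t[ e ] t[ f ]
      ... | tri< lt _ _ | _ | _ = path-path-y e i f j lt
      ... | tri> _ _ gt | _ | _ = meet-sym (path-path-y f j e i gt)
      ... | tri≈ _ eq _ | tri< lt _ _ | _ = lower eq (inj₁ (here lt)) (inj₁ (here lt))
      ... | tri≈ _ eq _ | tri> _ _ gt | _ = meet-sym (lower (≡sym eq) (inj₁ (here gt)) (inj₁ (here gt)))
      ... | tri≈ _ eq _ | tri≈ _ s≡ _ | tri< lt _ _ = lower-v eq s≡ lt
      ... | tri≈ _ eq _ | tri≈ _ s≡ _ | tri> _ _ gt = meet-sym (lower-v (≡sym eq) (≡sym s≡) gt)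
      ... | tri≈ _ eq _ | tri≈ _ s≡ _ | tri≈ _ t≡ _ = same (edge-≡ {G} e f (FP.toℕ-injective s≡) (FP.toℕ-injective t≡)) i j ne ¬adj
        where
        same : ∀ {e f} → e ≡ f → ∀ i j → _≢_ {A = SubV G k} (inj₂ (e , i)) (inj₂ (f , j)) →
               ¬ SubAdj G k (inj₂ (e , i)) (inj₂ (f , j)) → Met (inj₂ (e , i)) (inj₂ (f , j))
        same {e} refl i j ne ¬adj with ℕP.<-cmp (toℕ i) (toℕ j)
        ... | tri< lt _ _ = same-path e i j lt (λ q → ¬adj (refl , refl , inj₁ q))
        ... | tri> _ _ gt = meet-sym (same-path e j i gt (λ q → ¬adj (refl , refl , inj₂ q)))
        ... | tri≈ _ i≡j _ = ⊥-elim (ne (cong (λ i → inj₂ (e , i)) (FP.toℕ-injective i≡j)))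

      ¬consecutive : ∀ e (i j : Fin (k e)) → suc (toℕ i) ≡ toℕ j → ¬ Met (inj₂ (e , i)) (inj₂ (e , j))
      ¬consecutive e i j q = go (toℕ j) q (FP.toℕ<n j)
        (y≤xOf M (k e) s[ e ] t[ e ] (toℕ j) (FP.toℕ<n j) (proj₁ (proj₂ e)))
        where
        go : ∀ j' → suc (toℕ i) ≡ j' → j' < k e → (le : yOf (k e) s[ e ] ≤ xOf M (k e) s[ e ] t[ e ] j') →
          ¬ Meet (pathZ M (kind e i))
                 (pathZ M (code (yOf (k e) s[ e ]) (xOf M (k e) s[ e ] t[ e ] j') s[ e ] t[ e ] (rank₁ j') (rank₂ j') le))
        go .(suc (toℕ i)) refl j<k le
          with consecutive-x M (k e) s[ e ] t[ e ] (toℕ i) j<k (proj₁ (proj₂ e)) (FP.toℕ<n (tgt {G} e))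
        ... | inj₁ (p , q , x<) = λ mt → paths-disjoint M p q x< (meet-sym mt)
        ... | inj₂ (p , q , x>) = paths-disjoint M p q x>

    complement-B₂VPG : IsBkVPG 2 (Complement H)
    complement-B₂VPG = (λ p → zpath (shape p)) , λ p q p≢q → mk⇔ (λ (_ , ¬adj) → Meet.point (to p q p≢q ¬adj)) (λ mt → p≢q , λ adj → from p q adj (common mt))
      where
      to : ∀ p q → p ≢ q → ¬ SubAdj G k p q → Met p q
      to (inj₁ w) (inj₁ w') _ _ with ℕP.≤-total (toℕ w) (toℕ w')
      ... | inj₁ le = vertices-meet M (FP.toℕ<n w) (FP.toℕ<n w') (s≤s le)
      ... | inj₂ ge = meet-sym (vertices-meet M (FP.toℕ<n w') (FP.toℕ<n w) (s≤s ge))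
      to (inj₁ w) (inj₂ (e , i)) _ ¬adj = vertex-path w e i ¬adj
      to (inj₂ (e , i)) (inj₁ w) _ ¬adj = meet-sym (vertex-path w e i ¬adj)
      to (inj₂ (e , i)) (inj₂ (f , j)) p≢q ¬adj = path-path e i f j p≢q ¬adj
      from : ∀ p q → SubAdj G k p q → ¬ Met p q
      from (inj₁ w) (inj₂ (e , i)) adj mt = ¬vertex-path w e i adj (meet-sym mt)
      from (inj₂ (e , i)) (inj₁ w) adj mt = ¬vertex-path w e i adj mt
      from (inj₂ (e , i)) (inj₂ (f , j)) (s≡ , t≡ , alt) = same (edge-≡ {G} e f s≡ t≡) i j alt
        where
        same : ∀ {e f} → e ≡ f → ∀ i j → suc (toℕ i) ≡ toℕ j ⊎ suc (toℕ j) ≡ toℕ i → ¬ Met (inj₂ (e , i)) (inj₂ (f , j))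
        same {e} refl i j (inj₁ q) = ¬consecutive e i j q
        same {e} refl i j (inj₂ q) mt = ¬consecutive e j i q (meet-sym mt)

-- From bars and strips to L-shapes.

module Layouts where

  open import Defs
  open Rationals
  open LexEmbedding
  open import Data.Nat as ℕ using (ℕ; zero; suc)
  import Data.Nat.Properties as ℕP
  open import Data.Fin as F using (Fin; zero; suc; toℕ)
  import Data.Fin.Properties as FP
  open import Data.Rational using (ℚ; _-_; _≤_; _<_)
  import Data.Rational.Properties as QP
  open import Data.Sum using (swap)
  open import Function.Bundles using (_⇔_; mk⇔; Equivalence)
  open import Relation.Nullary.Decidable using (map′; _×-dec_)
  open import Relation.Binary using (tri<; tri≈; tri>)
  open ComplementVPG using (edge-≡)

  opaque
    mid : ∀ {p q} → p < q → ℚ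
    mid p<q = proj₁ (QP.<-dense p<q)

    <mid : ∀ {p q} (p<q : p < q) → p < mid p<q
    <mid p<q = proj₁ (proj₂ (QP.<-dense p<q))

    mid< : ∀ {p q} (p<q : p < q) → mid p<q < q
    mid< p<q = proj₂ (proj₂ (QP.<-dense p<q))

  -- An L-shape by the coordinates `T` and `R` of its arm ends instead of arm lengths, so that
  -- contact is a matter of comparisons.
  record El : Set where
    field
      x y T R : ℚ
      y<T : y < T
      x<R : x < R

  module _ (l : El) where
    open El l

    toL : LShape
    toL = record { corner = x , y ; h = T - y ; w = R - x ; h>0 = <⇒0<- y<T ; w>0 = <⇒0<- x<R }

    On : Point → Set
    On p = (proj₁ p ≡ x × y ≤ proj₂ p × proj₂ p ≤ T) ⊎ (proj₂ p ≡ y × x ≤ proj₁ p × proj₁ p ≤ R)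

    OnL⇒On : ∀ {p} → OnL p toL → On p
    OnL⇒On {p} (inj₁ s) = let (a , b , c) = fromV (QP.<⇒≤ y<T) (subst (λ t → OnSeg p (x , y) (x , t)) (p+[q-p] y T) s) in inj₁ (c , a , b)
    OnL⇒On {p} (inj₂ s) = let (a , b , c) = fromH (QP.<⇒≤ x<R) (subst (λ t → OnSeg p (x , y) (t , y)) (p+[q-p] x R) s) in inj₂ (c , a , b)

    On⇒OnL : ∀ {p} → On p → OnL p toL
    On⇒OnL {p} (inj₁ (refl , a , b)) = inj₁ (subst (λ t → OnSeg p (x , y) (x , t)) (≡sym (p+[q-p] y T)) (onV y<T a b))
    On⇒OnL {p} (inj₂ (refl , a , b)) = inj₂ (subst (λ t → OnSeg p (x , y) (t , y)) (≡sym (p+[q-p] x R)) (onH x<R a b))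

    x≤On : ∀ {p} → On p → x ≤ proj₁ p
    x≤On (inj₁ (e , _)) = QP.≤-reflexive (≡sym e)
    x≤On (inj₂ (_ , a , _)) = a

    On≤R : ∀ {p} → On p → proj₁ p ≤ R
    On≤R (inj₁ (e , _)) = QP.≤-trans (QP.≤-reflexive e) (QP.<⇒≤ x<R)
    On≤R (inj₂ (_ , _ , a)) = a

    y≤On : ∀ {p} → On p → y ≤ proj₂ p
    y≤On (inj₁ (_ , a , _)) = a
    y≤On (inj₂ (e , _)) = QP.≤-reflexive (≡sym e)

    On≤T : ∀ {p} → On p → proj₂ p ≤ T
    On≤T (inj₁ (_ , _ , a)) = a
    On≤T (inj₂ (e , _)) = QP.≤-trans (QP.≤-reflexive e) (QP.<⇒≤ y<T)

  record Touch (l l' : El) : Set where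
    constructor common
    field
      point : ∃[ p ] On l p × On l' p

  touch-sym : ∀ {l l'} → Touch l l' → Touch l' l
  touch-sym (common (p , a , b)) = common (p , b , a)

  left-of : ∀ {l l'} → El.R l < El.x l' → ¬ Touch l l'
  left-of {l} {l'} lt (common (p , a , b)) = <⇒≱ lt (QP.≤-trans (x≤On l' b) (On≤R l a))

  below : ∀ {l l'} → El.T l < El.y l' → ¬ Touch l l'
  below {l} {l'} lt (common (p , a , b)) = <⇒≱ lt (QP.≤-trans (y≤On l' b) (On≤T l a))

  touch⇔ : ∀ l l' → Touch l l' ⇔ LIntersect (toL l) (toL l')
  touch⇔ l l' = mk⇔ (λ (common (p , a , b)) → p , On⇒OnL l a , On⇒OnL l' b)
                    (λ (p , a , b) → common (p , OnL⇒On l a , OnL⇒On l' b))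

  -- Iterated midpoints supply an unbounded monotone sequence that stays strictly inside the
  -- interval, whatever the number of steps required.
  rising : ∀ {p q} → p < q → ℕ → Σ[ m ∈ ℚ ] (p < m) × (m < q)
  rising p<q zero = mid p<q , <mid p<q , mid< p<q
  rising p<q (suc i) = let (m , p<m , m<q) = rising p<q i in mid m<q , QP.<-trans p<m (<mid m<q) , mid< m<q

  falling : ∀ {p q} → p < q → ℕ → Σ[ m ∈ ℚ ] (p < m) × (m < q)
  falling p<q zero = mid p<q , <mid p<q , mid< p<q
  falling p<q (suc i) = let (m , p<m , m<q) = falling p<q i in mid p<m , <mid p<m , QP.<-trans (mid< p<m) m<q

  rising-mono : ∀ {p q} (p<q : p < q) {i j} → i ℕ.< j → proj₁ (rising p<q i) < proj₁ (rising p<q j)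
  rising-mono p<q {i} {suc j} (ℕ.s≤s i≤j) with ℕP.m≤n⇒m<n∨m≡n i≤j
  ... | inj₁ i<j = QP.<-trans (rising-mono p<q i<j) (<mid (proj₂ (proj₂ (rising p<q j))))
  ... | inj₂ refl = <mid (proj₂ (proj₂ (rising p<q j)))

  falling-suc : ∀ {p q} (p<q : p < q) i → proj₁ (falling p<q (suc i)) < proj₁ (falling p<q i)
  falling-suc p<q i = mid< (proj₁ (proj₂ (falling p<q i)))

  -- the j-th of k steps of a staircase that climbs leftwards through the box (lo , hi) × [B , U]
  module Staircase {lo hi B U : ℚ} (lo<hi : lo < hi) (B<U : B < U) (k : ℕ) where

    col : ℕ → ℚ
    col j = proj₁ (falling lo<hi j)

    lo<col : ∀ j → lo < col j
    lo<col j = proj₁ (proj₂ (falling lo<hi j))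

    col<hi : ∀ j → col j < hi
    col<hi j = proj₂ (proj₂ (falling lo<hi j))

    row : ℕ → ℚ
    row zero = B
    row (suc i) = proj₁ (rising B<U i)

    row<U : ∀ j → row j < U
    row<U zero = B<U
    row<U (suc j) = proj₂ (proj₂ (rising B<U j))

    row-mono : ∀ {i j} → i ℕ.< j → row i < row j
    row-mono {zero} {suc j} _ = proj₁ (proj₂ (rising B<U j))
    row-mono {suc i} {suc j} (ℕ.s≤s i<j) = rising-mono B<U i<j

    B≤row : ∀ j → B ≤ row j
    B≤row zero = QP.≤-refl
    B≤row (suc j) = QP.<⇒≤ (row-mono {0} {suc j} (ℕ.s≤s ℕ.z≤n))

    top : ℕ → ℚ
    top j with suc j ℕ.≟ k
    ... | yes _ = U
    ... | no _ = row (suc j)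

    row<top : ∀ j → row j < top j
    row<top j with suc j ℕ.≟ k
    ... | yes _ = row<U j
    ... | no _ = row-mono {j} ℕP.≤-refl

    top≤U : ∀ j → top j ≤ U
    top≤U j with suc j ℕ.≟ k
    ... | yes _ = QP.≤-refl
    ... | no _ = QP.<⇒≤ (row<U (suc j))

    top-last : ∀ j → suc j ≡ k → top j ≡ U
    top-last j e with suc j ℕ.≟ k
    ... | yes _ = refl
    ... | no ne = ⊥-elim (ne e)

    top-inner : ∀ j → suc j ≢ k → top j ≡ row (suc j)
    top-inner j ne with suc j ℕ.≟ k
    ... | yes e = ⊥-elim (ne e)
    ... | no _ = refl

    -- The top of the vertical arm of step j is the right end of the horizontal arm of step j + 1.
    -- Step 0 lies on the bottom line of the box, and only the last vertical arm is prolonged to its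
    -- upper line.
    stair : ℕ → El
    stair j = record { x = col (suc j) ; y = row j ; T = top j ; R = col j
                     ; y<T = row<top j ; x<R = falling-suc lo<hi j }

    consecutive-touch : ∀ j → suc j ℕ.< k → Touch (stair j) (stair (suc j))
    consecutive-touch j j<k = common ((col (suc j) , row (suc j)) ,
      inj₁ (refl , QP.<⇒≤ (row-mono {j} ℕP.≤-refl) , QP.≤-reflexive (≡sym (top-inner j (ℕP.<⇒≢ j<k)))) ,
      inj₂ (refl , QP.<⇒≤ (falling-suc lo<hi (suc j)) , QP.≤-refl))

    apart : ∀ i j → suc i ℕ.< j → j ℕ.< k → ¬ Touch (stair i) (stair j)
    apart i j 1+i<j j<k = below {stair i} {stair j} (subst (_< row j) (≡sym (top-inner i (ℕP.<⇒≢ (ℕP.<-trans 1+i<j j<k)))) (row-mono 1+i<j))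

  -- A weak visibility representation with edges thickened to strips. Horizontal intervals may share
  -- boundary points, since staircases stay strictly inside their strips; the vertical alternative
  -- of `separate` is strict, since a staircase touches both of its bars.
  record Layout (G : SimpleGraph) : Set where
    field
      height     : Fin (n G) → ℕ
      height-inj : ∀ u v → height u ≡ height v → u ≡ v
      left right : Fin (n G) → ℚ
      left<right : ∀ v → left v < right v
      lo hi      : Edge G → ℚ
      lo<hi      : ∀ e → lo e < hi e

    Within : Edge G → Fin (n G) → Set
    Within e v = left v ≤ lo e × hi e ≤ right v

    bot : Edge G → ℕ
    bot e = height (src {G} e) ℕ.⊓ height (tgt {G} e)

    top : Edge G → ℕ
    top e = height (src {G} e) ℕ.⊔ height (tgt {G} e)

    field
      within-src : ∀ e → Within e (src {G} e)
      within-tgt : ∀ e → Within e (tgt {G} e)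
      avoid      : ∀ e v → bot e ℕ.< height v → height v ℕ.< top e → hi e ≤ left v ⊎ right v ≤ lo e
      separate   : ∀ e f → e ≢ f → (hi e ≤ lo f ⊎ hi f ≤ lo e) ⊎ (top e ℕ.< bot f ⊎ top f ℕ.< bot e)

  module _ {G : SimpleGraph} (L : Layout G) (k : Edge G → ℕ) (k≥1 : ∀ e → 1 ℕ.≤ k e) where
    open Layout L

    private
      s t : Edge G → Fin (n G)
      s = src {G}
      t = tgt {G}

      s≢t : ∀ e → s e ≢ t e
      s≢t e p = FP.<-irrefl p (proj₁ (proj₂ e))

      bot<top : ∀ e → bot e ℕ.< top e
      bot<top e with ℕP.<-cmp (height (s e)) (height (t e))
      ... | tri< lt _ _ = subst₂ ℕ._<_ (≡sym (ℕP.m≤n⇒m⊓n≡m (ℕP.<⇒≤ lt))) (≡sym (ℕP.m≤n⇒m⊔n≡n (ℕP.<⇒≤ lt))) lt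
      ... | tri≈ _ eq _ = ⊥-elim (s≢t e (height-inj _ _ eq))
      ... | tri> _ _ gt = subst₂ ℕ._<_ (≡sym (ℕP.m≥n⇒m⊓n≡n (ℕP.<⇒≤ gt))) (≡sym (ℕP.m≥n⇒m⊔n≡m (ℕP.<⇒≤ gt))) gt

      -- An L-shape must have a vertical arm. The stub ends strictly below the next height and
      -- stands at the left end of the bar, to the left of all steps that start from it.
      bar : Fin (n G) → El
      bar v = record { x = left v ; y = ι (height v) ; T = mid (ι<ι-suc (height v)) ; R = right v
                     ; y<T = <mid _ ; x<R = left<right v }

      bar-top : ∀ {v m} → height v ℕ.< m → El.T (bar v) < ι m
      bar-top lt = QP.<-≤-trans (mid< _) (ι-mono-≤ lt)

      module St (e : Edge G) = Staircase (lo<hi e) (ι-mono-< (bot<top e)) (k e)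

      -- steps are counted upwards from the lower end of e
      step : (e : Edge G) → ℕ → ℕ
      step e i with height (s e) ℕ.<? height (t e)
      ... | yes _ = i
      ... | no _ = k e ℕ.∸ suc i

      step< : ∀ e {i} → i ℕ.< k e → step e i ℕ.< k e
      step< e {i} i<k with height (s e) ℕ.<? height (t e)
      ... | yes _ = i<k
      ... | no _ = ℕP.∸-monoʳ-< {k e} {suc i} {0} (ℕ.s≤s ℕ.z≤n) i<k

      flip-step : ∀ {k i j} → i ℕ.< k → j ℕ.< k → suc (k ℕ.∸ suc i) ≡ k ℕ.∸ suc j → suc j ≡ i
      flip-step {k} {i} {j} i<k j<k eq = ℕP.∸-cancelˡ-≡ j<k (ℕP.<⇒≤ i<k) (trans (≡sym eq) (≡sym (ℕP.+-∸-assoc 1 i<k)))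

      step-suc : ∀ e {i j} → i ℕ.< k e → j ℕ.< k e → suc i ≡ j → suc (step e i) ≡ step e j ⊎ suc (step e j) ≡ step e i
      step-suc e {i} {j} i<k j<k eq with height (s e) ℕ.<? height (t e)
      ... | yes _ = inj₁ eq
      step-suc e {i} i<k j<k refl | no _ = inj₂ (≡sym (ℕP.+-∸-assoc 1 j<k))

      suc-step : ∀ e {i j} → i ℕ.< k e → j ℕ.< k e → suc (step e i) ≡ step e j → suc i ≡ j ⊎ suc j ≡ i
      suc-step e {i} {j} i<k j<k eq with height (s e) ℕ.<? height (t e)
      ... | yes _ = inj₁ eq
      ... | no _ = inj₂ (flip-step i<k j<k eq)

      step-inj : ∀ e {i j} → i ℕ.< k e → j ℕ.< k e → step e i ≡ step e j → i ≡ j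
      step-inj e {i} {j} i<k j<k eq with height (s e) ℕ.<? height (t e)
      ... | yes _ = eq
      ... | no _ = ℕP.suc-injective (ℕP.∸-cancelˡ-≡ i<k j<k eq)

      data End (e : Edge G) (v : Fin (n G)) (j : ℕ) : Set where
        lower : height v ≡ bot e → j ≡ 0 → End e v j
        upper : height v ≡ top e → suc j ≡ k e → End e v j

      last-0 : ∀ {k} → 1 ℕ.≤ k → suc (k ℕ.∸ 1) ≡ k
      last-0 (ℕ.s≤s _) = refl

      end⇒ : ∀ e v {i} → i ℕ.< k e → (v ≡ s e × i ≡ 0) ⊎ (v ≡ t e × suc i ≡ k e) → End e v (step e i)
      end⇒ e v i<k alt with height (s e) ℕ.<? height (t e)
      end⇒ e v i<k (inj₁ (refl , refl)) | yes lt = lower (≡sym (ℕP.m≤n⇒m⊓n≡m (ℕP.<⇒≤ lt))) refl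
      end⇒ e v i<k (inj₂ (refl , p)) | yes lt = upper (≡sym (ℕP.m≤n⇒m⊔n≡n (ℕP.<⇒≤ lt))) p
      end⇒ e v i<k (inj₁ (refl , refl)) | no ge = upper (≡sym (ℕP.m≥n⇒m⊔n≡m (ℕP.≮⇒≥ ge))) (last-0 (k≥1 e))
      end⇒ e v i<k (inj₂ (refl , p)) | no ge = lower (≡sym (ℕP.m≥n⇒m⊓n≡n (ℕP.≮⇒≥ ge))) (ℕP.m≤n⇒m∸n≡0 (ℕP.≤-reflexive (≡sym p)))

      end⇐ : ∀ e v {i} → i ℕ.< k e → End e v (step e i) → (v ≡ s e × i ≡ 0) ⊎ (v ≡ t e × suc i ≡ k e)
      end⇐ e v i<k en with height (s e) ℕ.<? height (t e)
      end⇐ e v i<k (lower p q) | yes lt = inj₁ (height-inj _ _ (trans p (ℕP.m≤n⇒m⊓n≡m (ℕP.<⇒≤ lt))) , q)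
      end⇐ e v i<k (upper p q) | yes lt = inj₂ (height-inj _ _ (trans p (ℕP.m≤n⇒m⊔n≡n (ℕP.<⇒≤ lt))) , q)
      end⇐ e v i<k (lower p q) | no ge = inj₂ (height-inj _ _ (trans p (ℕP.m≥n⇒m⊓n≡n (ℕP.≮⇒≥ ge))) ,
        ℕP.≤-antisym i<k (ℕP.m∸n≡0⇒m≤n q))
      end⇐ e v {i} i<k (upper p q) | no ge = inj₁ (height-inj _ _ (trans p (ℕP.m≥n⇒m⊔n≡m (ℕP.≮⇒≥ ge))) ,
        ℕP.∸-cancelˡ-≡ (ℕP.<⇒≤ i<k) ℕ.z≤n (trans (ℕP.+-∸-assoc 1 i<k) q))

      within : ∀ e v → height v ≡ bot e ⊎ height v ≡ top e → Within e v
      within e v alt with height (s e) ℕ.<? height (t e)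
      within e v (inj₁ p) | yes lt = subst (Within e) (≡sym (height-inj _ _ (trans p (ℕP.m≤n⇒m⊓n≡m (ℕP.<⇒≤ lt))))) (within-src e)
      within e v (inj₂ p) | yes lt = subst (Within e) (≡sym (height-inj _ _ (trans p (ℕP.m≤n⇒m⊔n≡n (ℕP.<⇒≤ lt))))) (within-tgt e)
      within e v (inj₁ p) | no ge = subst (Within e) (≡sym (height-inj _ _ (trans p (ℕP.m≥n⇒m⊓n≡n (ℕP.≮⇒≥ ge))))) (within-tgt e)
      within e v (inj₂ p) | no ge = subst (Within e) (≡sym (height-inj _ _ (trans p (ℕP.m≥n⇒m⊔n≡m (ℕP.≮⇒≥ ge))))) (within-src e)

      bar-stair : ∀ e v j → End e v j → Touch (bar v) (St.stair e j)
      bar-stair e v .0 (lower p refl) = common ((St.col e 1 , ι (bot e)) ,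
        inj₂ (cong ι (≡sym p) , QP.≤-trans (proj₁ (within e v (inj₁ p))) (QP.<⇒≤ (St.lo<col e 1)) ,
                                QP.≤-trans (QP.<⇒≤ (St.col<hi e 1)) (proj₂ (within e v (inj₁ p)))) ,
        inj₁ (refl , QP.≤-refl , QP.<⇒≤ (St.row<top e 0)))
      bar-stair e v j (upper p q) = common ((St.col e (suc j) , ι (top e)) ,
        inj₂ (cong ι (≡sym p) , QP.≤-trans (proj₁ (within e v (inj₂ p))) (QP.<⇒≤ (St.lo<col e (suc j))) ,
                                QP.≤-trans (QP.<⇒≤ (St.col<hi e (suc j))) (proj₂ (within e v (inj₂ p)))) ,
        inj₁ (refl , QP.<⇒≤ (St.row<U e j) , QP.≤-reflexive (≡sym (St.top-last e j q))))

      ¬bar-stair : ∀ e v j → ¬ End e v j → ¬ Touch (bar v) (St.stair e j)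
      ¬bar-stair e v j ¬end tc with ℕP.<-cmp (height v) (bot e)
      ... | tri< lt _ _ = below {bar v} {St.stair e j} (QP.<-≤-trans (bar-top lt) (St.B≤row e j)) tc
      -- A step other than the lowest one avoids the bar below it: the stub is at `left v`, left of
      -- the strip, and the horizontal arm is below the row of the step.
      ... | tri≈ _ eq _ = at-bottom j (λ z → ¬end (lower eq z)) tc
        where
        at-bottom : ∀ j → j ≢ 0 → ¬ Touch (bar v) (St.stair e j)
        at-bottom zero ne _ = ne refl
        at-bottom (suc j) _ (common (p , inj₁ (a , _) , b)) =
          QP.<-irrefl (≡sym a) (QP.≤-<-trans (proj₁ (within e v (inj₁ eq))) (QP.<-≤-trans (St.lo<col e (suc (suc j))) (x≤On (St.stair e (suc j)) b)))
        at-bottom (suc j) _ (common (p , inj₂ (a , _) , b)) =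
          QP.<-irrefl (trans (cong ι (≡sym eq)) (≡sym a)) (QP.<-≤-trans (St.row-mono e {0} {suc j} (ℕ.s≤s ℕ.z≤n)) (y≤On (St.stair e (suc j)) b))
      ... | tri> _ _ gt with ℕP.<-cmp (height v) (top e)
      ...   | tri> _ _ gt' = below {St.stair e j} {bar v} (QP.≤-<-trans (St.top≤U e j) (ι-mono-< gt')) (touch-sym tc)
      ...   | tri≈ _ eq _ = below {St.stair e j} {bar v} (QP.<-≤-trans
                (subst (_< ι (top e)) (≡sym (St.top-inner e j (λ z → ¬end (upper eq z)))) (St.row<U e (suc j)))
                (QP.≤-reflexive (cong ι (≡sym eq)))) (touch-sym tc)
      ...   | tri< lt _ _ with avoid e v gt lt
      ...     | inj₁ hi≤left = left-of {St.stair e j} {bar v} (QP.<-≤-trans (St.col<hi e j) hi≤left) (touch-sym tc)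
      ...     | inj₂ right≤lo = left-of {bar v} {St.stair e j} (QP.≤-<-trans right≤lo (St.lo<col e (suc j))) tc

      ¬stairs : ∀ e f i j → e ≢ f → ¬ Touch (St.stair e i) (St.stair f j)
      ¬stairs e f i j e≢f tc with separate e f e≢f
      ... | inj₁ (inj₁ le) = left-of {St.stair e i} {St.stair f j} (QP.<-trans (QP.<-≤-trans (St.col<hi e i) le) (St.lo<col f (suc j))) tc
      ... | inj₁ (inj₂ le) = left-of {St.stair f j} {St.stair e i} (QP.<-trans (QP.<-≤-trans (St.col<hi f j) le) (St.lo<col e (suc i))) (touch-sym tc)
      ... | inj₂ (inj₁ lt) = below {St.stair e i} {St.stair f j} (QP.≤-<-trans (St.top≤U e i) (QP.<-≤-trans (ι-mono-< lt) (St.B≤row f j))) tc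
      ... | inj₂ (inj₂ lt) = below {St.stair f j} {St.stair e i} (QP.≤-<-trans (St.top≤U f j) (QP.<-≤-trans (ι-mono-< lt) (St.B≤row e i))) (touch-sym tc)

      ¬bars : ∀ u v → u ≢ v → ¬ Touch (bar u) (bar v)
      ¬bars u v u≢v tc with ℕP.<-cmp (height u) (height v)
      ... | tri< lt _ _ = below {bar u} {bar v} (bar-top lt) tc
      ... | tri≈ _ eq _ = u≢v (height-inj u v eq)
      ... | tri> _ _ gt = below {bar v} {bar u} (bar-top gt) (touch-sym tc)

      shape : SubV G k → El
      shape (inj₁ v) = bar v
      shape (inj₂ (e , i)) = St.stair e (step e (toℕ i))

      stairs : ∀ e (i j : Fin (k e)) → suc (toℕ i) ≡ toℕ j → Touch (shape (inj₂ (e , i))) (shape (inj₂ (e , j)))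
      stairs e i j eq with step-suc e (FP.toℕ<n i) (FP.toℕ<n j) eq
      ... | inj₁ p = subst (λ z → Touch (St.stair e (step e (toℕ i))) (St.stair e z)) p
                       (St.consecutive-touch e _ (subst (ℕ._< k e) (≡sym p) (step< e (FP.toℕ<n j))))
      ... | inj₂ p = touch-sym (subst (λ z → Touch (St.stair e (step e (toℕ j))) (St.stair e z)) p
                       (St.consecutive-touch e _ (subst (ℕ._< k e) (≡sym p) (step< e (FP.toℕ<n i)))))

      stairs⇐ : ∀ e (i j : Fin (k e)) → i ≢ j → Touch (shape (inj₂ (e , i))) (shape (inj₂ (e , j))) →
                suc (toℕ i) ≡ toℕ j ⊎ suc (toℕ j) ≡ toℕ i
      stairs⇐ e i j i≢j tc with ℕP.<-cmp (step e (toℕ i)) (step e (toℕ j))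
      ... | tri≈ _ eq _ = ⊥-elim (i≢j (FP.toℕ-injective (step-inj e (FP.toℕ<n i) (FP.toℕ<n j) eq)))
      ... | tri< lt _ _ with ℕP.m≤n⇒m<n∨m≡n lt
      ...   | inj₁ lt' = ⊥-elim (St.apart e _ _ lt' (step< e (FP.toℕ<n j)) tc)
      ...   | inj₂ eq = suc-step e (FP.toℕ<n i) (FP.toℕ<n j) eq
      stairs⇐ e i j i≢j tc | tri> _ _ gt with ℕP.m≤n⇒m<n∨m≡n gt
      ...   | inj₁ gt' = ⊥-elim (St.apart e _ _ gt' (step< e (FP.toℕ<n i)) (touch-sym tc))
      ...   | inj₂ eq = swap (suc-step e (FP.toℕ<n j) (FP.toℕ<n i) eq)

      to : ∀ p q → SubAdj G k p q → Touch (shape p) (shape q)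
      to (inj₁ v) (inj₂ (e , i)) adj = bar-stair e v _ (end⇒ e v (FP.toℕ<n i) adj)
      to (inj₂ (e , i)) (inj₁ v) adj = touch-sym (bar-stair e v _ (end⇒ e v (FP.toℕ<n i) adj))
      to (inj₂ (e , i)) (inj₂ (f , j)) (s≡ , t≡ , alt) = same (edge-≡ {G} e f s≡ t≡) i j alt
        where
        same : ∀ {e f} → e ≡ f → ∀ i j → suc (toℕ i) ≡ toℕ j ⊎ suc (toℕ j) ≡ toℕ i → Touch (shape (inj₂ (e , i))) (shape (inj₂ (f , j)))
        same {e} refl i j (inj₁ p) = stairs e i j p
        same {e} refl i j (inj₂ p) = touch-sym (stairs e j i p)

      end? : ∀ e v j → Dec (End e v j)
      end? e v j with height v ℕ.≟ bot e ×-dec j ℕ.≟ 0 | height v ℕ.≟ top e ×-dec suc j ℕ.≟ k e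
      ... | yes (p , q) | _ = yes (lower p q)
      ... | no _ | yes (p , q) = yes (upper p q)
      ... | no a | no b = no λ { (lower p q) → a (p , q) ; (upper p q) → b (p , q) }

      vertex-end : ∀ v e i → Touch (bar v) (shape (inj₂ (e , i))) → EndAdj G k v e i
      vertex-end v e i tc with end? e v (step e (toℕ i))
      ... | yes en = end⇐ e v (FP.toℕ<n i) en
      ... | no ¬en = ⊥-elim (¬bar-stair e v _ ¬en tc)

      edge-≟ : (e f : Edge G) → Dec (e ≡ f)
      edge-≟ e f = map′ (λ (p , q) → edge-≡ {G} e f p q) (λ { refl → refl , refl }) (s e F.≟ s f ×-dec t e F.≟ t f)

      from : ∀ p q → p ≢ q → Touch (shape p) (shape q) → SubAdj G k p q
      from (inj₁ u) (inj₁ v) ne tc = ¬bars u v (λ p → ne (cong inj₁ p)) tc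
      from (inj₁ v) (inj₂ (e , i)) _ tc = vertex-end v e i tc
      from (inj₂ (e , i)) (inj₁ v) _ tc = vertex-end v e i (touch-sym tc)
      from (inj₂ (e , i)) (inj₂ (f , j)) = both (edge-≟ e f) i j
        where
        both : ∀ {e f} → Dec (e ≡ f) → ∀ i j → _≢_ {A = SubV G k} (inj₂ (e , i)) (inj₂ (f , j)) →
               Touch (shape (inj₂ (e , i))) (shape (inj₂ (f , j))) → SubAdj G k (inj₂ (e , i)) (inj₂ (f , j))
        both {e} {f} (no e≢f) i j _ tc = ⊥-elim (¬stairs e f _ _ e≢f tc)
        both {e} (yes refl) i j ne tc = refl , refl , stairs⇐ e i j (λ { refl → ne refl }) tc

    layout⇒L : IsLGraph (Subdivision G k)
    layout⇒L = (λ p → toL (shape p)) , λ p q p≢q →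
      mk⇔ (λ adj → Equivalence.to (touch⇔ (shape p) (shape q)) (to p q adj))
          (λ m → from p q p≢q (Equivalence.from (touch⇔ (shape p) (shape q)) m))

-- Finite sums and the crossing form ω of two functions on a list.

module Sums where

  open import Data.Integer using (ℤ; 0ℤ; 1ℤ; _+_; _*_; _-_; -_)
  import Data.Integer.Properties as ℤP
  open import Data.Integer.Tactic.RingSolver using (solve-∀)
  open import Data.List using (List; []; _∷_; _++_; map; filter)
  open import Data.List.Membership.Propositional using (_∈_)
  open import Data.List.Relation.Unary.Any using (here; there)
  open import Data.List.Relation.Unary.All using ([]; _∷_; lookup)
  open import Data.List.Relation.Unary.Unique.Propositional using (Unique; []; _∷_)
  open import Data.List.Relation.Binary.Permutation.Propositional as Perm using (_↭_)
  open import Relation.Unary using (Decidable)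

  private
    variable
      A B : Set

  Σˡ : List A → (A → ℤ) → ℤ
  Σˡ [] f = 0ℤ
  Σˡ (x ∷ xs) f = f x + Σˡ xs f

  Σ-++ : ∀ (xs ys : List A) f → Σˡ (xs ++ ys) f ≡ Σˡ xs f + Σˡ ys f
  Σ-++ [] ys f = ≡sym (ℤP.+-identityˡ _)
  Σ-++ (x ∷ xs) ys f = trans (cong (f x +_) (Σ-++ xs ys f)) (≡sym (ℤP.+-assoc (f x) _ _))

  Σ-cong : ∀ (xs : List A) {f g} → (∀ {x} → x ∈ xs → f x ≡ g x) → Σˡ xs f ≡ Σˡ xs g
  Σ-cong [] eq = refl
  Σ-cong (x ∷ xs) eq = cong₂ _+_ (eq (here refl)) (Σ-cong xs (λ p → eq (there p)))

  Σ-0 : ∀ (xs : List A) {f} → (∀ {x} → x ∈ xs → f x ≡ 0ℤ) → Σˡ xs f ≡ 0ℤ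
  Σ-0 [] eq = refl
  Σ-0 (x ∷ xs) eq = cong₂ _+_ (eq (here refl)) (Σ-0 xs (λ p → eq (there p)))

  Σ-+ : ∀ (xs : List A) f g → Σˡ xs (λ x → f x + g x) ≡ Σˡ xs f + Σˡ xs g
  Σ-+ [] f g = refl
  Σ-+ (x ∷ xs) f g = trans (cong (f x + g x +_) (Σ-+ xs f g)) (l (f x) (g x) (Σˡ xs f) (Σˡ xs g))
    where
    l : ∀ a b c d → a + b + (c + d) ≡ a + c + (b + d)
    l = solve-∀

  Σ-*ˡ : ∀ (xs : List A) k f → Σˡ xs (λ x → k * f x) ≡ k * Σˡ xs f
  Σ-*ˡ [] k f = ≡sym (ℤP.*-zeroʳ k)
  Σ-*ˡ (x ∷ xs) k f = trans (cong (k * f x +_) (Σ-*ˡ xs k f)) (≡sym (ℤP.*-distribˡ-+ k (f x) (Σˡ xs f)))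

  Σ-*ʳ : ∀ (xs : List A) k f → Σˡ xs (λ x → f x * k) ≡ Σˡ xs f * k
  Σ-*ʳ xs k f = trans (Σ-cong xs (λ {x} _ → ℤP.*-comm (f x) k)) (trans (Σ-*ˡ xs k f) (ℤP.*-comm k _))

  Σ-neg : ∀ (xs : List A) f → Σˡ xs (λ x → - f x) ≡ - Σˡ xs f
  Σ-neg xs f = trans (Σ-cong xs (λ {x} _ → ≡sym (ℤP.-1*i≡-i (f x)))) (trans (Σ-*ˡ xs (- 1ℤ) f) (ℤP.-1*i≡-i _))

  Σ-- : ∀ (xs : List A) f g → Σˡ xs (λ x → f x - g x) ≡ Σˡ xs f - Σˡ xs g
  Σ-- xs f g = trans (Σ-+ xs f (λ x → - g x)) (cong (Σˡ xs f +_) (Σ-neg xs g))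

  Σ-swap : ∀ (xs : List A) (ys : List B) (f : A → B → ℤ) →
           Σˡ xs (λ x → Σˡ ys (f x)) ≡ Σˡ ys (λ y → Σˡ xs (λ x → f x y))
  Σ-swap [] ys f = ≡sym (Σ-0 ys (λ _ → refl))
  Σ-swap (x ∷ xs) ys f = trans (cong (Σˡ ys (f x) +_) (Σ-swap xs ys f)) (≡sym (Σ-+ ys (f x) (λ y → Σˡ xs (λ x → f x y))))

  Σ-map : ∀ (xs : List A) (h : A → B) f → Σˡ (map h xs) f ≡ Σˡ xs (λ x → f (h x))
  Σ-map [] h f = refl
  Σ-map (x ∷ xs) h f = cong (f (h x) +_) (Σ-map xs h f)

  Σ-↭ : ∀ {xs ys : List A} f → xs ↭ ys → Σˡ xs f ≡ Σˡ ys f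
  Σ-↭ f Perm.refl = refl
  Σ-↭ f (Perm.prep x p) = cong (f x +_) (Σ-↭ f p)
  Σ-↭ {ys = _ ∷ _ ∷ ys} f (Perm.swap x y p) =
    trans (cong (λ s → f x + (f y + s)) (Σ-↭ f p)) (l (f x) (f y) (Σˡ ys f))
    where
    l : ∀ a b c → a + (b + c) ≡ b + (a + c)
    l = solve-∀
  Σ-↭ f (Perm.trans p q) = trans (Σ-↭ f p) (Σ-↭ f q)

  Σ-filter : ∀ {P : A → Set} (P? : Decidable P) (xs : List A) {f} →
             (∀ {x} → x ∈ xs → ¬ P x → f x ≡ 0ℤ) → Σˡ (filter P? xs) f ≡ Σˡ xs f
  Σ-filter P? [] z = refl
  Σ-filter P? (x ∷ xs) {f} z with P? x
  ... | yes _ = cong (f x +_) (Σ-filter P? xs (λ p → z (there p)))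
  ... | no ¬p = trans (Σ-filter P? xs (λ p → z (there p)))
                  (trans (≡sym (ℤP.+-identityˡ _)) (cong (_+ Σˡ xs f) (≡sym (z (here refl) ¬p))))

  Σ-single : ∀ {xs : List A} {x f} → Unique xs → x ∈ xs → (∀ {y} → y ∈ xs → y ≢ x → f y ≡ 0ℤ) → Σˡ xs f ≡ f x
  Σ-single {xs = _ ∷ xs} {f = f} (d ∷ _) (here refl) z =
    trans (cong (f _ +_) (Σ-0 xs (λ p → z (there p) (λ e → lookup d p (≡sym e))))) (ℤP.+-identityʳ _)
  Σ-single {xs = y ∷ xs} {x} {f} (d ∷ u) (there p) z =
    trans (cong₂ _+_ (z (here refl) (lookup d p)) (Σ-single u p (λ q → z (there q)))) (ℤP.+-identityˡ _)

  -- Σ f aᵢ · g aⱼ - g aᵢ · f aⱼ  over i < j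
  ω : (f g : A → ℤ) → List A → ℤ
  ω f g [] = 0ℤ
  ω f g (x ∷ xs) = f x * Σˡ xs g - g x * Σˡ xs f + ω f g xs

  ω-++ : ∀ (f g : A → ℤ) xs ys →
         ω f g (xs ++ ys) ≡ ω f g xs + ω f g ys + (Σˡ xs f * Σˡ ys g - Σˡ xs g * Σˡ ys f)
  ω-++ f g [] ys = l (ω f g ys) (Σˡ ys g) (Σˡ ys f)
    where
    l : ∀ a b c → a ≡ 0ℤ + a + (0ℤ * b - 0ℤ * c)
    l = solve-∀
  ω-++ f g (x ∷ xs) ys rewrite Σ-++ xs ys f | Σ-++ xs ys g | ω-++ f g xs ys =
    l (f x) (g x) (Σˡ xs f) (Σˡ xs g) (Σˡ ys f) (Σˡ ys g) (ω f g xs) (ω f g ys)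
    where
    l : ∀ a b F G F' G' w w' →
        a * (G + G') - b * (F + F') + (w + w' + (F * G' - G * F')) ≡
        a * G - b * F + w + w' + ((a + F) * G' - (b + G) * F')
    l = solve-∀

  ω-cong : ∀ (xs : List A) {f f' g g'} → (∀ {x} → x ∈ xs → f x ≡ f' x) → (∀ {x} → x ∈ xs → g x ≡ g' x) →
           ω f g xs ≡ ω f' g' xs
  ω-cong [] _ _ = refl
  ω-cong (x ∷ xs) ef eg = cong₂ _+_
    (cong₂ _-_ (cong₂ _*_ (ef (here refl)) (Σ-cong xs (λ p → eg (there p))))
               (cong₂ _*_ (eg (here refl)) (Σ-cong xs (λ p → ef (there p)))))
    (ω-cong xs (λ p → ef (there p)) (λ p → eg (there p)))

  ω-0ˡ : ∀ (xs : List A) {f g} → (∀ {x} → x ∈ xs → f x ≡ 0ℤ) → ω f g xs ≡ 0ℤ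
  ω-0ˡ [] _ = refl
  ω-0ˡ (x ∷ xs) {f} {g} z rewrite z (here refl) | Σ-0 xs {f} (λ p → z (there p)) | ω-0ˡ xs {f} {g} (λ p → z (there p)) =
    l (Σˡ xs g) (g x)
    where
    l : ∀ a b → 0ℤ * a - b * 0ℤ + 0ℤ ≡ 0ℤ
    l = solve-∀

  ω-0ʳ : ∀ (xs : List A) {f g} → (∀ {x} → x ∈ xs → g x ≡ 0ℤ) → ω f g xs ≡ 0ℤ
  ω-0ʳ [] _ = refl
  ω-0ʳ (x ∷ xs) {f} {g} z rewrite z (here refl) | Σ-0 xs {g} (λ p → z (there p)) | ω-0ʳ xs {f} {g} (λ p → z (there p)) =
    l (Σˡ xs f) (f x)
    where
    l : ∀ a b → b * 0ℤ - 0ℤ * a + 0ℤ ≡ 0ℤ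
    l = solve-∀

  ω-map : ∀ (xs : List A) (h : A → B) f g → ω f g (map h xs) ≡ ω (λ x → f (h x)) (λ x → g (h x)) xs
  ω-map [] h f g = refl
  ω-map (x ∷ xs) h f g = cong₂ _+_ (cong₂ _-_ (cong (f (h x) *_) (Σ-map xs h g)) (cong (g (h x) *_) (Σ-map xs h f))) (ω-map xs h f g)

  ω-drop : ∀ (f g : A → ℤ) x xs → f x ≡ 0ℤ → g x ≡ 0ℤ → ω f g (x ∷ xs) ≡ ω f g xs
  ω-drop f g x xs p q rewrite p | q = l (Σˡ xs g) (Σˡ xs f) (ω f g xs)
    where
    l : ∀ a b c → 0ℤ * a - 0ℤ * b + c ≡ c
    l = solve-∀

  ω-filter : ∀ {P : A → Set} (P? : Decidable P) (xs : List A) {f g} →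
             (∀ {x} → x ∈ xs → ¬ P x → f x ≡ 0ℤ) → (∀ {x} → x ∈ xs → ¬ P x → g x ≡ 0ℤ) →
             ω f g (filter P? xs) ≡ ω f g xs
  ω-filter P? [] _ _ = refl
  ω-filter P? (x ∷ xs) {f} {g} zf zg with P? x
  ... | yes _ = cong₂ _+_ (cong₂ _-_ (cong (f x *_) (Σ-filter P? xs (λ p → zg (there p)))) (cong (g x *_) (Σ-filter P? xs (λ p → zf (there p)))))
                          (ω-filter P? xs (λ p → zf (there p)) (λ p → zg (there p)))
  ... | no ¬p = trans (ω-filter P? xs (λ p → zf (there p)) (λ p → zg (there p)))
                      (≡sym (ω-drop f g x xs (zf (here refl) ¬p) (zg (here refl) ¬p)))

  -- The two values differ by twice F G' - G F', and this is 0 because F' = - F and G' = - G. Hence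
  -- on balanced functions ω depends on the cyclic order only, and a list may represent a rotation.
  ω-rotate : ∀ (f g : A → ℤ) xs ys → Σˡ (xs ++ ys) f ≡ 0ℤ → Σˡ (xs ++ ys) g ≡ 0ℤ →
             ω f g (xs ++ ys) ≡ ω f g (ys ++ xs)
  ω-rotate f g xs ys zf zg =
    trans (ω-++ f g xs ys) (trans (l (ω f g xs) (ω f g ys) F G F' G' zf' zg') (≡sym (ω-++ f g ys xs)))
    where
    F = Σˡ xs f
    G = Σˡ xs g
    F' = Σˡ ys f
    G' = Σˡ ys g
    zf' = trans (≡sym (Σ-++ xs ys f)) zf
    zg' = trans (≡sym (Σ-++ xs ys g)) zg
    l₀ : ∀ a b F G F' G' → a + b + (F * G' - G * F') ≡
         b + a + (F' * G - G' * F) + (F + F') * (G' + G') - (F' + F') * (G + G')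
    l₀ = solve-∀
    l₁ : ∀ z x y → z + 0ℤ * x - y * 0ℤ ≡ z
    l₁ = solve-∀
    l : ∀ a b F G F' G' → F + F' ≡ 0ℤ → G + G' ≡ 0ℤ → a + b + (F * G' - G * F') ≡ b + a + (F' * G - G' * F)
    l a b F G F' G' p q = trans (l₀ a b F G F' G')
      (trans (cong₂ (λ u v → b + a + (F' * G - G' * F) + u * (G' + G') - (F' + F') * v) p q) (l₁ _ (G' + G') (F' + F')))

-- Contraction of edges preserves the crossing identity.

module Contraction where

  open Sums
  open import Data.Nat as ℕ using (ℕ)
  open import Data.Fin as F using (Fin)
  open import Data.Integer using (ℤ; 0ℤ; 1ℤ; _+_; _*_; _-_; -_)
  import Data.Integer.Properties as ℤP
  open import Data.Integer.Tactic.RingSolver using (solve-∀)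
  open import Data.List using (List; []; _∷_; _++_; map; filter; length)
  import Data.List.Properties as LP
  open import Data.List.Membership.Propositional using (_∈_; _∉_)
  open import Data.List.Membership.Propositional.Properties using (∈-++⁺ˡ; ∈-++⁺ʳ; ∈-++⁻; ∈-filter⁻; ∈-filter⁺)
  open import Data.List.Relation.Unary.Any using (here; there)
  open import Data.List.Relation.Unary.All as All using (All; []; _∷_)
  open import Data.List.Relation.Unary.AllPairs using ([]; _∷_)
  open import Data.List.Relation.Unary.Unique.Propositional using (Unique)
  import Data.List.Relation.Unary.Unique.Propositional.Properties as UniqueP
  import Data.List.Relation.Unary.Any as Any
  open import Relation.Nullary.Decidable using (_×-dec_; ¬?)

  ⟦_⟧ : {P : Set} → Dec P → ℤ
  ⟦ yes _ ⟧ = 1ℤ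
  ⟦ no _ ⟧ = 0ℤ

  ⟦⟧-yes : {P : Set} (d : Dec P) → P → ⟦ d ⟧ ≡ 1ℤ
  ⟦⟧-yes (yes _) _ = refl
  ⟦⟧-yes (no ¬p) p = ⊥-elim (¬p p)

  ⟦⟧-no : {P : Set} (d : Dec P) → ¬ P → ⟦ d ⟧ ≡ 0ℤ
  ⟦⟧-no (yes p) ¬p = ⊥-elim (¬p p)
  ⟦⟧-no (no _) _ = refl

  module _ {N : ℕ} where

    infix 4 _∈?_

    _∈?_ : (x : Fin N) (xs : List (Fin N)) → Dec (x ∈ xs)
    _∈?_ = D._∈?_ where import Data.List.Membership.DecPropositional F._≟_ as D

    -- The antisymmetric unit flow along the dart from `u` to `x`, evaluated at the dart from `a` to
    -- `b`.
    δ : Fin N → Fin N → Fin N → Fin N → ℤ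
    δ u x a b = ⟦ (a F.≟ u) ×-dec (b F.≟ x) ⟧ - ⟦ (b F.≟ u) ×-dec (a F.≟ x) ⟧

    δ-anti : ∀ u x a b → δ u x a b ≡ - δ u x b a
    δ-anti u x a b = l ⟦ (a F.≟ u) ×-dec (b F.≟ x) ⟧ ⟦ (b F.≟ u) ×-dec (a F.≟ x) ⟧
      where
      l : ∀ p q → p - q ≡ - (q - p)
      l = solve-∀

    δ-hit : ∀ u x → u ≢ x → δ u x u x ≡ 1ℤ
    δ-hit u x u≢x = cong₂ _-_ (⟦⟧-yes ((u F.≟ u) ×-dec (x F.≟ x)) (refl , refl))
                              (⟦⟧-no ((x F.≟ u) ×-dec (u F.≟ x)) (λ (_ , p) → u≢x p))

    δ-miss : ∀ {u x a b} → ¬ (a ≡ u × b ≡ x) → ¬ (b ≡ u × a ≡ x) → δ u x a b ≡ 0ℤ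
    δ-miss {u} {x} {a} {b} p q = cong₂ _-_ (⟦⟧-no ((a F.≟ u) ×-dec (b F.≟ x)) p) (⟦⟧-no ((b F.≟ u) ×-dec (a F.≟ x)) q)

  module Rotation {N : ℕ} (rot : Fin N → List (Fin N)) (rot-unique : ∀ v → Unique (rot v))
                  {A : Set} (near far : A → Fin N) where

    V = Fin N

    val : (V → V → ℤ) → A → ℤ
    val c d = c (near d) (far d)

    -- flows of the graph in which all vertices outside X are contracted to one vertex with rotation W
    record Flow (X : List V) (W : List A) (c : V → V → ℤ) : Set where
      field
        anti  : ∀ a b → c a b ≡ - c b a
        dead  : ∀ {a b} → a ∉ X → b ∉ X → c a b ≡ 0ℤ
        cons  : ∀ {z} → z ∈ X → Σˡ (rot z) (c z) ≡ 0ℤ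
        total : Σˡ W (val c) ≡ 0ℤ
    open Flow

    -- any two flows cross algebraically zero times
    Spherical : List V → List A → Set
    Spherical X W = ∀ {c c'} → Flow X W c → Flow X W c' →
      ω (val c) (val c') W + Σˡ X (λ x → ω (c x) (c' x) (rot x)) ≡ 0ℤ

    opaque
      _∖_ : List V → V → List V
      X ∖ x = filter (λ z → ¬? (z F.≟ x)) X

      ∈-∖⁻ : ∀ {X x z} → z ∈ X ∖ x → z ∈ X × z ≢ x
      ∈-∖⁻ {X} {x} = ∈-filter⁻ (λ z → ¬? (z F.≟ x))

      ∈-∖⁺ : ∀ {X x z} → z ∈ X → z ≢ x → z ∈ X ∖ x
      ∈-∖⁺ {X} {x} = ∈-filter⁺ (λ z → ¬? (z F.≟ x))

      unique-∖ : ∀ {X x} → Unique X → Unique (X ∖ x)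
      unique-∖ {x = x} = UniqueP.filter⁺ (λ z → ¬? (z F.≟ x))

      length-∖ : ∀ {X x} → x ∈ X → length (X ∖ x) ℕ.< length X
      length-∖ {X} {x} p = LP.filter-notAll (λ z → ¬? (z F.≟ x)) X (Any.map (λ e ne → ne (≡sym e)) p)

      Σ-∖ : ∀ {X x} → Unique X → x ∈ X → ∀ f → Σˡ X f ≡ f x + Σˡ (X ∖ x) f
      Σ-∖ {x ∷ X} {x} (d ∷ _) (here refl) f with x F.≟ x
      ... | no ne = ⊥-elim (ne refl)
      ... | yes _ = cong (f x +_) (cong (λ Y → Σˡ Y f) (≡sym (LP.filter-all (λ z → ¬? (z F.≟ x)) (All.map (λ p q → p (≡sym q)) d))))
      Σ-∖ {y ∷ X} {x} (d ∷ u) (there p) f with y F.≟ x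
      ... | yes refl = ⊥-elim (All.lookup d p refl)
      ... | no _ = trans (cong (f y +_) (Σ-∖ u p f)) (l (f y) (f x) (Σˡ (X ∖ x) f))
        where
        l : ∀ a b c → a + (b + c) ≡ b + (a + c)
        l = solve-∀

    x∉X∖x : ∀ {X x} → x ∉ X ∖ x
    x∉X∖x p = proj₂ (∈-∖⁻ p) refl

    Σ-far : ∀ {x} (R : List A) c → (∀ {d} → d ∈ R → near d ≡ x) → Σˡ R (val c) ≡ Σˡ (map far R) (c x)
    Σ-far R c eq = trans (Σ-cong R (λ {d} p → cong (λ a → c a (far d)) (eq p))) (≡sym (Σ-map R far (c _)))

    ω-far : ∀ {x} (R : List A) c c' → (∀ {d} → d ∈ R → near d ≡ x) → ω (val c) (val c') R ≡ ω (c x) (c' x) (map far R)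
    ω-far R c c' eq = trans (ω-cong R (λ {d} p → cong (λ a → c a (far d)) (eq p)) (λ {d} p → cong (λ a → c' a (far d)) (eq p)))
                            (≡sym (ω-map R far (c _) (c' _)))

    -- contracting a vertex into an exhausted component
    module Restart {X : List V} {x : V} (uX : Unique X) (x∈X : x ∈ X) (R : List A)
                   (near-R : ∀ {d} → d ∈ R → near d ≡ x) (far-R : map far R ≡ filter (_∈? (X ∖ x)) (rot x)) where

      private
        ΣR : ∀ {c} → Flow (X ∖ x) R c → Σˡ (rot x) (c x) ≡ Σˡ R (val c)
        ΣR {c} fl = ≡sym (trans (Σ-far R c near-R) (trans (cong (λ l → Σˡ l (c x)) far-R)
          (Σ-filter (_∈? (X ∖ x)) (rot x) (λ _ p → dead fl x∉X∖x p))))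

        -- No edge joins the contracted set to `X`, so `x` takes over the role of the contracted
        -- vertex: conservation at `x` is the `total` of the given flow.
        extend : ∀ {c} → Flow (X ∖ x) R c → Flow X [] c
        extend fl = record
          { anti = anti fl
          ; dead = λ p q → dead fl (λ r → p (proj₁ (∈-∖⁻ r))) (λ r → q (proj₁ (∈-∖⁻ r)))
          ; cons = λ {z} p → cons′ z p (z F.≟ x)
          ; total = refl }
          where
          cons′ : ∀ z → z ∈ X → Dec (z ≡ x) → Σˡ (rot z) _ ≡ 0ℤ
          cons′ z p (yes refl) = trans (ΣR fl) (total fl)
          cons′ z p (no ne) = cons fl (∈-∖⁺ p ne)

      spherical : Spherical X [] → Spherical (X ∖ x) R
      spherical J {c} {c'} fl fl' = begin
        ω (val c) (val c') R + Σˡ (X ∖ x) ψ          ≡⟨ cong (_+ Σˡ (X ∖ x) ψ) ωR ⟩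
        ψ x + Σˡ (X ∖ x) ψ                          ≡⟨ Σ-∖ uX x∈X ψ ⟨
        Σˡ X ψ                                      ≡⟨ ℤP.+-identityˡ _ ⟨
        0ℤ + Σˡ X ψ                                 ≡⟨ J (extend fl) (extend fl') ⟩
        0ℤ                                          ∎
        where
        open ≡-Reasoning
        ψ = λ z → ω (c z) (c' z) (rot z)
        ωR : ω (val c) (val c') R ≡ ψ x
        ωR = trans (ω-far R c c' near-R) (trans (cong (ω (c x) (c' x)) far-R)
          (ω-filter (_∈? (X ∖ x)) (rot x) (λ _ p → dead fl x∉X∖x p) (λ _ p → dead fl' x∉X∖x p)))

    -- contracting the first edge of a block of parallel edges and deleting the others
    module Merge {X : List V} {x : V} (uX : Unique X) (x∈X : x ∈ X)
      {L : List A} {b : A} {B C : List A} (P Q : List V) (R : List A)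
      (far-b : far b ≡ x) (far-B : ∀ {d} → d ∈ B → far d ≡ x) (near-B : ∀ {d} → d ∈ B → near d ≢ near b)
      (far-L : ∀ {d} → d ∈ L → far d ≢ x) (far-C : ∀ {d} → d ∈ C → far d ≢ x)
      (near∉ : ∀ {d} → d ∈ L ++ (b ∷ B) ++ C → near d ∉ X)
      (rot-x : rot x ≡ P ++ near b ∷ Q)
      (near-R : ∀ {d} → d ∈ R → near d ≡ x) (far-R : map far R ≡ filter (_∈? (X ∖ x)) (Q ++ P)) where

      private
        W  = L ++ (b ∷ B) ++ C
        W' = L ++ R ++ C
        u = near b

        u∉X : u ∉ X
        u∉X = near∉ (∈-++⁺ʳ L (here refl))

        u≢x : u ≢ x
        u≢x p = u∉X (subst (_∈ X) (≡sym p) x∈X)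

        split-unique : ∀ {ys} (zs : List V) → Unique (zs ++ u ∷ ys) → u ∉ zs × u ∉ ys
        split-unique [] (d ∷ _) = (λ ()) , λ p → All.lookup d p refl
        split-unique (z ∷ zs) (d ∷ uq) =
          (λ { (here refl) → All.lookup d (∈-++⁺ʳ zs (here refl)) refl ; (there p) → proj₁ (split-unique zs uq) p }) ,
          proj₂ (split-unique zs uq)

        u∉ : u ∉ P × u ∉ Q
        u∉ = split-unique P (subst Unique rot-x (rot-unique x))

        u∉QP : u ∉ Q ++ P
        u∉QP p with ∈-++⁻ Q p
        ... | inj₁ q = proj₂ u∉ q
        ... | inj₂ q = proj₁ u∉ q

        ∈L : ∀ {d} → d ∈ L → d ∈ W
        ∈L = ∈-++⁺ˡ
        ∈B : ∀ {d} → d ∈ B → d ∈ W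
        ∈B p = ∈-++⁺ʳ L (∈-++⁺ˡ (there p))
        ∈C : ∀ {d} → d ∈ C → d ∈ W
        ∈C p = ∈-++⁺ʳ L (∈-++⁺ʳ (b ∷ B) p)

        -- In the contracted graph the edge from `u` to `x` carries nothing. Conservation at `x`
        -- before the contraction forces the amount `s` on `b`, and the edges parallel to `b` are
        -- left with 0.
        module Lift {c : V → V → ℤ} (fl : Flow (X ∖ x) W' c) where
          s : ℤ
          s = Σˡ (Q ++ P) (c x)

          ĉ : V → V → ℤ
          ĉ v w = c v w + s * δ u x v w

          same : ∀ {v w} → ¬ (v ≡ u × w ≡ x) → ¬ (w ≡ u × v ≡ x) → ĉ v w ≡ c v w
          same {v} {w} p q = trans (cong (λ k → c v w + s * k) (δ-miss p q)) (l (c v w) s)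
            where
            l : ∀ a b → a + b * 0ℤ ≡ a
            l = solve-∀

          ĉ-ux : ĉ u x ≡ s
          ĉ-ux = trans (cong₂ (λ a b → a + s * b) (dead fl (λ p → u∉X (proj₁ (∈-∖⁻ p))) x∉X∖x) (δ-hit u x u≢x)) (l s)
            where
            l : ∀ s → 0ℤ + s * 1ℤ ≡ s
            l = solve-∀

          ĉ-anti : ∀ v w → ĉ v w ≡ - ĉ w v
          ĉ-anti v w = trans (cong₂ (λ p q → p + s * q) (anti fl v w) (δ-anti u x v w)) (l (c w v) s (δ u x w v))
            where
            l : ∀ a s d → - a + s * - d ≡ - (a + s * d)
            l = solve-∀

          ĉ-QP : ∀ {w} → w ∈ Q ++ P → ĉ x w ≡ c x w
          ĉ-QP p = same (λ (e , _) → u≢x (≡sym e)) (λ { (refl , _) → u∉QP p })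

          ΣQP : Σˡ (Q ++ P) (ĉ x) ≡ s
          ΣQP = Σ-cong (Q ++ P) ĉ-QP

          ΣuQP : Σˡ ((u ∷ Q) ++ P) (ĉ x) ≡ 0ℤ
          ΣuQP = trans (cong₂ _+_ (trans (ĉ-anti x u) (cong -_ ĉ-ux)) ΣQP) (ℤP.+-inverseˡ s)

          Σrot : Σˡ (P ++ u ∷ Q) (ĉ x) ≡ 0ℤ
          Σrot = trans (Σ-++ P (u ∷ Q) (ĉ x)) (trans (ℤP.+-comm (Σˡ P (ĉ x)) _)
                   (trans (≡sym (Σ-++ (u ∷ Q) P (ĉ x))) ΣuQP))

          same-L : ∀ {d} → d ∈ L → val ĉ d ≡ val c d
          same-L p = same (λ (_ , e) → far-L p e) (λ (_ , e) → near∉ (∈L p) (subst (_∈ X) (≡sym e) x∈X))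

          same-C : ∀ {d} → d ∈ C → val ĉ d ≡ val c d
          same-C p = same (λ (_ , e) → far-C p e) (λ (_ , e) → near∉ (∈C p) (subst (_∈ X) (≡sym e) x∈X))

          ĉ-B : ∀ {d} → d ∈ B → val ĉ d ≡ 0ℤ
          ĉ-B {d} p = trans (same (λ (e , _) → near-B p e) (λ (_ , e) → near∉ (∈B p) (subst (_∈ X) (≡sym e) x∈X)))
            (dead fl (λ q → near∉ (∈B p) (proj₁ (∈-∖⁻ q))) (λ q → x∉X∖x (subst (_∈ X ∖ x) (far-B p) q)))

          ĉ-b : val ĉ b ≡ s
          ĉ-b = trans (cong (ĉ u) far-b) ĉ-ux

          ΣbB : Σˡ (b ∷ B) (val ĉ) ≡ s
          ΣbB = trans (cong₂ _+_ ĉ-b (Σ-0 B ĉ-B)) (ℤP.+-identityʳ s)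

          ΣR : Σˡ R (val c) ≡ s
          ΣR = trans (Σ-far R c near-R) (trans (cong (λ l → Σˡ l (c x)) far-R)
                 (Σ-filter (_∈? (X ∖ x)) (Q ++ P) (λ _ p → dead fl x∉X∖x p)))

          Σpieces : ∀ (M : List A) f → Σˡ (L ++ M ++ C) f ≡ Σˡ L f + (Σˡ M f + Σˡ C f)
          Σpieces M f = trans (Σ-++ L (M ++ C) f) (cong (Σˡ L f +_) (Σ-++ M C f))

          flow : Flow X W ĉ
          flow = record
            { anti = ĉ-anti
            ; dead = λ p q → trans (same (λ (_ , e) → q (subst (_∈ X) (≡sym e) x∈X)) (λ (_ , e) → p (subst (_∈ X) (≡sym e) x∈X)))
                       (dead fl (λ r → p (proj₁ (∈-∖⁻ r))) (λ r → q (proj₁ (∈-∖⁻ r))))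
            ; cons = λ {z} p → cons′ z p (z F.≟ x)
            ; total = trans (Σpieces (b ∷ B) (val ĉ)) (trans
                (cong₂ _+_ (Σ-cong L same-L) (cong₂ _+_ (trans ΣbB (≡sym ΣR)) (Σ-cong C same-C)))
                (trans (≡sym (Σpieces R (val c))) (total fl))) }
            where
            cons′ : ∀ z → z ∈ X → Dec (z ≡ x) → Σˡ (rot z) (ĉ z) ≡ 0ℤ
            cons′ z p (yes refl) = trans (cong (λ l → Σˡ l (ĉ x)) rot-x) Σrot
            cons′ z p (no ne) = trans (Σ-cong (rot z) (λ _ → same (λ { (refl , _) → u∉X p }) (λ (_ , e) → ne e)))
                                  (cons fl (∈-∖⁺ p ne))

      spherical : Spherical X W → Spherical (X ∖ x) W'
      spherical J {c} {c'} fl fl' = begin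
        ω (val c) (val c') W' + Σˡ (X ∖ x) ψ                        ≡⟨ cong₂ _+_ ωW' (Σ-cong (X ∖ x) ψ-same) ⟩
        ω (val G.ĉ) (val G'.ĉ) W + ψ̂ x + Σˡ (X ∖ x) ψ̂              ≡⟨ ℤP.+-assoc (ω (val G.ĉ) (val G'.ĉ) W) _ _ ⟩
        ω (val G.ĉ) (val G'.ĉ) W + (ψ̂ x + Σˡ (X ∖ x) ψ̂)            ≡⟨ cong (ω (val G.ĉ) (val G'.ĉ) W +_) (Σ-∖ uX x∈X ψ̂) ⟨
        ω (val G.ĉ) (val G'.ĉ) W + Σˡ X ψ̂                          ≡⟨ J G.flow G'.flow ⟩
        0ℤ                                                        ∎
        where
        open ≡-Reasoning
        module G = Lift fl
        module G' = Lift fl'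
        ψ ψ̂ : V → ℤ
        ψ z = ω (c z) (c' z) (rot z)
        ψ̂ z = ω (G.ĉ z) (G'.ĉ z) (rot z)
        ψ-same : ∀ {z} → z ∈ X ∖ x → ψ z ≡ ψ̂ z
        ψ-same {z} p = ω-cong (rot z)
          (λ _ → ≡sym (G.same (λ { (refl , _) → u∉X (proj₁ (∈-∖⁻ p)) }) (λ (_ , e) → proj₂ (∈-∖⁻ p) e)))
          (λ _ → ≡sym (G'.same (λ { (refl , _) → u∉X (proj₁ (∈-∖⁻ p)) }) (λ (_ , e) → proj₂ (∈-∖⁻ p) e)))
        ωR : ω (val c) (val c') R ≡ ω (c x) (c' x) (Q ++ P)
        ωR = trans (ω-far R c c' near-R) (trans (cong (ω (c x) (c' x)) far-R)
          (ω-filter (_∈? (X ∖ x)) (Q ++ P) (λ _ p → dead fl x∉X∖x p) (λ _ p → dead fl' x∉X∖x p)))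
        -- Rotating brings `u` to the front of the rotation at `x`; there its two terms, products of
        -- the same amounts s and s', cancel.
        ψ̂x : ψ̂ x ≡ ω (val c) (val c') R
        ψ̂x = begin
          ω (G.ĉ x) (G'.ĉ x) (rot x)         ≡⟨ cong (ω (G.ĉ x) (G'.ĉ x)) rot-x ⟩
          ω (G.ĉ x) (G'.ĉ x) (P ++ u ∷ Q)    ≡⟨ ω-rotate (G.ĉ x) (G'.ĉ x) P (u ∷ Q) G.Σrot G'.Σrot ⟩
          ω (G.ĉ x) (G'.ĉ x) (u ∷ Q ++ P)    ≡⟨ cong₂ _+_ (cong₂ _-_
                                                 (cong₂ _*_ (trans (G.ĉ-anti x u) (cong -_ G.ĉ-ux)) G'.ΣQP)
                                                 (cong₂ _*_ (trans (G'.ĉ-anti x u) (cong -_ G'.ĉ-ux)) G.ΣQP))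
                                                 (ω-cong (Q ++ P) G.ĉ-QP G'.ĉ-QP) ⟩
          - G.s * G'.s - - G'.s * G.s + ω (c x) (c' x) (Q ++ P) ≡⟨ l G.s G'.s (ω (c x) (c' x) (Q ++ P)) ⟩
          ω (c x) (c' x) (Q ++ P)            ≡⟨ ωR ⟨
          ω (val c) (val c') R               ∎
          where
          l : ∀ s t w → - s * t - - t * s + w ≡ w
          l = solve-∀
        ωbB : ω (val G.ĉ) (val G'.ĉ) (b ∷ B) ≡ 0ℤ
        ωbB = trans (cong₂ _+_ (cong₂ _-_ (cong (val G.ĉ b *_) (Σ-0 B G'.ĉ-B)) (cong (val G'.ĉ b *_) (Σ-0 B G.ĉ-B))) (ω-0ˡ B {val G.ĉ} {val G'.ĉ} G.ĉ-B))
                    (l (val G.ĉ b) (val G'.ĉ b))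
          where
          l : ∀ a b → a * 0ℤ - b * 0ℤ + 0ℤ ≡ 0ℤ
          l = solve-∀
        -- A middle piece enters ω of the whole list only through its own ω and its two sums. The
        -- sums over `b ∷ B` and over `R` are equal and ω of `b ∷ B` is 0, so the exchange adds
        -- precisely ω over `R`, which is the term of `x` that leaves the sum over `X`.
        pieces : ∀ f g (M : List A) → ω f g (L ++ M ++ C) ≡
          ω f g L + (ω f g M + ω f g C + (Σˡ M f * Σˡ C g - Σˡ M g * Σˡ C f)) +
          (Σˡ L f * (Σˡ M g + Σˡ C g) - Σˡ L g * (Σˡ M f + Σˡ C f))
        pieces f g M = trans (ω-++ f g L (M ++ C)) (cong₂ _+_ (cong (ω f g L +_) (ω-++ f g M C))
          (cong₂ _-_ (cong (Σˡ L f *_) (Σ-++ M C g)) (cong (Σˡ L g *_) (Σ-++ M C f))))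
        form : (wL wM wC ΣL ΣL' ΣM ΣM' ΣC ΣC' : ℤ) → ℤ
        form wL wM wC ΣL ΣL' ΣM ΣM' ΣC ΣC' =
          wL + (wM + wC + (ΣM * ΣC' - ΣM' * ΣC)) + (ΣL * (ΣM' + ΣC') - ΣL' * (ΣM + ΣC))
        shift : ∀ wL w wC ΣL ΣL' ΣM ΣM' ΣC ΣC' →
          form wL w wC ΣL ΣL' ΣM ΣM' ΣC ΣC' ≡ form wL 0ℤ wC ΣL ΣL' ΣM ΣM' ΣC ΣC' + w
        shift = l
          where
          l : ∀ wL w wC ΣL ΣL' ΣM ΣM' ΣC ΣC' →
            wL + (w + wC + (ΣM * ΣC' - ΣM' * ΣC)) + (ΣL * (ΣM' + ΣC') - ΣL' * (ΣM + ΣC)) ≡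
            wL + (0ℤ + wC + (ΣM * ΣC' - ΣM' * ΣC)) + (ΣL * (ΣM' + ΣC') - ΣL' * (ΣM + ΣC)) + w
          l = solve-∀
        form-cong : ∀ {wL wL' wM wM' wC wC' p p' q q' r r' s s' t t' v v'} →
          wL ≡ wL' → wM ≡ wM' → wC ≡ wC' → p ≡ p' → q ≡ q' → r ≡ r' → s ≡ s' → t ≡ t' → v ≡ v' →
          form wL wM wC p q r s t v ≡ form wL' wM' wC' p' q' r' s' t' v'
        form-cong refl refl refl refl refl refl refl refl refl = refl
        ωW' : ω (val c) (val c') W' ≡ ω (val G.ĉ) (val G'.ĉ) W + ψ̂ x
        ωW' = begin
          ω (val c) (val c') W'     ≡⟨ pieces (val c) (val c') R ⟩
          form (ω (val c) (val c') L) (ω (val c) (val c') R) (ω (val c) (val c') C)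
               (Σˡ L (val c)) (Σˡ L (val c')) (Σˡ R (val c)) (Σˡ R (val c')) (Σˡ C (val c)) (Σˡ C (val c'))
            ≡⟨ shift (ω (val c) (val c') L) (ω (val c) (val c') R) (ω (val c) (val c') C) (Σˡ L (val c)) (Σˡ L (val c')) (Σˡ R (val c)) (Σˡ R (val c')) (Σˡ C (val c)) (Σˡ C (val c')) ⟩
          form (ω (val c) (val c') L) 0ℤ (ω (val c) (val c') C)
               (Σˡ L (val c)) (Σˡ L (val c')) (Σˡ R (val c)) (Σˡ R (val c')) (Σˡ C (val c)) (Σˡ C (val c'))
            + ω (val c) (val c') R
            ≡⟨ cong₂ _+_ (form-cong (≡sym (ω-cong L G.same-L G'.same-L)) (≡sym ωbB) (≡sym (ω-cong C G.same-C G'.same-C))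
                 (≡sym (Σ-cong L G.same-L)) (≡sym (Σ-cong L G'.same-L)) (trans G.ΣR (≡sym G.ΣbB)) (trans G'.ΣR (≡sym G'.ΣbB))
                 (≡sym (Σ-cong C G.same-C)) (≡sym (Σ-cong C G'.same-C))) (≡sym ψ̂x) ⟩
          form (ω (val G.ĉ) (val G'.ĉ) L) (ω (val G.ĉ) (val G'.ĉ) (b ∷ B)) (ω (val G.ĉ) (val G'.ĉ) C)
               (Σˡ L (val G.ĉ)) (Σˡ L (val G'.ĉ)) (Σˡ (b ∷ B) (val G.ĉ)) (Σˡ (b ∷ B) (val G'.ĉ)) (Σˡ C (val G.ĉ)) (Σˡ C (val G'.ĉ))
            + ψ̂ x
            ≡⟨ cong (_+ ψ̂ x) (pieces (val G.ĉ) (val G'.ĉ) (b ∷ B)) ⟨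
          ω (val G.ĉ) (val G'.ĉ) W + ψ̂ x ∎

-- Non-crossing sequences: alternation contradicts the crossing identity, and its absence yields a
-- block.

module Blocks where

  open Sums
  open Contraction
  open import Data.Nat as ℕ using (ℕ; zero; suc)
  import Data.Nat.Properties as ℕP
  open import Data.Fin as F using (Fin)
  open import Data.Integer as ℤ using (ℤ; 0ℤ; 1ℤ; _+_; _*_; _-_; -_)
  import Data.Integer.Properties as ℤP
  open import Data.Integer.Tactic.RingSolver using (solve-∀)
  open import Data.List using (List; []; _∷_; _++_; length)
  import Data.List.Properties as LP
  open import Data.List.Membership.Propositional using (_∈_; _∉_)
  open import Data.List.Relation.Unary.Any using (here; there)
  open import Data.List.Relation.Unary.All as All using (All; []; _∷_)
  import Data.List.Relation.Unary.All.Properties as AllP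
  open import Data.List.Relation.Unary.AllPairs using (AllPairs; []; _∷_)
  open import Data.List.Relation.Unary.Unique.Propositional using (Unique)
  open import Data.List.Relation.Binary.Sublist.Propositional using (_⊆_; []; _∷_; _∷ʳ_; ⊆-refl; ⊆-trans; from∈)
  open import Data.List.Relation.Binary.Sublist.Propositional.Properties using (++⁺ˡ; ++⁺ʳ; ++⁺; All-resp-⊆; Any-resp-⊆)

  span : ∀ {A : Set} {P : A → Set} (P? : ∀ a → Dec (P a)) (xs : List A) →
         Σ[ B ∈ List A ] Σ[ rest ∈ List A ] xs ≡ B ++ rest × All P B × (∀ {r rs} → rest ≡ r ∷ rs → ¬ P r)
  span P? [] = [] , [] , refl , [] , λ ()
  span P? (x ∷ xs) with P? x
  ... | no ¬p = [] , x ∷ xs , refl , [] , λ { refl → ¬p }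
  ... | yes p = let (B , rest , eq , all , nr) = span P? xs in x ∷ B , rest , cong (x ∷_) eq , p ∷ all , nr

  first : ∀ {A : Set} {P : A → Set} (P? : ∀ a → Dec (P a)) (xs : List A) →
          All (λ a → ¬ P a) xs ⊎ Σ[ M ∈ List A ] Σ[ a ∈ A ] Σ[ N ∈ List A ] xs ≡ M ++ a ∷ N × All (λ a → ¬ P a) M × P a
  first P? [] = inj₁ []
  first P? (x ∷ xs) with P? x
  ... | yes p = inj₂ ([] , x , xs , refl , [] , p)
  ... | no ¬p with first P? xs
  ...   | inj₁ none = inj₁ (¬p ∷ none)
  ...   | inj₂ (M , a , N , eq , none , p) = inj₂ (x ∷ M , a , N , cong (x ∷_) eq , ¬p ∷ none , p)

  module _ {A : Set} {K : Set} (_≟_ : (a b : K) → Dec (a ≡ b)) (key : A → K) where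

    NoAlternation : List A → Set
    NoAlternation W = ∀ {d₁ d₂ d₃ d₄} → (d₁ ∷ d₂ ∷ d₃ ∷ d₄ ∷ []) ⊆ W → key d₁ ≡ key d₃ → key d₂ ≡ key d₄ → key d₁ ≡ key d₂

    record Block (W : List A) : Set where
      field
        {L} : List A
        {b} : A
        {B C} : List A
        split : W ≡ L ++ (b ∷ B) ++ C
        key-B : All (λ d → key d ≡ key b) B
        key-L : All (λ d → key d ≢ key b) L
        key-C : All (λ d → key d ≢ key b) C

    -- If the key of the first entry returns after its initial run, the entries between the run and
    -- the first return form a shorter non-crossing list. A block found there is a block of the
    -- whole list: a later entry d with the same key as its member b would make a, b, a′, d
    -- alternate.
    block : ∀ k a W → length W ℕ.≤ k → NoAlternation (a ∷ W) → Block (a ∷ W)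
    block k a W le na with span (λ d → key d ≟ key a) W
    ... | B , rest , refl , all-B , ¬head with first (λ d → key d ≟ key a) rest
    ...   | inj₁ none = record { L = [] ; split = refl ; key-B = all-B ; key-L = [] ; key-C = none }
    ...   | inj₂ ([] , a′ , N , refl , _ , p) = ⊥-elim (¬head refl p)
    block zero a W le na | B , rest , refl , all-B , ¬head | inj₂ (c ∷ M , a′ , N , refl , none , p) with ℕP.n≤0⇒n≡0 le
    ... | eq = ⊥-elim (no-room B eq)
      where
      no-room : ∀ B → length (B ++ (c ∷ M) ++ a′ ∷ N) ≢ 0
      no-room [] ()
      no-room (_ ∷ _) ()
    block (suc k) a W le na | B , rest , refl , all-B , ¬head | inj₂ (c ∷ M , a′ , N , refl , none , p) = record
      { L = a ∷ B ++ Bl.L ; b = Bl.b ; B = Bl.B ; C = Bl.C ++ a′ ∷ N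
      ; split = cong (a ∷_) (trans (cong (λ z → B ++ z ++ a′ ∷ N) Bl.split) reassoc)
      ; key-B = Bl.key-B
      ; key-L = (λ e → b≢a (≡sym e)) ∷ AllP.++⁺ (All.map (λ e f → b≢a (trans (≡sym f) e)) all-B) Bl.key-L
      ; key-C = AllP.++⁺ Bl.key-C ((λ e → b≢a (trans (≡sym e) p)) ∷ All.tabulate not-later) }
      where
      inside : length M ℕ.≤ k
      inside = ℕP.≤-pred (ℕP.≤-trans (ℕP.≤-trans (ℕP.m≤m+n (suc (length M)) (length (a′ ∷ N)))
        (ℕP.≤-reflexive (≡sym (LP.length-++ (c ∷ M)))))
        (ℕP.≤-trans (ℕP.m≤n+m _ (length B)) (ℕP.≤-trans (ℕP.≤-reflexive (≡sym (LP.length-++ B))) le)))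
      M⊆ : (c ∷ M) ⊆ (a ∷ B ++ (c ∷ M) ++ a′ ∷ N)
      M⊆ = a ∷ʳ ++⁺ˡ B (++⁺ʳ (a′ ∷ N) ⊆-refl)
      bl : Block (c ∷ M)
      bl = block k c M inside (λ s → na (⊆-trans s M⊆))
      module Bl = Block bl
      b∈ : Bl.b ∈ c ∷ M
      b∈ = subst (Bl.b ∈_) (≡sym Bl.split) (∈-mid Bl.L)
        where
        ∈-mid : ∀ {b : A} {B} L → b ∈ L ++ b ∷ B
        ∈-mid [] = here refl
        ∈-mid (_ ∷ L) = there (∈-mid L)
      b≢a : key Bl.b ≢ key a
      b≢a = All.lookup none b∈
      not-later : ∀ {d} → d ∈ N → key d ≢ key Bl.b
      not-later d∈ e = b≢a (≡sym (na (refl ∷ ++⁺ˡ B (++⁺ (from∈ b∈) (refl ∷ from∈ d∈))) (≡sym p) (≡sym e)))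
      reassoc : B ++ (Bl.L ++ (Bl.b ∷ Bl.B) ++ Bl.C) ++ a′ ∷ N ≡ (B ++ Bl.L) ++ (Bl.b ∷ Bl.B) ++ Bl.C ++ a′ ∷ N
      reassoc = trans (cong (B ++_) (trans (LP.++-assoc Bl.L _ _) (cong (Bl.L ++_) (LP.++-assoc (Bl.b ∷ Bl.B) Bl.C _))))
                      (≡sym (LP.++-assoc B Bl.L _))

  module NonCrossing {N : ℕ} (rot : Fin N → List (Fin N)) (rot-unique : ∀ v → Unique (rot v))
                     {A : Set} (near far : A → Fin N) where

    open Rotation rot rot-unique near far

    -- Entries are compared as darts only; whatever else an element of `A` carries is ignored.
    Diff : A → A → Set
    Diff d e = ¬ (near d ≡ near e × far d ≡ far e)

    diff-sym : ∀ {d e} → Diff d e → Diff e d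
    diff-sym p (q , r) = p (≡sym q , ≡sym r)

    module Restrict (f : A → ℤ) where

      Off : List A → A → Set
      Off ds y = All (λ d → Diff d y) ds

      Σ-restrict : ∀ {ds W} → ds ⊆ W → AllPairs Diff W → (∀ {y} → y ∈ W → Off ds y → f y ≡ 0ℤ) → Σˡ W f ≡ Σˡ ds f
      Σ-restrict [] _ _ = refl
      Σ-restrict (y ∷ʳ s) (d ∷ u) z =
        trans (cong₂ _+_ (z (here refl) (All.map diff-sym (All-resp-⊆ s d))) (Σ-restrict s u (λ p → z (there p)))) (ℤP.+-identityˡ _)
      Σ-restrict (refl ∷ s) (d ∷ u) z = cong (f _ +_) (Σ-restrict s u (λ p off → z (there p) (All.lookup d p ∷ off)))

    open Restrict

    ω-restrict : ∀ (f g : A → ℤ) {ds W} → ds ⊆ W → AllPairs Diff W → (∀ {y} → y ∈ W → Off f ds y → f y ≡ 0ℤ) →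
                 (∀ {y} → y ∈ W → Off g ds y → g y ≡ 0ℤ) → ω f g W ≡ ω f g ds
    ω-restrict f g [] _ _ _ = refl
    ω-restrict f g {W = _ ∷ W} (y ∷ʳ s) (d ∷ u) zf zg =
      trans (ω-drop f g y W (zf (here refl) off) (zg (here refl) off)) (ω-restrict f g s u (λ p → zf (there p)) (λ p → zg (there p)))
      where off = All.map diff-sym (All-resp-⊆ s d)
    ω-restrict f g (refl ∷ s) (d ∷ u) zf zg = cong₂ _+_
      (cong₂ _-_ (cong (f _ *_) (Σ-restrict g s u zg′)) (cong (g _ *_) (Σ-restrict f s u zf′)))
      (ω-restrict f g s u zf′ zg′)
      where
      zf′ = λ {y} p off → zf {y} (there p) (All.lookup d p ∷ off)
      zg′ = λ {y} p off → zg {y} (there p) (All.lookup d p ∷ off)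

    pairs : ∀ {ds W} → ds ⊆ W → AllPairs Diff W → AllPairs Diff ds
    pairs [] u = []
    pairs (y ∷ʳ s) (_ ∷ u) = pairs s u
    pairs (refl ∷ s) (d ∷ u) = All-resp-⊆ s d ∷ pairs s u

    -- Two paths of length two through distinct vertices of `X` close up to cycles at the contracted
    -- vertex. Their only common vertex is that one, and the crossing identity forbids them to cross
    -- there.
    module _ {X : List V} {W : List A} (J : Spherical X W) (distinct : AllPairs Diff W)
      (far∈ : ∀ {d} → d ∈ W → far d ∈ X) (near∉ : ∀ {d} → d ∈ W → near d ∉ X)
      (near∈rot : ∀ {d} → d ∈ W → near d ∈ rot (far d)) where

      private
        ∈⊆ : ∀ {ds d} → ds ⊆ W → d ∈ ds → d ∈ W
        ∈⊆ s p = Any-resp-⊆ s p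

        sep : ∀ {u v} → u ∉ X → v ∈ X → u ≢ v
        sep p q refl = p q

        -- the flow from d to d′ through their common far end
        module Cycle {d d′ : A} (d∈ : d ∈ W) (d′∈ : d′ ∈ W) (same : far d ≡ far d′) (diff : Diff d d′) where
          x = far d
          u = near d
          u′ = near d′

          c : V → V → ℤ
          c a b = δ u x a b - δ u′ x a b

          x∈ = far∈ d∈
          u∉ = near∉ d∈
          u′∉ = near∉ d′∈

          u≢u′ : u ≢ u′
          u≢u′ p = diff (p , same)

          Σδ : ∀ {v z} → v ∉ X → v ∈ rot x → z ∈ X → z ≡ x → Σˡ (rot z) (δ v x z) ≡ - 1ℤ
          Σδ {v} v∉ v∈ z∈ refl = trans
            (Σ-single (rot-unique x) v∈ (λ _ ne → δ-miss (λ (e , _) → sep v∉ x∈ (≡sym e)) (λ (e , _) → ne e)))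
            (trans (δ-anti v x x v) (cong -_ (δ-hit v x (sep v∉ x∈))))

          away : ∀ {z} → z ∈ X → z ≢ x → ∀ w → c z w ≡ 0ℤ
          away z∈ ne w = cong₂ _-_ (δ-miss (λ (e , _) → sep u∉ z∈ (≡sym e)) (λ (_ , e) → ne e))
                                   (δ-miss (λ (e , _) → sep u′∉ z∈ (≡sym e)) (λ (_ , e) → ne e))

          at-d : val c d ≡ 1ℤ
          at-d = cong₂ _-_ (δ-hit u x (sep u∉ x∈)) (δ-miss (λ (e , _) → u≢u′ e) (λ (e , _) → sep u′∉ x∈ (≡sym e)))

          at-d′ : val c d′ ≡ - 1ℤ
          at-d′ = cong₂ _-_ (δ-miss (λ (e , _) → u≢u′ (≡sym e)) (λ (e , _) → sep u∉ (far∈ d′∈) (≡sym e)))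
                            (trans (cong (δ u′ x u′) (≡sym same)) (δ-hit u′ x (sep u′∉ x∈)))

          off : ∀ {y} → y ∈ W → Diff d y → Diff d′ y → val c y ≡ 0ℤ
          off y∈ p q = cong₂ _-_ (δ-miss (λ (e , f) → p (≡sym e , ≡sym f)) (λ (e , _) → sep u∉ (far∈ y∈) (≡sym e)))
                                 (δ-miss (λ (e , f) → q (≡sym e , trans (≡sym same) (≡sym f))) (λ (e , _) → sep u′∉ (far∈ y∈) (≡sym e)))

          far-off : ∀ {y} → y ∈ W → far y ≢ x → val c y ≡ 0ℤ
          far-off y∈ ne = off y∈ (λ (_ , e) → ne (≡sym e)) (λ (_ , e) → ne (trans (≡sym e) (≡sym same)))

          flow : Σˡ W (val c) ≡ 0ℤ → Flow X W c
          flow t = record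
            { anti = λ a b → trans (cong₂ _-_ (δ-anti u x a b) (δ-anti u′ x a b)) (l (δ u x b a) (δ u′ x b a))
            ; dead = λ p q → cong₂ _-_ (δ-miss (λ (_ , e) → sep q x∈ e) (λ (_ , e) → sep p x∈ e))
                                       (δ-miss (λ (_ , e) → sep q x∈ e) (λ (_ , e) → sep p x∈ e))
            ; cons = λ {z} p → cons′ z p (z F.≟ x)
            ; total = t }
            where
            l : ∀ a b → - a - - b ≡ - (a - b)
            l = solve-∀
            cons′ : ∀ z → z ∈ X → Dec (z ≡ x) → Σˡ (rot z) (c z) ≡ 0ℤ
            cons′ z p (yes e) = trans (Σ-- (rot z) (δ u x z) (δ u′ x z))
              (cong₂ _-_ (Σδ u∉ (near∈rot d∈) p e) (Σδ u′∉ (subst (λ v → u′ ∈ rot v) (≡sym same) (near∈rot d′∈)) p e))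
            cons′ z p (no ne) = Σ-0 (rot z) (λ {w} _ → away p ne w)

      no-alternation : NoAlternation F._≟_ far W
      no-alternation {d₁} {d₂} {d₃} {d₄} s e₁₃ e₂₄ with far d₁ F.≟ far d₂
      ... | yes e = e
      ... | no ne with pairs s distinct
      ...   | (_ ∷ n₁₃ ∷ _) ∷ (_ ∷ n₂₄ ∷ []) ∷ _ = ⊥-elim (two≢0 (trans (≡sym total) (J (C.flow ΣC) (D.flow ΣD))))
        where
        m₁ : d₁ ∈ W
        m₁ = ∈⊆ s (here refl)
        m₂ : d₂ ∈ W
        m₂ = ∈⊆ s (there (here refl))
        m₃ : d₃ ∈ W
        m₃ = ∈⊆ s (there (there (here refl)))
        m₄ : d₄ ∈ W
        m₄ = ∈⊆ s (there (there (there (here refl))))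
        module C = Cycle m₁ m₃ e₁₃ n₁₃
        module D = Cycle m₂ m₄ e₂₄ n₂₄
        C₂ : val C.c d₂ ≡ 0ℤ
        C₂ = C.far-off m₂ (λ e → ne (≡sym e))
        C₄ : val C.c d₄ ≡ 0ℤ
        C₄ = C.far-off m₄ (λ e → ne (trans (≡sym e) (≡sym e₂₄)))
        D₁ : val D.c d₁ ≡ 0ℤ
        D₁ = D.far-off m₁ ne
        D₃ : val D.c d₃ ≡ 0ℤ
        D₃ = D.far-off m₃ (λ e → ne (trans e₁₃ e))
        offC : ∀ {y} → y ∈ W → Off (val C.c) (d₁ ∷ d₂ ∷ d₃ ∷ d₄ ∷ []) y → val C.c y ≡ 0ℤ
        offC p (q₁ ∷ _ ∷ q₃ ∷ _) = C.off p q₁ q₃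
        offD : ∀ {y} → y ∈ W → Off (val D.c) (d₁ ∷ d₂ ∷ d₃ ∷ d₄ ∷ []) y → val D.c y ≡ 0ℤ
        offD p (_ ∷ q₂ ∷ _ ∷ q₄ ∷ []) = D.off p q₂ q₄
        Σ4 : ∀ {a b c d} → {p q r t : ℤ} → a ≡ p → b ≡ q → c ≡ r → d ≡ t → a + (b + (c + (d + 0ℤ))) ≡ p + (q + (r + (t + 0ℤ)))
        Σ4 refl refl refl refl = refl
        ΣC : Σˡ W (val C.c) ≡ 0ℤ
        ΣC = trans (Σ-restrict (val C.c) s distinct offC) (Σ4 C.at-d C₂ C.at-d′ C₄)
        ΣD : Σˡ W (val D.c) ≡ 0ℤ
        ΣD = trans (Σ-restrict (val D.c) s distinct offD) (Σ4 D₁ D.at-d D₃ D.at-d′)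
        -- The interleaved sequences (1, 0, -1, 0) and (0, 1, 0, -1) contribute 1 - 1 + 1 + 1.
        ω4 : ∀ (f g : A → ℤ) → f d₁ ≡ 1ℤ → f d₂ ≡ 0ℤ → f d₃ ≡ - 1ℤ → f d₄ ≡ 0ℤ →
             g d₁ ≡ 0ℤ → g d₂ ≡ 1ℤ → g d₃ ≡ 0ℤ → g d₄ ≡ - 1ℤ → ω f g (d₁ ∷ d₂ ∷ d₃ ∷ d₄ ∷ []) ≡ ℤ.+ 2
        ω4 f g p₁ p₂ p₃ p₄ q₁ q₂ q₃ q₄ rewrite p₁ | p₂ | p₃ | p₄ | q₁ | q₂ | q₃ | q₄ = refl
        -- At the far end of the first cycle the second one is absent; at all other vertices of `X`
        -- the first one is.
        vanish : ∀ {z} → z ∈ X → Dec (z ≡ C.x) → ω (C.c z) (D.c z) (rot z) ≡ 0ℤ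
        vanish {z} p (yes refl) = ω-0ʳ (rot z) {C.c z} {D.c z} (λ {w} _ → D.away p ne w)
        vanish {z} p (no z≢x) = ω-0ˡ (rot z) {C.c z} {D.c z} (λ {w} _ → C.away p z≢x w)
        total : ω (val C.c) (val D.c) W + Σˡ X (λ z → ω (C.c z) (D.c z) (rot z)) ≡ ℤ.+ 2
        total = cong₂ _+_
          (trans (ω-restrict (val C.c) (val D.c) s distinct offC offD)
                 (ω4 (val C.c) (val D.c) C.at-d C₂ C.at-d′ C₄ D₁ D.at-d D₃ D.at-d′))
          (Σ-0 X (λ {z} p → vanish p (z F.≟ C.x)))
        two≢0 : ℤ.+ 2 ≢ 0ℤ
        two≢0 ()

-- The bottom-to-top sweep that places bars and strips.

module Sweeps where

  open Contraction
  open Blocks using (block; module NonCrossing)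
  open LexEmbedding using (0<1)
  open Layouts using (mid; <mid; mid<)
  open import Data.Nat as ℕ using (ℕ; suc; s≤s)
  import Data.Nat.Properties as ℕP
  open import Data.Fin as F using (Fin)
  open import Data.Rational using (ℚ; 0ℚ; _≤_; _<_)
  import Data.Rational.Properties as QP
  open import Data.List using (List; []; _∷_; _++_; length; map; filter)
  import Data.List.Properties as LP
  open import Data.List.Membership.Propositional using (_∈_; _∉_)
  open import Data.List.Membership.Propositional.Properties using (∈-++⁺ˡ; ∈-++⁺ʳ; ∈-++⁻; ∈-filter⁻; ∈-filter⁺; ∈-map⁺; ∈-map⁻; ∈-∃++)
  open import Data.List.Relation.Unary.Any using (here; there)
  open import Data.List.Relation.Unary.All as All using (All; []; _∷_)
  open import Data.List.Relation.Unary.AllPairs as AllPairs using (AllPairs; []; _∷_)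
  open import Data.List.Relation.Unary.Unique.Propositional using (Unique)
  import Data.List.Relation.Unary.Unique.Propositional.Properties as UniqueP
  open import Data.Sum using (swap)

  module _ {A : Set} {R : A → A → Set} where

    cross : ∀ xs {ys} → AllPairs R (xs ++ ys) → ∀ {x y} → x ∈ xs → y ∈ ys → R x y
    cross (_ ∷ xs) (d ∷ _) (here refl) q = All.lookup d (∈-++⁺ʳ xs q)
    cross (_ ∷ xs) (_ ∷ u) (there p) q = cross xs u p q

    prefix : ∀ xs {ys} → AllPairs R (xs ++ ys) → AllPairs R xs
    prefix [] _ = []
    prefix (x ∷ xs) (d ∷ u) = All.tabulate (λ p → All.lookup d (∈-++⁺ˡ p)) ∷ prefix xs u

    suffix : ∀ xs {ys} → AllPairs R (xs ++ ys) → AllPairs R ys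
    suffix [] u = u
    suffix (x ∷ xs) (_ ∷ u) = suffix xs u

    join : ∀ {xs ys} → AllPairs R xs → AllPairs R ys → (∀ {x y} → x ∈ xs → y ∈ ys → R x y) → AllPairs R (xs ++ ys)
    join [] v c = v
    join {x ∷ xs} (d ∷ u) v c = All.tabulate both ∷ join u v (λ p q → c (there p) q)
      where
      both : ∀ {y} → y ∈ xs ++ _ → R x y
      both p with ∈-++⁻ xs p
      ... | inj₁ q = All.lookup d q
      ... | inj₂ q = c (here refl) q

    related : ∀ {xs} → AllPairs R xs → ∀ {x y} → x ∈ xs → y ∈ xs → x ≡ y ⊎ R x y ⊎ R y x
    related (d ∷ u) (here refl) (here refl) = inj₁ refl
    related (d ∷ u) (here refl) (there q) = inj₂ (inj₁ (All.lookup d q))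
    related (d ∷ u) (there p) (here refl) = inj₂ (inj₂ (All.lookup d p))
    related (d ∷ u) (there p) (there q) = related u p q

  module _ {N : ℕ} {T : Set} (x : Fin N) (a : T) (f : Fin N → T) where

    upd : Fin N → T
    upd v with v F.≟ x
    ... | yes _ = a
    ... | no _ = f v

    upd-hit : upd x ≡ a
    upd-hit with x F.≟ x
    ... | yes _ = refl
    ... | no ne = ⊥-elim (ne refl)

    upd-miss : ∀ {v} → v ≢ x → upd v ≡ f v
    upd-miss {v} ne with v F.≟ x
    ... | yes e = ⊥-elim (ne e)
    ... | no _ = refl

  -- an edge whose lower end is placed at height start; it will be drawn in the strip (p , q), and
  -- (q , r) is kept for the edges leaving its upper end
  record Active (N : ℕ) : Set where
    field
      near far : Fin N
      start    : ℕ
      p q r    : ℚ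
      p<q      : p < q
      q<r      : q < r

  module Sweeping {N : ℕ} (rot : Fin N → List (Fin N)) (rot-unique : ∀ v → Unique (rot v))
                  (rot-sym : ∀ {v w} → w ∈ rot v → v ∈ rot w) (rot-irrefl : ∀ {v} → v ∉ rot v) where

    open Active
    open Rotation rot rot-unique {Active N} near far
    open NonCrossing rot rot-unique {Active N} near far

    Before : Active N → Active N → Set
    Before d e = r d ≤ p e

    -- `X` is still to be placed, `W` lists from left to right the edges between placed and unplaced
    -- vertices, and `t` is the next free height.
    record State (X : List V) (W : List (Active N)) (t : ℕ) : Set where
      field
        uX       : Unique X
        far∈     : ∀ {d} → d ∈ W → far d ∈ X
        near∉    : ∀ {d} → d ∈ W → near d ∉ X
        near∈rot : ∀ {d} → d ∈ W → near d ∈ rot (far d)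
        distinct : AllPairs Diff W
        sorted   : AllPairs Before W
        started  : ∀ {d} → d ∈ W → start d ℕ.< t
        J        : Spherical X W

    -- The picture from height `t` upwards. The recursion draws the later vertices before it inserts
    -- `x` underneath them, so `S` also contains the strips of `W`, whose lower ends are below `t`.
    record Drawing (X : List V) (W : List (Active N)) (t : ℕ) : Set where
      field
        height     : V → ℕ
        left right : V → ℚ
        height≥    : ∀ {v} → v ∈ X → t ℕ.≤ height v
        height-inj : ∀ {u v} → u ∈ X → v ∈ X → height u ≡ height v → u ≡ v
        left<right : ∀ {v} → v ∈ X → left v < right v
        S          : List (Active N)
        W⊆S        : ∀ {d} → d ∈ W → d ∈ S
        origin     : ∀ {d} → d ∈ S → d ∈ W ⊎ (t ℕ.≤ start d × near d ∈ X × start d ≡ height (near d))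
        far∈S      : ∀ {d} → d ∈ S → far d ∈ X
        start<     : ∀ {d} → d ∈ S → start d ℕ.< height (far d)
        apart      : ∀ {d e} → d ∈ S → e ∈ S →
                     d ≡ e ⊎ (q d ≤ p e ⊎ q e ≤ p d) ⊎ (height (far d) ℕ.< start e ⊎ height (far e) ℕ.< start d)
        at-near    : ∀ {d} → d ∈ S → near d ∈ X → left (near d) ≤ p d × q d ≤ right (near d)
        at-far     : ∀ {d} → d ∈ S → left (far d) ≤ p d × q d ≤ right (far d)
        around     : ∀ {d v} → d ∈ S → v ∈ X → start d ℕ.< height v → height v ℕ.< height (far d) → q d ≤ left v ⊎ right v ≤ p d
        cover      : ∀ {u w} → u ∈ X → w ∈ X → w ∈ rot u →
                     ∃[ d ] d ∈ S × near d ∈ X × (near d ≡ u × far d ≡ w ⊎ near d ≡ w × far d ≡ u)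

    module Spawn (x : V) (t : ℕ) where

      -- The interval is halved for every edge: the left half is divided into the strip and its
      -- reserve, the right half goes to the remaining edges. This works for any number of edges.
      spawn : List V → ∀ {m r} → m < r → List (Active N)
      spawn [] _ = []
      spawn (w ∷ ws) {m} {r} m<r =
        record { near = x ; far = w ; start = t ; p = m ; q = mid (<mid m<r) ; r = mid m<r ; p<q = <mid _ ; q<r = mid< _ }
        ∷ spawn ws (mid< m<r)

      far-spawn : ∀ ws {m r} (m<r : m < r) → map far (spawn ws m<r) ≡ ws
      far-spawn [] _ = refl
      far-spawn (w ∷ ws) m<r = cong (w ∷_) (far-spawn ws (mid< m<r))

      near-spawn : ∀ ws {m r} (m<r : m < r) {d} → d ∈ spawn ws m<r → near d ≡ x × start d ≡ t
      near-spawn (w ∷ ws) m<r (here refl) = refl , refl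
      near-spawn (w ∷ ws) m<r (there i) = near-spawn ws (mid< m<r) i

      ≤spawn : ∀ ws {m r} (m<r : m < r) {d} → d ∈ spawn ws m<r → m ≤ p d
      ≤spawn (w ∷ ws) m<r (here refl) = QP.≤-refl
      ≤spawn (w ∷ ws) m<r (there i) = QP.≤-trans (QP.<⇒≤ (<mid m<r)) (≤spawn ws (mid< m<r) i)

      spawn≤ : ∀ ws {m r'} (m<r : m < r') {d} → d ∈ spawn ws m<r → r d ≤ r'
      spawn≤ (w ∷ ws) m<r (here refl) = QP.<⇒≤ (mid< m<r)
      spawn≤ (w ∷ ws) m<r (there i) = spawn≤ ws (mid< m<r) i

      sorted-spawn : ∀ ws {m r} (m<r : m < r) → AllPairs Before (spawn ws m<r)
      sorted-spawn [] _ = []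
      sorted-spawn (w ∷ ws) m<r = All.tabulate (≤spawn ws (mid< m<r)) ∷ sorted-spawn ws (mid< m<r)

    -- one step of the sweep: the vertex x, drawn as the bar [l , ρ] at height t, replaces the block B by R
    module Step {X : List V} {x : V} (x∈X : x ∈ X) {L B C : List (Active N)} {t : ℕ}
      (st : State X (L ++ B ++ C) t)
      (far-B : ∀ {d} → d ∈ B → far d ≡ x) (far-L : ∀ {d} → d ∈ L → far d ≢ x) (far-C : ∀ {d} → d ∈ C → far d ≢ x)
      {l m ρ : ℚ} (l<m : l < m) (m<ρ : m < ρ)
      (hull : ∀ {d} → d ∈ B → l ≤ p d × q d ≤ m)
      (L≤l : ∀ {d} → d ∈ L → r d ≤ l) (ρ≤C : ∀ {d} → d ∈ C → ρ ≤ p d)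
      (ws : List V) (ws-unique : Unique ws) (ws⊆ : ∀ {w} → w ∈ ws → w ∈ X ∖ x × w ∈ rot x)
      (ws⊇ : ∀ {w} → w ∈ X ∖ x → w ∈ rot x → w ∈ ws) where

      open State st
      open Spawn x t

      R : List (Active N)
      R = spawn ws m<ρ

      private
        W = L ++ B ++ C
        W' = L ++ R ++ C

        ∈L : ∀ {d} → d ∈ L → d ∈ W
        ∈L = ∈-++⁺ˡ
        ∈B : ∀ {d} → d ∈ B → d ∈ W
        ∈B i = ∈-++⁺ʳ L (∈-++⁺ˡ i)
        ∈C : ∀ {d} → d ∈ C → d ∈ W
        ∈C i = ∈-++⁺ʳ L (∈-++⁺ʳ B i)

        data Piece (d : Active N) : Set where
          inL : d ∈ L → Piece d
          inR : d ∈ R → Piece d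
          inC : d ∈ C → Piece d

        piece : ∀ {d} → d ∈ W' → Piece d
        piece i with ∈-++⁻ L i
        ... | inj₁ j = inL j
        ... | inj₂ j with ∈-++⁻ R j
        ...   | inj₁ k = inR k
        ...   | inj₂ k = inC k

        far-R : ∀ {d} → d ∈ R → far d ∈ ws
        far-R {d} i = subst (far d ∈_) (far-spawn ws m<ρ) (∈-map⁺ far i)

        near-R : ∀ {d} → d ∈ R → near d ≡ x
        near-R i = proj₁ (near-spawn ws m<ρ i)

        p<r : ∀ (d : Active N) → p d < r d
        p<r d = QP.<-trans (p<q d) (q<r d)

      next : Spherical (X ∖ x) W' → State (X ∖ x) W' (suc t)
      next J' = record
        { uX = unique-∖ uX
        ; far∈ = λ i → far∈' (piece i)
        ; near∉ = λ i → near∉' (piece i)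
        ; near∈rot = λ i → near∈rot' (piece i)
        ; distinct = join (prefix L distinct) (join distinct-R (suffix B (suffix L distinct)) R-C)
                       (λ i j → L-RC i (∈-++⁻ R j))
        ; sorted = join (prefix L sorted) (join (sorted-spawn ws m<ρ) (suffix B (suffix L sorted))
                       (λ i j → QP.≤-trans (spawn≤ ws m<ρ i) (ρ≤C j)))
                       (λ i j → L-RC-sorted i (∈-++⁻ R j))
        ; started = λ i → started' (piece i)
        ; J = J' }
        where
        far∈' : ∀ {d} → Piece d → far d ∈ X ∖ x
        far∈' (inL i) = ∈-∖⁺ (far∈ (∈L i)) (far-L i)
        far∈' (inR i) = proj₁ (ws⊆ (far-R i))
        far∈' (inC i) = ∈-∖⁺ (far∈ (∈C i)) (far-C i)
        near∉' : ∀ {d} → Piece d → near d ∉ X ∖ x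
        near∉' (inL i) j = near∉ (∈L i) (proj₁ (∈-∖⁻ j))
        near∉' {d} (inR i) j = x∉X∖x (subst (_∈ X ∖ x) (near-R i) j)
        near∉' (inC i) j = near∉ (∈C i) (proj₁ (∈-∖⁻ j))
        near∈rot' : ∀ {d} → Piece d → near d ∈ rot (far d)
        near∈rot' (inL i) = near∈rot (∈L i)
        near∈rot' {d} (inR i) = subst (_∈ rot (far d)) (≡sym (near-R i)) (rot-sym (proj₂ (ws⊆ (far-R i))))
        near∈rot' (inC i) = near∈rot (∈C i)
        started' : ∀ {d} → Piece d → start d ℕ.< suc t
        started' (inL i) = ℕP.m<n⇒m<1+n (started (∈L i))
        started' (inR i) = s≤s (ℕP.≤-reflexive (proj₂ (near-spawn ws m<ρ i)))
        started' (inC i) = ℕP.m<n⇒m<1+n (started (∈C i))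
        unmap : ∀ {ds : List (Active N)} → Unique (map far ds) → AllPairs Diff ds
        unmap {[]} [] = []
        unmap {d ∷ ds} (u ∷ us) = All.tabulate (λ i (_ , e) → All.lookup u (∈-map⁺ far i) e) ∷ unmap us
        distinct-R : AllPairs Diff R
        distinct-R = unmap (subst Unique (≡sym (far-spawn ws m<ρ)) ws-unique)
        R-C : ∀ {d e} → d ∈ R → e ∈ C → Diff d e
        R-C i j (a , _) = near∉ (∈C j) (subst (_∈ X) (trans (≡sym (near-R i)) a) x∈X)
        L-RC : ∀ {d e} → d ∈ L → e ∈ R ⊎ e ∈ C → Diff d e
        L-RC i (inj₁ j) (a , _) = near∉ (∈L i) (subst (_∈ X) (≡sym (trans a (near-R j))) x∈X)
        L-RC i (inj₂ j) = cross L distinct i (∈-++⁺ʳ B j)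
        L-RC-sorted : ∀ {d e} → d ∈ L → e ∈ R ⊎ e ∈ C → Before d e
        L-RC-sorted i (inj₁ j) = QP.≤-trans (L≤l i) (QP.≤-trans (QP.<⇒≤ l<m) (≤spawn ws m<ρ j))
        L-RC-sorted i (inj₂ j) = cross L sorted i (∈-++⁺ʳ B j)

      draw : Drawing (X ∖ x) W' (suc t) → Drawing X W t
      draw D = record
        { height = height ; left = left ; right = right
        ; height≥ = λ {v} i → height≥ v i (v F.≟ x)
        ; height-inj = λ {u} {v} i j → height-inj u v i j (u F.≟ x) (v F.≟ x)
        ; left<right = λ {v} i → left<right v i (v F.≟ x)
        ; S = B ++ D.S
        ; W⊆S = λ i → W⊆S (∈-++⁻ L i)
        ; origin = λ i → origin (∈-++⁻ B i)
        ; far∈S = λ i → far∈S (∈-++⁻ B i)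
        ; start< = λ i → start< (∈-++⁻ B i)
        ; apart = λ i j → apart (∈-++⁻ B i) (∈-++⁻ B j)
        ; at-near = λ {d} i → at-near (∈-++⁻ B i) (near d F.≟ x)
        ; at-far = λ i → at-far (∈-++⁻ B i)
        ; around = λ {d} {v} i → around (∈-++⁻ B i) (v F.≟ x)
        ; cover = λ {u} {w} i j → cover i j (u F.≟ x) (w F.≟ x) }
        where
        module D = Drawing D
        height : V → ℕ
        height = upd x t D.height
        left right : V → ℚ
        left = upd x l D.left
        right = upd x ρ D.right

        hx : height x ≡ t
        hx = upd-hit x t D.height
        hv : ∀ {v} → v ≢ x → height v ≡ D.height v
        hv = upd-miss x t D.height

        Within : Active N → V → Set
        Within d v = left v ≤ p d × q d ≤ right v

        within-x : ∀ {d v} → v ≡ x → l ≤ p d → q d ≤ ρ → Within d v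
        within-x {d} refl a b = subst (_≤ p d) (≡sym (upd-hit x l D.left)) a , subst (q d ≤_) (≡sym (upd-hit x ρ D.right)) b

        within-v : ∀ {d v} → v ≢ x → D.left v ≤ p d × q d ≤ D.right v → Within d v
        within-v {d} ne (a , b) = subst (_≤ p d) (≡sym (upd-miss x l D.left ne)) a , subst (q d ≤_) (≡sym (upd-miss x ρ D.right ne)) b

        height≥ : ∀ v → v ∈ X → Dec (v ≡ x) → t ℕ.≤ height v
        height≥ v _ (yes refl) = ℕP.≤-reflexive (≡sym hx)
        height≥ v i (no ne) = ℕP.<⇒≤ (subst (t ℕ.<_) (≡sym (hv ne)) (D.height≥ (∈-∖⁺ i ne)))

        t<height : ∀ {v} → v ∈ X → v ≢ x → t ℕ.< height v
        t<height i ne = subst (t ℕ.<_) (≡sym (hv ne)) (D.height≥ (∈-∖⁺ i ne))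

        height-inj : ∀ u v → u ∈ X → v ∈ X → Dec (u ≡ x) → Dec (v ≡ x) → height u ≡ height v → u ≡ v
        height-inj u v i j (yes refl) (yes refl) _ = refl
        height-inj u v i j (yes refl) (no ne) e = ⊥-elim (ℕP.<-irrefl (trans (≡sym hx) e) (t<height j ne))
        height-inj u v i j (no ne) (yes refl) e = ⊥-elim (ℕP.<-irrefl (trans (≡sym hx) (≡sym e)) (t<height i ne))
        height-inj u v i j (no a) (no b) e = D.height-inj (∈-∖⁺ i a) (∈-∖⁺ j b) (trans (≡sym (hv a)) (trans e (hv b)))

        left<right : ∀ v → v ∈ X → Dec (v ≡ x) → left v < right v
        left<right v _ (yes refl) = subst₂ _<_ (≡sym (upd-hit x l D.left)) (≡sym (upd-hit x ρ D.right)) (QP.<-trans l<m m<ρ)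
        left<right v i (no ne) = subst₂ _<_ (≡sym (upd-miss x l D.left ne)) (≡sym (upd-miss x ρ D.right ne)) (D.left<right (∈-∖⁺ i ne))

        W⊆S : ∀ {d} → d ∈ L ⊎ d ∈ B ++ C → d ∈ B ++ D.S
        W⊆S (inj₁ i) = ∈-++⁺ʳ B (D.W⊆S (∈-++⁺ˡ i))
        W⊆S (inj₂ i) with ∈-++⁻ B i
        ... | inj₁ j = ∈-++⁺ˡ j
        ... | inj₂ j = ∈-++⁺ʳ B (D.W⊆S (∈-++⁺ʳ L (∈-++⁺ʳ R j)))

        -- an edge of the upper drawing is active on either side of x, leaves x, or starts higher up
        data Origin (d : Active N) : Set where
          onL : d ∈ L → Origin d
          onR : d ∈ R → Origin d
          onC : d ∈ C → Origin d
          new : t ℕ.< start d → near d ∈ X ∖ x → start d ≡ D.height (near d) → Origin d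

        org : ∀ {d} → d ∈ D.S → Origin d
        org i with D.origin i
        ... | inj₂ (a , b , c) = new a b c
        ... | inj₁ j with piece j
        ...   | inL k = onL k
        ...   | inR k = onR k
        ...   | inC k = onC k

        start-R : ∀ {d} → d ∈ R → start d ≡ t
        start-R i = proj₂ (near-spawn ws m<ρ i)

        origin : ∀ {d} → d ∈ B ⊎ d ∈ D.S → d ∈ W ⊎ (t ℕ.≤ start d × near d ∈ X × start d ≡ height (near d))
        origin (inj₁ i) = inj₁ (∈B i)
        origin (inj₂ i) with org i
        ... | onL j = inj₁ (∈L j)
        ... | onC j = inj₁ (∈C j)
        ... | onR j = inj₂ (ℕP.≤-reflexive (≡sym (start-R j)) , subst (_∈ X) (≡sym (near-R j)) x∈X ,
                            trans (start-R j) (≡sym (trans (cong height (near-R j)) hx)))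
        ... | new a b c = inj₂ (ℕP.<⇒≤ a , proj₁ (∈-∖⁻ b) , trans c (≡sym (hv (proj₂ (∈-∖⁻ b)))))

        far∈S : ∀ {d} → d ∈ B ⊎ d ∈ D.S → far d ∈ X
        far∈S (inj₁ i) = far∈ (∈B i)
        far∈S (inj₂ i) = proj₁ (∈-∖⁻ (D.far∈S i))

        far≢ : ∀ {d} → d ∈ D.S → far d ≢ x
        far≢ i = proj₂ (∈-∖⁻ (D.far∈S i))

        hB : ∀ {d} → d ∈ B → height (far d) ≡ t
        hB i = trans (cong height (far-B i)) hx

        hS : ∀ {d} → d ∈ D.S → height (far d) ≡ D.height (far d)
        hS i = hv (far≢ i)

        start< : ∀ {d} → d ∈ B ⊎ d ∈ D.S → start d ℕ.< height (far d)
        start< {d} (inj₁ i) = subst (start d ℕ.<_) (≡sym (hB i)) (started (∈B i))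
        start< {d} (inj₂ i) = subst (start d ℕ.<_) (≡sym (hS i)) (D.start< i)

        Apart : Active N → Active N → Set
        Apart d e = d ≡ e ⊎ (q d ≤ p e ⊎ q e ≤ p d) ⊎ (height (far d) ℕ.< start e ⊎ height (far e) ℕ.< start d)

        apart-sym : ∀ {d e} → Apart d e → Apart e d
        apart-sym (inj₁ e) = inj₁ (≡sym e)
        apart-sym (inj₂ (inj₁ a)) = inj₂ (inj₁ (swap a))
        apart-sym (inj₂ (inj₂ a)) = inj₂ (inj₂ (swap a))

        q≤ : ∀ {d e} → Before d e → q d ≤ p e
        q≤ {d} b = QP.≤-trans (QP.<⇒≤ (q<r d)) b

        -- A strip of the block ends at height `t`. Strips still active lie beside it, strips that
        -- leave `x` start to the right of the hull of the block, and all others start above `t`.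
        -- The third case is the reason for the reserve: ending and starting strips share the bar of
        -- `x`.
        apart-B : ∀ {d e} → d ∈ B → e ∈ D.S → Apart d e
        apart-B {d} {e} i j with org j
        ... | onL k = inj₂ (inj₁ (inj₂ (q≤ {e} {d} (cross L sorted k (∈-++⁺ˡ i)))))
        ... | onR k = inj₂ (inj₁ (inj₁ (QP.≤-trans (proj₂ (hull i)) (≤spawn ws m<ρ k))))
        ... | onC k = inj₂ (inj₁ (inj₁ (q≤ {d} {e} (cross B (suffix L sorted) i k))))
        ... | new a _ _ = inj₂ (inj₂ (inj₁ (subst (ℕ._< start e) (≡sym (hB i)) a)))

        apart : ∀ {d e} → d ∈ B ⊎ d ∈ D.S → e ∈ B ⊎ e ∈ D.S → Apart d e
        apart {d} {e} (inj₁ i) (inj₁ j) with related sorted (∈B i) (∈B j)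
        ... | inj₁ a = inj₁ a
        ... | inj₂ (inj₁ b) = inj₂ (inj₁ (inj₁ (q≤ {d} {e} b)))
        ... | inj₂ (inj₂ b) = inj₂ (inj₁ (inj₂ (q≤ {e} {d} b)))
        apart (inj₁ i) (inj₂ j) = apart-B i j
        apart (inj₂ i) (inj₁ j) = apart-sym (apart-B j i)
        apart {d} {e} (inj₂ i) (inj₂ j) with D.apart i j
        ... | inj₁ a = inj₁ a
        ... | inj₂ (inj₁ a) = inj₂ (inj₁ a)
        ... | inj₂ (inj₂ (inj₁ a)) = inj₂ (inj₂ (inj₁ (subst (ℕ._< start e) (≡sym (hS i)) a)))
        ... | inj₂ (inj₂ (inj₂ a)) = inj₂ (inj₂ (inj₂ (subst (ℕ._< start d) (≡sym (hS j)) a)))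

        at-near : ∀ {d} → d ∈ B ⊎ d ∈ D.S → Dec (near d ≡ x) → near d ∈ X → Within d (near d)
        at-near (inj₁ i) _ j = ⊥-elim (near∉ (∈B i) j)
        at-near {d} (inj₂ i) (no ne) j = within-v {d} ne (D.at-near i (∈-∖⁺ j ne))
        at-near {d} (inj₂ i) (yes e) j with org i
        ... | onL k = ⊥-elim (near∉ (∈L k) j)
        ... | onC k = ⊥-elim (near∉ (∈C k) j)
        ... | new _ b _ = ⊥-elim (proj₂ (∈-∖⁻ b) e)
        ... | onR k = within-x {d} e (QP.≤-trans (QP.<⇒≤ l<m) (≤spawn ws m<ρ k)) (QP.≤-trans (QP.<⇒≤ (q<r d)) (spawn≤ ws m<ρ k))

        at-far : ∀ {d} → d ∈ B ⊎ d ∈ D.S → Within d (far d)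
        at-far {d} (inj₁ i) = within-x {d} (far-B i) (proj₁ (hull i)) (QP.≤-trans (proj₂ (hull i)) (QP.<⇒≤ m<ρ))
        at-far {d} (inj₂ i) = within-v {d} (far≢ i) (D.at-far i)

        Around : Active N → V → Set
        Around d v = q d ≤ left v ⊎ right v ≤ p d

        around : ∀ {d v} → d ∈ B ⊎ d ∈ D.S → Dec (v ≡ x) → v ∈ X → start d ℕ.< height v → height v ℕ.< height (far d) → Around d v
        around (inj₁ i) (yes refl) _ _ b = ⊥-elim (ℕP.<-irrefl (trans hx (≡sym (hB i))) b)
        around {v = v} (inj₁ i) (no ne) j _ b = ⊥-elim (ℕP.<-asym (t<height j ne) (subst (height v ℕ.<_) (hB i) b))
        around {d} (inj₂ i) (yes refl) _ a _ with org i
        ... | onL k = inj₁ (subst (q d ≤_) (≡sym (upd-hit x l D.left)) (QP.≤-trans (QP.<⇒≤ (q<r d)) (L≤l k)))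
        ... | onC k = inj₂ (subst (_≤ p d) (≡sym (upd-hit x ρ D.right)) (ρ≤C k))
        ... | onR k = ⊥-elim (ℕP.<-irrefl (trans (start-R k) (≡sym hx)) a)
        ... | new b _ _ = ⊥-elim (ℕP.<-asym b (subst (start d ℕ.<_) hx a))
        around {d} {v} (inj₂ i) (no ne) j a b with D.around i (∈-∖⁺ j ne) (subst (start d ℕ.<_) (hv ne) a) (subst₂ ℕ._<_ (hv ne) (hS i) b)
        ... | inj₁ c = inj₁ (subst (q d ≤_) (≡sym (upd-miss x l D.left ne)) c)
        ... | inj₂ c = inj₂ (subst (_≤ p d) (≡sym (upd-miss x ρ D.right ne)) c)

        leaving : ∀ {w} → w ∈ X ∖ x → w ∈ rot x → ∃[ d ] d ∈ B ++ D.S × near d ∈ X × near d ≡ x × far d ≡ w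
        leaving {w} i j with ∈-map⁻ far (subst (w ∈_) (≡sym (far-spawn ws m<ρ)) (ws⊇ i j))
        ... | d , k , e = d , ∈-++⁺ʳ B (D.W⊆S (∈-++⁺ʳ L (∈-++⁺ˡ k))) , subst (_∈ X) (≡sym (near-R k)) x∈X , near-R k , ≡sym e

        cover : ∀ {u w} → u ∈ X → w ∈ X → Dec (u ≡ x) → Dec (w ≡ x) → w ∈ rot u →
                ∃[ d ] d ∈ B ++ D.S × near d ∈ X × (near d ≡ u × far d ≡ w ⊎ near d ≡ w × far d ≡ u)
        cover i j (yes refl) (no ne) k = let (d , a , b , c , e) = leaving (∈-∖⁺ j ne) k in d , a , b , inj₁ (c , e)
        cover i j (no ne) (yes refl) k = let (d , a , b , c , e) = leaving (∈-∖⁺ i ne) (rot-sym k) in d , a , b , inj₂ (c , e)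
        cover i j (no a) (no b) k =
          let (d , i , j , c) = D.cover (∈-∖⁺ i a) (∈-∖⁺ j b) k in d , ∈-++⁺ʳ B i , proj₁ (∈-∖⁻ j) , c
        cover i j (yes refl) (yes refl) k = ⊥-elim (rot-irrefl k)

    private
      empty : ∀ {W t} → State [] W t → Drawing [] W t
      empty st = record
        { height = λ _ → 0 ; left = λ _ → 0ℚ ; right = λ _ → 0ℚ
        ; height≥ = λ () ; height-inj = λ () ; left<right = λ ()
        ; S = [] ; W⊆S = λ i → none (State.far∈ st i) ; origin = λ () ; far∈S = λ () ; start< = λ ()
        ; apart = λ () ; at-near = λ () ; at-far = λ () ; around = λ () ; cover = λ () }
        where
        none : ∀ {A : Set} {v : V} → v ∈ [] → A
        none ()

      -- The reserve (q z, r z) of the last strip of the block lies right of the whole block and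
      -- left of everything after it; the edges leaving the new bar go there.
      last : ∀ b B → AllPairs Before (b ∷ B) → Σ[ z ∈ Active N ] z ∈ b ∷ B × p b ≤ p z × (∀ {d} → d ∈ b ∷ B → q d ≤ q z)
      last b [] _ = b , here refl , QP.≤-refl , λ { (here refl) → QP.≤-refl }
      last b (b′ ∷ B) (d ∷ u) with last b′ B u
      ... | z , z∈ , pz , max = z , there z∈ , QP.<⇒≤ (QP.<-≤-trans p<r b≤z) ,
        λ { (here refl) → QP.<⇒≤ (QP.<-≤-trans (q<r b) (QP.≤-trans b≤z (QP.<⇒≤ (p<q z)))) ; (there i) → max i }
        where
        p<r = QP.<-trans (p<q b) (q<r b)
        b≤z : r b ≤ p z
        b≤z = QP.≤-trans (All.lookup d (here refl)) pz

    sweep : ∀ k {X W t} → length X ℕ.≤ k → State X W t → Drawing X W t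

    advance : ∀ k {X a W t} → length X ℕ.≤ suc k → State X (a ∷ W) t → Drawing X (a ∷ W) t
    advance k {X} {a} {W} {t} le st = go (block F._≟_ far (length W) a W ℕP.≤-refl
      (no-alternation (State.J st) (State.distinct st) (State.far∈ st) (State.near∉ st) (State.near∈rot st)))
      where
      go : Blocks.Block F._≟_ far (a ∷ W) → Drawing X (a ∷ W) t
      go bl = subst (λ W → Drawing X W t) (≡sym Bl.split) (at-x (∈-∃++ (near∈rot b∈)))
        where
        module Bl = Blocks.Block bl
        open Bl using (b; B; L; C)
        x = far b
        st' : State X (L ++ (b ∷ B) ++ C) t
        st' = subst (λ W → State X W t) Bl.split st
        open State st'
        b∈ : b ∈ L ++ (b ∷ B) ++ C
        b∈ = ∈-++⁺ʳ L (here refl)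
        x∈X = far∈ b∈
        sorted-B = prefix (b ∷ B) (suffix L sorted)
        at-x : ∃₂ (λ P Q → rot x ≡ P ++ near b ∷ Q) → Drawing X (L ++ (b ∷ B) ++ C) t
        at-x (P , Q , rot-x) with last b B sorted-B
        ... | z , z∈ , pz , max = S.draw (sweep k (ℕP.≤-pred (ℕP.≤-trans (length-∖ x∈X) le)) (S.next (M.spherical J)))
          where
          -- The rotation at `x` is read from just after the entering edge `b`; in this cyclic order
          -- the leaving edges take the place of `b`.
          ws = filter (_∈? (X ∖ x)) (Q ++ P)
          QP⊆ : ∀ {w} → w ∈ Q ++ P → w ∈ rot x
          QP⊆ i with ∈-++⁻ Q i
          ... | inj₁ j = subst (_ ∈_) (≡sym rot-x) (∈-++⁺ʳ P (there j))
          ... | inj₂ j = subst (_ ∈_) (≡sym rot-x) (∈-++⁺ˡ j)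
          ⊆QP : ∀ {w} → w ∈ X ∖ x → w ∈ P ++ near b ∷ Q → w ∈ Q ++ P
          ⊆QP w∈ i with ∈-++⁻ P i
          ... | inj₁ j = ∈-++⁺ʳ Q j
          ... | inj₂ (here refl) = ⊥-elim (near∉ b∈ (proj₁ (∈-∖⁻ w∈)))
          ... | inj₂ (there j) = ∈-++⁺ˡ j
          drop-mid : ∀ P {u : V} {Q} → Unique (P ++ u ∷ Q) → Unique (Q ++ P)
          drop-mid P uq = join (AllPairs.tail (suffix P uq)) (prefix P uq) (λ i j e → cross P uq j (there i) (≡sym e))
          p<r : ∀ (d : Active N) → p d < r d
          p<r d = QP.<-trans (p<q d) (q<r d)
          min : ∀ {d} → d ∈ b ∷ B → p b ≤ p d
          min (here refl) = QP.≤-refl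
          min (there i) = QP.≤-trans (QP.<⇒≤ (p<r b)) (All.lookup (AllPairs.head sorted-B) i)
          far-block : ∀ {d} → d ∈ b ∷ B → far d ≡ x
          far-block (here refl) = refl
          far-block (there i) = All.lookup Bl.key-B i
          ws⊆ : ∀ {w} → w ∈ ws → w ∈ X ∖ x × w ∈ rot x
          ws⊆ i = let (j , k) = ∈-filter⁻ (_∈? (X ∖ x)) {xs = Q ++ P} i in k , QP⊆ j
          module S = Step x∈X {L} {b ∷ B} {C} st'
            far-block
            (All.lookup Bl.key-L) (All.lookup Bl.key-C)
            -- The bar spans the block together with the reserve of its last strip.
            {l = p b} {m = q z} {ρ = r z} (QP.≤-<-trans pz (p<q z)) (q<r z)
            (λ i → min i , max i)
            (λ i → cross L sorted i (here refl)) (λ i → cross (b ∷ B) (suffix L sorted) z∈ i)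
            ws (UniqueP.filter⁺ (_∈? (X ∖ x)) (drop-mid P (subst Unique rot-x (rot-unique x))))
            ws⊆
            (λ i j → ∈-filter⁺ (_∈? (X ∖ x)) (⊆QP i (subst (_ ∈_) rot-x j)) i)
          module M = Merge uX x∈X {L} {b} {B} {C} P Q S.R refl (All.lookup Bl.key-B)
            (λ {d} i e → All.lookup (AllPairs.head (prefix (b ∷ B) (suffix L distinct))) i (≡sym e , ≡sym (All.lookup Bl.key-B i)))
            (All.lookup Bl.key-L) (All.lookup Bl.key-C) near∉ rot-x
            (λ i → proj₁ (Spawn.near-spawn x t ws (q<r z) i)) (Spawn.far-spawn x t ws (q<r z))

    sweep k {[]} _ st = empty st
    sweep (suc k) {X} {a ∷ W} le st = advance k le st
    sweep (suc k) {x ∷ X′} {[]} {t} le st =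
      S.draw (subst (λ W → Drawing (X ∖ x) W (suc t)) (≡sym (LP.++-identityʳ S.R)) restart)
      where
      open State st
      X = x ∷ X′
      x∈X : x ∈ X
      x∈X = here refl
      ws = filter (_∈? (X ∖ x)) (rot x)
      ws⊆ : ∀ {w} → w ∈ ws → w ∈ X ∖ x × w ∈ rot x
      ws⊆ i = let (j , k) = ∈-filter⁻ (_∈? (X ∖ x)) {xs = rot x} i in k , j
      module S = Step x∈X {[]} {[]} {[]} st (λ ()) (λ ()) (λ ())
        -- A new component begins with no strip active. All earlier strips end below height `t`, so
        -- the interval (0,1) can be used again; the empty block only asks for some l < m < ρ.
        (<mid 0<1) (mid< 0<1) (λ ()) (λ ()) (λ ())
        ws (UniqueP.filter⁺ (_∈? (X ∖ x)) (rot-unique x))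
        ws⊆
        (λ i j → ∈-filter⁺ (_∈? (X ∖ x)) j i)
      module M = Restart uX x∈X S.R (λ i → proj₁ (Spawn.near-spawn x t ws _ i)) (Spawn.far-spawn x t ws _)
      restart : Drawing (X ∖ x) S.R (suc t)
      restart = sweep k (ℕP.≤-pred (ℕP.≤-trans (length-∖ x∈X) le))
        (subst (λ W → State (X ∖ x) W (suc t)) (LP.++-identityʳ S.R)
          (S.next (subst (Spherical (X ∖ x)) (≡sym (LP.++-identityʳ S.R)) (M.spherical J))))

-- From a rotation system without crossings to a layout.

module Assembly where

  open import Defs
  open Sums
  open Contraction
  open Layouts using (Layout)
  open Sweeps
  open ComplementVPG using (edge-≡)
  open import Data.Bool using (true)
  open import Data.Nat as ℕ using (ℕ)
  import Data.Nat.Properties as ℕP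
  open import Data.Fin as F using (Fin)
  open import Data.Integer as ℤ using (ℤ; 0ℤ)
  import Data.Integer.Properties as ℤP
  open import Data.Rational using (_≤_; _<_)
  open import Data.List using (List; []; length; allFin)
  open import Data.List.Membership.Propositional using (_∈_; _∉_)
  open import Data.List.Membership.Propositional.Properties using (∈-allFin)
  open import Data.List.Relation.Unary.AllPairs using ([])
  open import Data.List.Relation.Unary.Unique.Propositional using (Unique)
  import Data.List.Relation.Unary.Unique.Propositional.Properties as UniqueP

  record Circulation {N : ℕ} (rot : Fin N → List (Fin N)) (c : Fin N → Fin N → ℤ) : Set where
    field
      anti : ∀ a b → c a b ≡ ℤ.- c b a
      cons : ∀ v → Σˡ (rot v) (c v) ≡ 0ℤ

  module _ {G : SimpleGraph} (rot : Fin (n G) → List (Fin (n G))) (rot-unique : ∀ v → Unique (rot v))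
    (rot-adj : ∀ {v w} → w ∈ rot v → adj G v w ≡ true) (adj-rot : ∀ {v w} → adj G v w ≡ true → w ∈ rot v)
    (crossings : ∀ {c c'} → Circulation rot c → Circulation rot c' → Σˡ (allFin (n G)) (λ v → ω (c v) (c' v) (rot v)) ≡ 0ℤ) where

    private
      rot-sym : ∀ {v w} → w ∈ rot v → v ∈ rot w
      rot-sym {v} {w} i = adj-rot (trans (SimpleGraph.sym G w v) (rot-adj i))

      rot-irrefl : ∀ {v} → v ∉ rot v
      rot-irrefl {v} i with trans (≡sym (rot-adj i)) (irrefl G v)
      ... | ()

      open Sweeping rot rot-unique rot-sym rot-irrefl
      open Active
      open Rotation rot rot-unique {Active (n G)} near far using (Flow; module Flow)

      start-state : State (allFin (n G)) [] 0
      start-state = record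
        { uX = UniqueP.allFin⁺ (n G) ; far∈ = λ () ; near∉ = λ () ; near∈rot = λ () ; distinct = [] ; sorted = [] ; started = λ ()
        ; J = λ f f' → trans (ℤP.+-identityˡ _) (crossings (circ f) (circ f')) }
        where
        circ : ∀ {c} → Flow (allFin (n G)) [] c → Circulation rot c
        circ f = record { anti = Flow.anti f ; cons = λ v → Flow.cons f (∈-allFin v) }

      module D = Drawing (sweep (length (allFin (n G))) ℕP.≤-refl start-state)

      strip : (e : Edge G) → ∃[ d ] d ∈ D.S × near d ∈ allFin (n G) ×
              (near d ≡ src {G} e × far d ≡ tgt {G} e ⊎ near d ≡ tgt {G} e × far d ≡ src {G} e)
      strip e = D.cover (∈-allFin _) (∈-allFin _) (adj-rot (proj₂ (proj₂ e)))

      act : Edge G → Active (n G)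
      act e = proj₁ (strip e)

      act∈ : ∀ e → act e ∈ D.S
      act∈ e = proj₁ (proj₂ (strip e))

      -- The sweep begins with an empty `W`, so no strip comes from below and each one starts at the
      -- height of its lower end.
      start≡ : ∀ e → start (act e) ≡ D.height (near (act e))
      start≡ e with D.origin (act∈ e)
      ... | inj₂ (_ , _ , p) = p

      ends : ∀ e → (near (act e) ≡ src {G} e × far (act e) ≡ tgt {G} e) ⊎ (near (act e) ≡ tgt {G} e × far (act e) ≡ src {G} e)
      ends e = proj₂ (proj₂ (proj₂ (strip e)))

      near<far : ∀ e → D.height (near (act e)) ℕ.< D.height (far (act e))
      near<far e = subst (ℕ._< D.height (far (act e))) (start≡ e) (D.start< (act∈ e))

      bot≡ : ∀ e → D.height (src {G} e) ℕ.⊓ D.height (tgt {G} e) ≡ start (act e)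
      bot≡ e with ends e
      ... | inj₁ (p , q) = trans (ℕP.m≤n⇒m⊓n≡m (ℕP.<⇒≤ (subst₂ (λ a b → D.height a ℕ.< D.height b) p q (near<far e))))
                             (trans (cong D.height (≡sym p)) (≡sym (start≡ e)))
      ... | inj₂ (p , q) = trans (ℕP.m≥n⇒m⊓n≡n (ℕP.<⇒≤ (subst₂ (λ a b → D.height a ℕ.< D.height b) p q (near<far e))))
                             (trans (cong D.height (≡sym p)) (≡sym (start≡ e)))

      top≡ : ∀ e → D.height (src {G} e) ℕ.⊔ D.height (tgt {G} e) ≡ D.height (far (act e))
      top≡ e with ends e
      ... | inj₁ (p , q) = trans (ℕP.m≤n⇒m⊔n≡n (ℕP.<⇒≤ (subst₂ (λ a b → D.height a ℕ.< D.height b) p q (near<far e)))) (cong D.height (≡sym q))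
      ... | inj₂ (p , q) = trans (ℕP.m≥n⇒m⊔n≡m (ℕP.<⇒≤ (subst₂ (λ a b → D.height a ℕ.< D.height b) p q (near<far e)))) (cong D.height (≡sym q))

      Within : Edge G → Fin (n G) → Set
      Within e v = D.left v ≤ p (act e) × q (act e) ≤ D.right v

      within-src : ∀ e → Within e (src {G} e)
      within-src e with ends e
      ... | inj₁ (p , _) = subst (Within e) p (D.at-near (act∈ e) (∈-allFin _))
      ... | inj₂ (_ , p) = subst (Within e) p (D.at-far (act∈ e))

      within-tgt : ∀ e → Within e (tgt {G} e)
      within-tgt e with ends e
      ... | inj₁ (_ , p) = subst (Within e) p (D.at-far (act∈ e))
      ... | inj₂ (p , _) = subst (Within e) p (D.at-near (act∈ e) (∈-allFin _))

      -- One strip cannot be traversed in opposite directions by two edges, because `src` is smaller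
      -- than `tgt` for both.
      act-inj : ∀ e f → act e ≡ act f → e ≡ f
      act-inj e f eq with ends e | ends f
      ... | inj₁ (a , b) | inj₁ (c , d) = edge-≡ {G} e f (trans (≡sym a) (trans (cong near eq) c)) (trans (≡sym b) (trans (cong far eq) d))
      ... | inj₂ (a , b) | inj₂ (c , d) = edge-≡ {G} e f (trans (≡sym b) (trans (cong far eq) d)) (trans (≡sym a) (trans (cong near eq) c))
      ... | inj₁ (a , b) | inj₂ (c , d) = ⊥-elim (ℕP.<-asym (proj₁ (proj₂ e))
              (subst₂ F._<_ (trans (≡sym d) (trans (cong far (≡sym eq)) b)) (trans (≡sym c) (trans (cong near (≡sym eq)) a)) (proj₁ (proj₂ f))))
      ... | inj₂ (a , b) | inj₁ (c , d) = ⊥-elim (ℕP.<-asym (proj₁ (proj₂ e))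
              (subst₂ F._<_ (trans (≡sym c) (trans (cong near (≡sym eq)) a)) (trans (≡sym d) (trans (cong far (≡sym eq)) b)) (proj₁ (proj₂ f))))

      avoid : ∀ e v → D.height (src {G} e) ℕ.⊓ D.height (tgt {G} e) ℕ.< D.height v →
              D.height v ℕ.< D.height (src {G} e) ℕ.⊔ D.height (tgt {G} e) → q (act e) ≤ D.left v ⊎ D.right v ≤ p (act e)
      avoid e v a b = D.around (act∈ e) (∈-allFin v) (subst (ℕ._< D.height v) (bot≡ e) a) (subst (D.height v ℕ.<_) (top≡ e) b)

      Bot Top : Edge G → ℕ
      Bot e = D.height (src {G} e) ℕ.⊓ D.height (tgt {G} e)
      Top e = D.height (src {G} e) ℕ.⊔ D.height (tgt {G} e)

      separate : ∀ e f → e ≢ f → (q (act e) ≤ p (act f) ⊎ q (act f) ≤ p (act e)) ⊎ (Top e ℕ.< Bot f ⊎ Top f ℕ.< Bot e)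
      separate e f ne with D.apart (act∈ e) (act∈ f)
      ... | inj₁ eq = ⊥-elim (ne (act-inj e f eq))
      ... | inj₂ (inj₁ a) = inj₁ a
      ... | inj₂ (inj₂ (inj₁ a)) = inj₂ (inj₁ (subst₂ ℕ._<_ (≡sym (top≡ e)) (≡sym (bot≡ f)) a))
      ... | inj₂ (inj₂ (inj₂ a)) = inj₂ (inj₂ (subst₂ ℕ._<_ (≡sym (top≡ f)) (≡sym (bot≡ e)) a))

    layout : Layout G
    layout = record
      { height = D.height ; height-inj = λ u v → D.height-inj (∈-allFin u) (∈-allFin v)
      ; left = D.left ; right = D.right ; left<right = λ v → D.left<right (∈-allFin v)
      ; lo = λ e → p (act e) ; hi = λ e → q (act e) ; lo<hi = λ e → p<q (act e)
      ; within-src = within-src ; within-tgt = within-tgt ; avoid = avoid ; separate = separate }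

-- The left-right relation of two segments that do not cross.

module Segments where

  open Rationals
  open Contraction using (⟦_⟧; ⟦⟧-yes; ⟦⟧-no)
  open import Data.Integer as ℤ using (ℤ; 0ℤ; 1ℤ)
  import Data.Integer.Properties as ℤP
  import Data.Integer.Tactic.RingSolver as ℤS
  open import Data.Rational using (ℚ; 0ℚ; 1ℚ; _+_; _*_; _-_; -_; _≤_; _<_)
  import Data.Rational.Properties as QP
  open import Data.Sum using (swap)
  open import Relation.Nullary.Decidable using (_×-dec_)
  open import Relation.Binary using (tri<; tri≈; tri>)
  open import Tactic.RingSolver using (solve-∀)

  opaque
    -- the sign of q - p
    sg : ℚ → ℚ → ℤ
    sg p q with QP.<-cmp p q
    ... | tri< _ _ _ = 1ℤ
    ... | tri≈ _ _ _ = 0ℤ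
    ... | tri> _ _ _ = ℤ.- 1ℤ

    sg-< : ∀ {p q} → p < q → sg p q ≡ 1ℤ
    sg-< {p} {q} lt with QP.<-cmp p q
    ... | tri< _ _ _ = refl
    ... | tri≈ ¬lt _ _ = ⊥-elim (¬lt lt)
    ... | tri> ¬lt _ _ = ⊥-elim (¬lt lt)

    sg-> : ∀ {p q} → q < p → sg p q ≡ ℤ.- 1ℤ
    sg-> {p} {q} gt with QP.<-cmp p q
    ... | tri< _ _ ¬gt = ⊥-elim (¬gt gt)
    ... | tri≈ _ _ ¬gt = ⊥-elim (¬gt gt)
    ... | tri> _ _ _ = refl

    sg-≡ : ∀ {p q} → p ≡ q → sg p q ≡ 0ℤ
    sg-≡ {p} {q} eq with QP.<-cmp p q
    ... | tri< _ ¬eq _ = ⊥-elim (¬eq eq)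
    ... | tri≈ _ _ _ = refl
    ... | tri> _ ¬eq _ = ⊥-elim (¬eq eq)

    sg-anti : ∀ p q → sg p q ≡ ℤ.- sg q p
    sg-anti p q with QP.<-cmp p q
    ... | tri< lt _ _ = cong ℤ.-_ (≡sym (sg-> lt))
    ... | tri≈ _ eq _ = cong ℤ.-_ (≡sym (sg-≡ (≡sym eq)))
    ... | tri> _ _ gt = cong ℤ.-_ (≡sym (sg-< gt))

  between : ∀ {a b c d : ℚ} → a < c → a < d → b < c → b < d → ∃[ y ] (a < y × y < c) × (b < y × y < d)
  between {a} {b} {c} {d} ac ad bc bd with QP.≤-total a b | QP.≤-total c d
  ... | inj₁ ab | inj₁ cd = let (y , l , u) = QP.<-dense bc in y , (QP.≤-<-trans ab l , u) , (l , QP.<-≤-trans u cd)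
  ... | inj₁ ab | inj₂ dc = let (y , l , u) = QP.<-dense bd in y , (QP.≤-<-trans ab l , QP.<-≤-trans u dc) , (l , u)
  ... | inj₂ ba | inj₁ cd = let (y , l , u) = QP.<-dense ac in y , (l , u) , (QP.≤-<-trans ba l , QP.<-≤-trans u cd)
  ... | inj₂ ba | inj₂ dc = let (y , l , u) = QP.<-dense ad in y , (l , QP.<-≤-trans u dc) , (QP.≤-<-trans ba l , u)

  -- a segment with bottom (bx , bh) and top (tx , th); heights are the second coordinates
  record Seg : Set where
    field
      bx bh tx th sl : ℚ
      bh<th : bh < th
      line  : tx ≡ bx + sl * (th - bh)

  module _ (s : Seg) where
    open Seg s

    opaque
      X : ℚ → ℚ
      X y = bx + sl * (y - bh)

      X-bot : X bh ≡ bx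
      X-bot = l bx sl bh
        where
        l : ∀ b s h → b + s * (h - h) ≡ b
        l = solve-∀ ℚ-ring

      X-top : X th ≡ tx
      X-top = ≡sym line

  opaque
    unfolding X

    X-shared-bottom : ∀ s s' → Seg.bx s ≡ Seg.bx s' → Seg.bh s ≡ Seg.bh s' → ∀ y →
                      X s y + (Seg.sl s' - Seg.sl s) * (y - Seg.bh s) ≡ X s' y
    X-shared-bottom s s' ex eh y =
      trans (l (Seg.bx s) (Seg.sl s) (Seg.sl s') (Seg.bh s) y) (cong₂ (λ b h → b + Seg.sl s' * (y - h)) ex eh)
      where
      l : ∀ b s s' h y → b + s * (y - h) + (s' - s) * (y - h) ≡ b + s' * (y - h)
      l = solve-∀ ℚ-ring

    X-shared-top : ∀ s s' → Seg.tx s ≡ Seg.tx s' → Seg.th s ≡ Seg.th s' → ∀ y →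
                   X s' y + (Seg.sl s' - Seg.sl s) * (Seg.th s - y) ≡ X s y
    X-shared-top s s' ex eh y =
      trans (l (Seg.bx s') (Seg.sl s) (Seg.sl s') (Seg.bh s') (Seg.th s) y)
        (trans (cong (λ z → z + Seg.sl s * (y - Seg.th s))
          (trans (cong (λ h → Seg.bx s' + Seg.sl s' * (h - Seg.bh s')) eh)
            (trans (≡sym (Seg.line s')) (trans (≡sym ex) (Seg.line s)))))
          (l₂ (Seg.bx s) (Seg.sl s) (Seg.bh s) (Seg.th s) y))
      where
      l : ∀ b s s' h t y → b + s' * (y - h) + (s' - s) * (t - y) ≡ b + s' * (t - h) + s * (y - t)
      l = solve-∀ ℚ-ring
      l₂ : ∀ b s h t y → b + s * (t - h) + s * (y - t) ≡ b + s * (y - h)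
      l₂ = solve-∀ ℚ-ring

    X-affine : ∀ s y₁ y₂ t → X s (y₁ + t * (y₂ - y₁)) ≡ X s y₁ + t * (X s y₂ - X s y₁)
    X-affine s y₁ y₂ t = l (Seg.bx s) (Seg.sl s) (Seg.bh s) y₁ y₂ t
      where
      l : ∀ b s h y₁ y₂ t → b + s * (y₁ + t * (y₂ - y₁) - h) ≡ b + s * (y₁ - h) + t * (b + s * (y₂ - h) - (b + s * (y₁ - h)))
      l = solve-∀ ℚ-ring

  -- If the horizontal gaps at the two heights are a and b with opposite orientation, the lines meet
  -- at the fraction a / (a + b) of the way.
  crossing : ∀ s s' {y₁ y₂} → y₁ < y₂ → X s y₁ < X s' y₁ → X s' y₂ < X s y₂ →
             ∃[ y ] y₁ < y × y < y₂ × X s y ≡ X s' y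
  crossing s s' {y₁} {y₂} y₁<y₂ lt gt =
    y₁ + t * (y₂ - y₁) , by-diff-< (0<* (0<* 0<r 0<a) (<⇒0<- y₁<y₂)) refl ,
    by-diff-< {d = r * b * (y₂ - y₁)} (0<* (0<* 0<r 0<b) (<⇒0<- y₁<y₂)) upper ,
    trans (X-affine s y₁ y₂ t) (trans equal (≡sym (X-affine s' y₁ y₂ t)))
    where
    a = X s' y₁ - X s y₁
    b = X s y₂ - X s' y₂
    0<a : 0ℚ < a
    0<a = <⇒0<- lt
    0<b : 0ℚ < b
    0<b = <⇒0<- gt
    0<a+b : 0ℚ < a + b
    0<a+b = QP.<-trans 0<a (by-diff-< 0<b refl)
    r = proj₁ (inv 0<a+b)
    0<r = proj₁ (proj₂ (inv 0<a+b))
    r*[a+b] : r * (a + b) ≡ 1ℚ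
    r*[a+b] = proj₂ (proj₂ (inv 0<a+b))
    t = r * a
    l₁ : ∀ y z r a b → y + r * a * (z - y) + r * b * (z - y) ≡ y + r * (a + b) * (z - y)
    l₁ = solve-∀ ℚ-ring
    upper : y₁ + t * (y₂ - y₁) + r * b * (y₂ - y₁) ≡ y₂
    upper = trans (l₁ y₁ y₂ r a b) (trans (cong (λ k → y₁ + k * (y₂ - y₁)) r*[a+b])
              (trans (cong (y₁ +_) (QP.*-identityˡ (y₂ - y₁))) (p+[q-p] y₁ y₂)))
    l₂ : ∀ p q p' q' r → p + r * (p' - p) * (q - p) ≡ p' + r * (p' - p) * (q' - p') + (r * (p' - p + (q - q')) - 1ℚ) * (p' - p)
    l₂ = solve-∀ ℚ-ring
    l₃ : ∀ z w → z + (1ℚ - 1ℚ) * w ≡ z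
    l₃ = solve-∀ ℚ-ring
    equal : X s y₁ + t * (X s y₂ - X s y₁) ≡ X s' y₁ + t * (X s' y₂ - X s' y₁)
    equal = trans (l₂ (X s y₁) (X s y₂) (X s' y₁) (X s' y₂) r)
      (trans (cong (λ k → X s' y₁ + t * (X s' y₂ - X s' y₁) + (k - 1ℚ) * a) r*[a+b]) (l₃ _ a))

  Pt : Set
  Pt = ℚ × ℚ

  bot top : Seg → Pt
  bot s = Seg.bx s , Seg.bh s
  top s = Seg.tx s , Seg.th s

  opaque
    -- +1 for points to the left of s, -1 for points to the right, 0 for points not strictly between the ends in height
    side : Seg → Pt → ℤ
    side s (x , h) = ⟦ (Seg.bh s QP.<? h) ×-dec (h QP.<? Seg.th s) ⟧ ℤ.* sg x (X s h)

    side-in : ∀ s {x h} → Seg.bh s < h → h < Seg.th s → side s (x , h) ≡ sg x (X s h)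
    side-in s {x} {h} p q = trans (cong (ℤ._* sg x (X s h)) (⟦⟧-yes ((Seg.bh s QP.<? h) ×-dec (h QP.<? Seg.th s)) (p , q))) (ℤP.*-identityˡ _)

    side-out : ∀ s {x h} → ¬ (Seg.bh s < h × h < Seg.th s) → side s (x , h) ≡ 0ℤ
    side-out s {x} {h} p = cong (ℤ._* sg x (X s h)) (⟦⟧-no ((Seg.bh s QP.<? h) ×-dec (h QP.<? Seg.th s)) p)

  -- The correction for ends at equal heights, where `side` is 0. Such ends will be common points,
  -- and near a common point the slopes tell which segment is on the left.
  θ : Seg → Seg → ℤ
  θ s s' = (⟦ Seg.bh s QP.≟ Seg.bh s' ⟧ ℤ.+ ⟦ Seg.th s QP.≟ Seg.th s' ⟧) ℤ.* sg (Seg.sl s) (Seg.sl s')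

  -- Segments may share endpoints. After a generic shear two ends at the same height are the same
  -- point, and this is all that `same-bot` and `same-top` express.
  record Disjoint (s s' : Seg) : Set where
    private
      module A = Seg s
      module B = Seg s'
    field
      no-cross : ∀ {y} → A.bh ≤ y → y ≤ A.th → B.bh ≤ y → y ≤ B.th → X s y ≡ X s' y →
                 (y ≡ A.bh ⊎ y ≡ A.th) × (y ≡ B.bh ⊎ y ≡ B.th)
      same-bot : A.bh ≡ B.bh → A.bx ≡ B.bx
      same-top : A.th ≡ B.th → A.tx ≡ B.tx

  -- The left-right relation read off at the lower and at the upper limit of the common heights.
  -- When there are common inner heights, one of the three terms is the relevant one: the end of
  -- `s`, the end of `s'`, or the slopes at a shared end. At a shared top the smaller slope belongs
  -- to the segment on the right, hence the minus sign.
  lower-diff upper-diff : Seg → Seg → ℤ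
  lower-diff s s' = side s' (bot s) ℤ.- side s (bot s') ℤ.+ ⟦ Seg.bh s QP.≟ Seg.bh s' ⟧ ℤ.* sg (Seg.sl s) (Seg.sl s')
  upper-diff s s' = side s' (top s) ℤ.- side s (top s') ℤ.- ⟦ Seg.th s QP.≟ Seg.th s' ⟧ ℤ.* sg (Seg.sl s) (Seg.sl s')

  module Pair {s s' : Seg} (d : Disjoint s s') where
    private
      module A = Seg s
      module B = Seg s'
    open Disjoint d

    Inside : ℚ → Set
    Inside y = (A.bh < y × y < A.th) × (B.bh < y × y < B.th)

    private
      ends : ∀ {a b y : ℚ} → a < y → y < b → y ≡ a ⊎ y ≡ b → ⊥
      ends p q (inj₁ refl) = QP.<-irrefl refl p
      ends p q (inj₂ refl) = QP.<-irrefl refl q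

    apart : ∀ {y} → Inside y → X s y ≢ X s' y
    apart ((a , b) , c , e) eq = ends a b (proj₁ (no-cross (QP.<⇒≤ a) (QP.<⇒≤ b) (QP.<⇒≤ c) (QP.<⇒≤ e) eq))

    -- A change of sign would produce a common point at an inner height. The first height may be an
    -- end of either segment, so that values of `side` at ends can be compared with the relation
    -- inside.
    steady : ∀ {y₁ y₂} → A.bh ≤ y₁ → y₁ ≤ A.th → B.bh ≤ y₁ → y₁ ≤ B.th → X s y₁ ≢ X s' y₁ → Inside y₂ →
             sg (X s y₁) (X s' y₁) ≡ sg (X s y₂) (X s' y₂)
    steady {y₁} {y₂} a b c e ne i@((a' , b') , c' , e') = go (QP.<-cmp (X s y₁) (X s' y₁)) (QP.<-cmp (X s y₂) (X s' y₂)) (QP.<-cmp y₁ y₂)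
      where
      up : y₁ < y₂ → ¬ (∃[ y ] y₁ < y × y < y₂ × X s y ≡ X s' y)
      up _ (y , p , q , eq) = apart ((QP.≤-<-trans a p , QP.<-trans q b') , QP.≤-<-trans c p , QP.<-trans q e') eq
      down : y₂ < y₁ → ¬ (∃[ y ] y₂ < y × y < y₁ × X s y ≡ X s' y)
      down _ (y , p , q , eq) = apart ((QP.<-trans a' p , QP.<-≤-trans q b) , QP.<-trans c' p , QP.<-≤-trans q e) eq
      flip : ∀ {y z} → ∃[ w ] y < w × w < z × X s' w ≡ X s w → ∃[ w ] y < w × w < z × X s w ≡ X s' w
      flip (w , p , q , eq) = w , p , q , ≡sym eq
      go : _ → _ → _ → _
      go (tri< p _ _) (tri< q _ _) _ = trans (sg-< p) (≡sym (sg-< q))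
      go (tri> _ _ p) (tri> _ _ q) _ = trans (sg-> p) (≡sym (sg-> q))
      go (tri≈ _ p _) _ _ = ⊥-elim (ne p)
      go _ (tri≈ _ p _) _ = ⊥-elim (apart i p)
      go (tri< p _ _) (tri> _ _ q) (tri< r _ _) = ⊥-elim (up r (crossing s s' r p q))
      go (tri< p _ _) (tri> _ _ q) (tri> _ _ r) = ⊥-elim (down r (flip (crossing s' s r q p)))
      go (tri> _ _ p) (tri< q _ _) (tri< r _ _) = ⊥-elim (up r (flip (crossing s' s r p q)))
      go (tri> _ _ p) (tri< q _ _) (tri> _ _ r) = ⊥-elim (down r (crossing s s' r q p))
      go (tri< p _ _) (tri> _ _ q) (tri≈ _ refl _) = ⊥-elim (QP.<-asym p q)
      go (tri> _ _ p) (tri< q _ _) (tri≈ _ refl _) = ⊥-elim (QP.<-asym p q)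

    module _ {y : ℚ} (i : Inside y) where
      private
        a = proj₁ (proj₁ i)
        b = proj₂ (proj₁ i)
        c = proj₁ (proj₂ i)
        e = proj₂ (proj₂ i)
        ε = sg (X s y) (X s' y)

      slope-bottom : A.bh ≡ B.bh → sg A.sl B.sl ≡ ε
      slope-bottom eh with QP.<-cmp A.sl B.sl
      ... | tri< p _ _ = trans (sg-< p) (≡sym (sg-< (by-diff-< (0<* (<⇒0<- p) (<⇒0<- a)) (X-shared-bottom s s' (same-bot eh) eh y))))
      ... | tri> _ _ p = trans (sg-> p) (≡sym (sg-> (by-diff-< (0<* (<⇒0<- p) (<⇒0<- c)) (X-shared-bottom s' s (≡sym (same-bot eh)) (≡sym eh) y))))
      ... | tri≈ _ p _ = ⊥-elim (apart i (trans (≡sym (z p)) (X-shared-bottom s s' (same-bot eh) eh y)))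
        where
        l : ∀ x k z → x + (k - k) * z ≡ x
        l = solve-∀ ℚ-ring
        z : A.sl ≡ B.sl → X s y + (B.sl - A.sl) * (y - A.bh) ≡ X s y
        z p = trans (cong (λ k → X s y + (B.sl - k) * (y - A.bh)) p) (l (X s y) B.sl (y - A.bh))

      slope-top : A.th ≡ B.th → ℤ.- sg A.sl B.sl ≡ ε
      slope-top eh with QP.<-cmp A.sl B.sl
      ... | tri< p _ _ = trans (cong ℤ.-_ (sg-< p)) (≡sym (sg-> (by-diff-< (0<* (<⇒0<- p) (<⇒0<- b)) (X-shared-top s s' (same-top eh) eh y))))
      ... | tri> _ _ p = trans (cong ℤ.-_ (sg-> p)) (≡sym (sg-< (by-diff-< (0<* (<⇒0<- p) (<⇒0<- e)) (X-shared-top s' s (≡sym (same-top eh)) (≡sym eh) y))))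
      ... | tri≈ _ p _ = ⊥-elim (apart i (trans (≡sym (X-shared-top s s' (same-top eh) eh y)) (z p)))
        where
        l : ∀ x k z → x + (k - k) * z ≡ x
        l = solve-∀ ℚ-ring
        z : A.sl ≡ B.sl → X s' y + (B.sl - A.sl) * (A.th - y) ≡ X s' y
        z p = trans (cong (λ k → X s' y + (B.sl - k) * (A.th - y)) p) (l (X s' y) B.sl (A.th - y))

      private
        eval : ∀ {p q r t : ℤ} k → p ≡ q → r ≡ t → ∀ {z w} → z ≡ w → p ℤ.- r ℤ.+ z ℤ.* k ≡ q ℤ.- t ℤ.+ w ℤ.* k
        eval k refl refl refl = refl
        eval′ : ∀ {p q r t : ℤ} k → p ≡ q → r ≡ t → ∀ {z w} → z ≡ w → p ℤ.- r ℤ.- z ℤ.* k ≡ q ℤ.- t ℤ.- w ℤ.* k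
        eval′ k refl refl refl = refl
        l₁ : ∀ p k → 0ℤ ℤ.- p ℤ.+ 0ℤ ℤ.* k ≡ ℤ.- p
        l₁ = ℤS.solve-∀
        l₂ : ∀ p k → p ℤ.- 0ℤ ℤ.+ 0ℤ ℤ.* k ≡ p
        l₂ = ℤS.solve-∀
        l₃ : ∀ k → 0ℤ ℤ.- 0ℤ ℤ.+ 1ℤ ℤ.* k ≡ k
        l₃ = ℤS.solve-∀
        l₄ : ∀ p k → 0ℤ ℤ.- p ℤ.- 0ℤ ℤ.* k ≡ ℤ.- p
        l₄ = ℤS.solve-∀
        l₅ : ∀ p k → p ℤ.- 0ℤ ℤ.- 0ℤ ℤ.* k ≡ p
        l₅ = ℤS.solve-∀
        l₆ : ∀ k → 0ℤ ℤ.- 0ℤ ℤ.- 1ℤ ℤ.* k ≡ ℤ.- k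
        l₆ = ℤS.solve-∀

      lower : lower-diff s s' ≡ ε
      lower with QP.<-cmp A.bh B.bh
      ... | tri< p ne _ = trans (eval (sg A.sl B.sl) (side-out s' (λ (q , _) → QP.<-asym p q)) (side-in s p (QP.<-trans c b))
              (⟦⟧-no (A.bh QP.≟ B.bh) ne)) (trans (l₁ _ (sg A.sl B.sl))
              (trans (cong (λ x → ℤ.- sg x (X s B.bh)) (≡sym (X-bot s'))) (trans (≡sym (sg-anti (X s B.bh) (X s' B.bh)))
                (steady (QP.<⇒≤ p) (QP.<⇒≤ (QP.<-trans c b)) QP.≤-refl (QP.<⇒≤ B.bh<th)
                  (λ eq → ends p (QP.<-trans c b) (proj₁ (no-cross (QP.<⇒≤ p) (QP.<⇒≤ (QP.<-trans c b)) QP.≤-refl (QP.<⇒≤ B.bh<th) eq))) i))))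
      ... | tri> _ ne p = trans (eval (sg A.sl B.sl) (side-in s' p (QP.<-trans a e)) (side-out s (λ (q , _) → QP.<-asym p q))
              (⟦⟧-no (A.bh QP.≟ B.bh) ne)) (trans (l₂ _ (sg A.sl B.sl))
              (trans (cong (λ x → sg x (X s' A.bh)) (≡sym (X-bot s)))
                (steady QP.≤-refl (QP.<⇒≤ A.bh<th) (QP.<⇒≤ p) (QP.<⇒≤ (QP.<-trans a e))
                  (λ eq → ends p (QP.<-trans a e) (proj₂ (no-cross QP.≤-refl (QP.<⇒≤ A.bh<th) (QP.<⇒≤ p) (QP.<⇒≤ (QP.<-trans a e)) eq))) i)))
      ... | tri≈ ¬p eh ¬q = trans (eval (sg A.sl B.sl) (side-out s' (λ (q , _) → ¬q q)) (side-out s (λ (q , _) → ¬p q))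
              (⟦⟧-yes (A.bh QP.≟ B.bh) eh)) (trans (l₃ (sg A.sl B.sl)) (slope-bottom eh))

      upper : upper-diff s s' ≡ ε
      upper with QP.<-cmp A.th B.th
      ... | tri> ¬q ne p = trans (eval′ (sg A.sl B.sl) (side-out s' (λ (_ , q) → ¬q q)) (side-in s (QP.<-trans a e) p)
              (⟦⟧-no (A.th QP.≟ B.th) ne)) (trans (l₄ _ (sg A.sl B.sl))
              (trans (cong (λ x → ℤ.- sg x (X s B.th)) (≡sym (X-top s'))) (trans (≡sym (sg-anti (X s B.th) (X s' B.th)))
                (steady (QP.<⇒≤ (QP.<-trans a e)) (QP.<⇒≤ p) (QP.<⇒≤ B.bh<th) QP.≤-refl
                  (λ eq → ends (QP.<-trans a e) p (proj₁ (no-cross (QP.<⇒≤ (QP.<-trans a e)) (QP.<⇒≤ p) (QP.<⇒≤ B.bh<th) QP.≤-refl eq))) i))))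
      ... | tri< p ne ¬q = trans (eval′ (sg A.sl B.sl) (side-in s' (QP.<-trans c b) p) (side-out s (λ (_ , q) → ¬q q))
              (⟦⟧-no (A.th QP.≟ B.th) ne)) (trans (l₅ _ (sg A.sl B.sl))
              (trans (cong (λ x → sg x (X s' A.th)) (≡sym (X-top s)))
                (steady (QP.<⇒≤ A.bh<th) QP.≤-refl (QP.<⇒≤ (QP.<-trans c b)) (QP.<⇒≤ p)
                  (λ eq → ends (QP.<-trans c b) p (proj₂ (no-cross (QP.<⇒≤ A.bh<th) QP.≤-refl (QP.<⇒≤ (QP.<-trans c b)) (QP.<⇒≤ p) eq))) i)))
      ... | tri≈ ¬p eh ¬q = trans (eval′ (sg A.sl B.sl) (side-out s' (λ (_ , q) → ¬p q)) (side-out s (λ (_ , q) → ¬q q))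
              (⟦⟧-yes (A.th QP.≟ B.th) eh)) (trans (l₆ (sg A.sl B.sl)) (slope-top eh))

    private
      zeros : ∀ {p q r k : ℤ} → p ≡ 0ℤ → q ≡ 0ℤ → r ≡ 0ℤ → p ℤ.- q ℤ.+ r ℤ.* k ≡ 0ℤ
      zeros refl refl refl = refl
      zeros′ : ∀ {p q r k : ℤ} → p ≡ 0ℤ → q ≡ 0ℤ → r ≡ 0ℤ → p ℤ.- q ℤ.- r ℤ.* k ≡ 0ℤ
      zeros′ refl refl refl = refl

    -- If the open height intervals overlap, both sides equal the relation at any common inner
    -- height; otherwise all their terms are 0.
    diff-≡ : lower-diff s s' ≡ upper-diff s s'
    diff-≡ = go (B.bh QP.<? A.th) (A.bh QP.<? B.th)
      where
      go : Dec (B.bh < A.th) → Dec (A.bh < B.th) → lower-diff s s' ≡ upper-diff s s'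
      go (yes p) (yes q) = let (y , u , v) = between A.bh<th q p B.bh<th in trans (lower (u , v)) (≡sym (upper (u , v)))
      go (no ¬p) _ =
        trans (zeros (side-out s' (λ (q , _) → ¬p (QP.<-trans q A.bh<th))) (side-out s (λ (_ , q) → ¬p q))
                (⟦⟧-no (A.bh QP.≟ B.bh) (λ eq → ¬p (subst (_< A.th) eq A.bh<th))))
          (≡sym (zeros′ (side-out s' (λ (q , _) → ¬p q)) (side-out s (λ (_ , q) → ¬p (QP.<-trans B.bh<th q)))
                (⟦⟧-no (A.th QP.≟ B.th) (λ eq → ¬p (subst (B.bh <_) (≡sym eq) B.bh<th)))))
      go (yes _) (no ¬p) =
        trans (zeros (side-out s' (λ (_ , q) → ¬p q)) (side-out s (λ (q , _) → ¬p (QP.<-trans q B.bh<th)))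
                (⟦⟧-no (A.bh QP.≟ B.bh) (λ eq → ¬p (subst (_< B.th) (≡sym eq) B.bh<th))))
          (≡sym (zeros′ (side-out s' (λ (_ , q) → ¬p (QP.<-trans A.bh<th q))) (side-out s (λ (q , _) → ¬p q))
                (⟦⟧-no (A.th QP.≟ B.th) (λ eq → ¬p (subst (A.bh <_) eq A.bh<th)))))

    -- With equal slopes the two segments would coincide just above the shared point.
    bottom-slopes : A.bh ≡ B.bh → A.sl ≢ B.sl
    bottom-slopes eh p =
      let (y , u , v) = between A.bh<th (subst (_< B.th) (≡sym eh) B.bh<th) (subst (_< A.th) eh A.bh<th) B.bh<th
      in apart (u , v) (trans (≡sym (vanish (X s y) B.sl (y - A.bh) p)) (X-shared-bottom s s' (same-bot eh) eh y))
      where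
      l : ∀ x k z → x + (k - k) * z ≡ x
      l = solve-∀ ℚ-ring
      vanish : ∀ {a} x k z → a ≡ k → x + (k - a) * z ≡ x
      vanish x k z refl = l x k z

    top-slopes : A.th ≡ B.th → A.sl ≢ B.sl
    top-slopes eh p =
      let (y , u , v) = between A.bh<th (subst (A.bh <_) eh A.bh<th) (subst (B.bh <_) (≡sym eh) B.bh<th) B.bh<th
      in apart (u , v) (trans (≡sym (X-shared-top s s' (same-top eh) eh y)) (vanish (X s' y) B.sl (A.th - y) p))
      where
      l : ∀ x k z → x + (k - k) * z ≡ x
      l = solve-∀ ℚ-ring
      vanish : ∀ {a} x k z → a ≡ k → x + (k - a) * z ≡ x
      vanish x k z refl = l x k z

    -- This is `lower-diff` minus `upper-diff`, regrouped so that each bracket is the difference of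
    -- one function between the two ends of one segment. In this form conservation can be applied.
    κ : (side s' (bot s) ℤ.- side s' (top s)) ℤ.- (side s (bot s') ℤ.- side s (top s')) ℤ.+ θ s s' ≡ 0ℤ
    κ = trans (l (side s' (bot s)) (side s' (top s)) (side s (bot s')) (side s (top s'))
                 ⟦ A.bh QP.≟ B.bh ⟧ ⟦ A.th QP.≟ B.th ⟧ (sg A.sl B.sl))
              (trans (cong (ℤ._- upper-diff s s') diff-≡) (ℤP.+-inverseʳ (upper-diff s s')))
      where
      l : ∀ a b c d p q k → a ℤ.- b ℤ.- (c ℤ.- d) ℤ.+ (p ℤ.+ q) ℤ.* k ≡
          a ℤ.- c ℤ.+ p ℤ.* k ℤ.- (b ℤ.- d ℤ.- q ℤ.* k)
      l = ℤS.solve-∀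

-- Generic shears and upward orientation of segments.

module Shears where

  open import Defs
  open Rationals
  open Segments
  open LexEmbedding using (0<1)
  open import Data.Rational using (ℚ; 0ℚ; 1ℚ; _+_; _*_; _-_; -_; _≤_; _<_)
  import Data.Rational.Properties as QP
  open import Data.List using (List; []; _∷_)
  open import Data.List.Membership.Propositional using (_∈_)
  open import Data.List.Relation.Unary.Any using (here; there)
  open import Relation.Binary using (Tri; tri<; tri≈; tri>)
  open import Tactic.RingSolver using (solve-∀)

  opaque
    -- the height of a point after the shear (x , y) ↦ (x , y + l x)
    H : ℚ → Point → ℚ
    H l (x , y) = y + l * x

  Eventually : (ℚ → Set) → Set
  Eventually P = ∃[ b ] (∀ l → b ≤ l → P l)

  eventually-both : ∀ {P R : ℚ → Set} → Eventually P → Eventually R → Eventually (λ l → P l × R l)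
  eventually-both (b , f) (c , g) with QP.≤-total b c
  ... | inj₁ b≤c = c , λ l c≤l → f l (QP.≤-trans b≤c c≤l) , g l c≤l
  ... | inj₂ c≤b = b , λ l b≤l → f l b≤l , g l (QP.≤-trans c≤b b≤l)

  eventually-all : ∀ {A : Set} {P : A → ℚ → Set} (xs : List A) → (∀ x → Eventually (P x)) → Eventually (λ l → ∀ {x} → x ∈ xs → P x l)
  eventually-all [] ev = 0ℚ , λ _ _ ()
  eventually-all (x ∷ xs) ev =
    let (b , f) = eventually-both (ev x) (eventually-all xs ev)
    in b , λ l b≤l → λ { (here refl) → proj₁ (f l b≤l) ; (there p) → proj₂ (f l b≤l) p }

  opaque
    unfolding H

    -- Points with different abscissas get equal heights for a single value of l, namely (y - y') /
    -- (x' - x); one more than that value is a sufficient bound. Points on a common vertical line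
    -- keep their vertical distance.
    separated : ∀ P R → Eventually (λ l → H l P ≡ H l R → P ≡ R)
    separated (x , y) (x' , y') = go (QP.<-cmp x x')
      where
      less : ∀ {x y x' y'} → x < x' → Eventually (λ l → y + l * x ≢ y' + l * x')
      less {x} {y} {x'} {y'} lt = (y - y') * r + 1ℚ , λ l b≤l eq →
        <⇒≱ (by-diff-< 0<1 refl) (QP.≤-trans b≤l (QP.≤-reflexive (value l eq)))
        where
        r : ℚ
        r = proj₁ (inv (<⇒0<- lt))
        r* : r * (x' - x) ≡ 1ℚ
        r* = proj₂ (proj₂ (inv (<⇒0<- lt)))
        l₁ : ∀ l y y' x x' r → l * (r * (x' - x)) ≡ (y - y') * r + r * ((y' + l * x') - (y + l * x))
        l₁ = solve-∀ ℚ-ring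
        l₂ : ∀ a r z → a + r * (z - z) ≡ a
        l₂ = solve-∀ ℚ-ring
        value : ∀ l → y + l * x ≡ y' + l * x' → l ≡ (y - y') * r
        value l eq = trans (≡sym (QP.*-identityʳ l)) (trans (cong (l *_) (≡sym r*)) (trans (l₁ l y y' x x' r)
          (trans (cong (λ z → (y - y') * r + r * ((y' + l * x') - z)) eq) (l₂ ((y - y') * r) r (y' + l * x')))))
      go : Tri (x < x') (x ≡ x') (x' < x) → Eventually (λ l → y + l * x ≡ y' + l * x' → (x , y) ≡ (x' , y'))
      go (tri< lt _ _) = let (b , f) = less {x} {y} {x'} {y'} lt in b , λ l b≤l eq → ⊥-elim (f l b≤l eq)
      go (tri> _ _ gt) = let (b , f) = less {x'} {y'} {x} {y} gt in b , λ l b≤l eq → ⊥-elim (f l b≤l (≡sym eq))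
      go (tri≈ _ eqx _) = 0ℚ , λ l _ eq → cong₂ _,_ eqx (cancel l eqx eq)
        where
        c : ∀ y z → y + z - z ≡ y
        c = solve-∀ ℚ-ring
        cancel : ∀ l → x ≡ x' → y + l * x ≡ y' + l * x' → y ≡ y'
        cancel l refl eq = trans (≡sym (c y (l * x))) (trans (cong (_- l * x) eq) (c y' (l * x)))

  generic-shear : (ps : List Point) → ∃[ l ] (∀ {P R} → P ∈ ps → R ∈ ps → H l P ≡ H l R → P ≡ R)
  generic-shear ps =
    let (b , f) = eventually-all ps (λ P → eventually-all ps (λ R → separated P R))
    in b , λ p r → f b QP.≤-refl p r

  module Sheared (l : ℚ) where

    sh : Point → Pt
    sh P = proj₁ P , H l P

    Up Down : Seg → Point → Point → Set
    Up s A B = bot s ≡ sh A × top s ≡ sh B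
    Down s A B = bot s ≡ sh B × top s ≡ sh A

    upward : ∀ A B → H l A < H l B → Σ[ s ∈ Seg ] Up s A B
    upward A B lt = record { bx = proj₁ A ; bh = H l A ; tx = proj₁ B ; th = H l B ; sl = (proj₁ B - proj₁ A) * r
                           ; bh<th = lt ; line = eq } , refl , refl
      where
      r a b : ℚ
      r = proj₁ (inv (<⇒0<- lt))
      a = H l A
      b = H l B
      e : ∀ x x' r d → x + (x' - x) * r * d ≡ x + (x' - x) * (r * d)
      e = solve-∀ ℚ-ring
      e₂ : ∀ x x' → x' ≡ x + (x' - x) * 1ℚ
      e₂ = solve-∀ ℚ-ring
      eq : proj₁ B ≡ proj₁ A + (proj₁ B - proj₁ A) * r * (b - a)
      eq = trans (e₂ (proj₁ A) (proj₁ B)) (trans (cong (λ k → proj₁ A + (proj₁ B - proj₁ A) * k) (≡sym (proj₂ (proj₂ (inv (<⇒0<- lt))))))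
                 (≡sym (e (proj₁ A) (proj₁ B) r (b - a))))

    directed : ∀ A B → H l A ≢ H l B → Σ[ s ∈ Seg ] (Up s A B ⊎ Down s A B)
    directed A B ne with QP.<-cmp (H l A) (H l B)
    ... | tri< lt _ _ = let (s , u) = upward A B lt in s , inj₁ u
    ... | tri≈ _ eq _ = ⊥-elim (ne eq)
    ... | tri> _ _ gt = let (s , u) = upward B A gt in s , inj₂ u

    unshear : Seg → ℚ → Point
    unshear s y = X s y , y - l * X s y

    opaque
      unfolding H X

      H-unshear : ∀ s y → H l (unshear s y) ≡ y
      H-unshear s y = e y (l * X s y)
        where
        e : ∀ y z → y - z + z ≡ y
        e = solve-∀ ℚ-ring

      private
        on-line : ∀ s xa ya xb yb → Seg.bx s ≡ xa → Seg.bh s ≡ ya + l * xa → Seg.tx s ≡ xb → Seg.th s ≡ yb + l * xb →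
          ∀ y t → t * (Seg.th s - Seg.bh s) ≡ y - Seg.bh s →
          (X s y ≡ xa + t * (xb - xa)) × (y - l * X s y ≡ ya + t * (yb - ya))
        on-line s xa ya xb yb ea eha eb ehb y t et = ex ,
          trans (cong₂ (λ u v → u - l * v) ey ex) (e₅ l xa ya xb yb t)
          where
          e₁ : ∀ b sl t d → b + sl * (t * d) ≡ b + t * (b + sl * d - b)
          e₁ = solve-∀ ℚ-ring
          ex : X s y ≡ xa + t * (xb - xa)
          ex = trans (cong (λ k → Seg.bx s + Seg.sl s * k) (≡sym et))
            (trans (e₁ (Seg.bx s) (Seg.sl s) t (Seg.th s - Seg.bh s))
              (trans (cong (λ k → Seg.bx s + t * (k - Seg.bx s)) (trans (≡sym (Seg.line s)) eb)) (cong (λ k → k + t * (xb - k)) ea)))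
          ey : y ≡ (ya + l * xa) + t * ((yb + l * xb) - (ya + l * xa))
          ey = trans (≡sym (p+[q-p] (Seg.bh s) y)) (trans (cong (Seg.bh s +_) (≡sym et))
            (cong₂ (λ p q → p + t * (q - p)) eha ehb))
          e₅ : ∀ l xa ya xb yb t → ((ya + l * xa) + t * ((yb + l * xb) - (ya + l * xa))) - l * (xa + t * (xb - xa)) ≡ ya + t * (yb - ya)
          e₅ = solve-∀ ℚ-ring

      on-up : ∀ s {A B} → Up s A B → ∀ {y} → Seg.bh s ≤ y → y ≤ Seg.th s → OnSeg (unshear s y) A B
      on-up s {xa , ya} {xb , yb} (eb , et) {y} lo hi =
        let (t , 0≤t , t≤1 , eq) = ratio (Seg.bh<th s) lo hi
            (p , q) = on-line s xa ya xb yb (cong proj₁ eb) (cong proj₂ eb) (cong proj₁ et) (cong proj₂ et) y t eq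
        in t , 0≤t , t≤1 , p , q

    flip-OnSeg : ∀ {p A B} → OnSeg p A B → OnSeg p B A
    flip-OnSeg {px , py} {xa , ya} {xb , yb} (t , 0≤t , t≤1 , ex , ey) =
      1ℚ - t , ≤⇒0≤- t≤1 , by-diff-≤ 0≤t (e₀ 1ℚ t) ,
      trans ex (e xa xb t) , trans ey (e ya yb t)
      where
      e₀ : ∀ o t → o - t + t ≡ o
      e₀ = solve-∀ ℚ-ring
      e : ∀ a b t → a + t * (b - a) ≡ b + (1ℚ - t) * (a - b)
      e = solve-∀ ℚ-ring

    on-directed : ∀ s {A B} → Up s A B ⊎ Down s A B → ∀ {y} → Seg.bh s ≤ y → y ≤ Seg.th s → OnSeg (unshear s y) A B
    on-directed s (inj₁ u) lo hi = on-up s u lo hi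
    on-directed s {A} {B} (inj₂ (eb , et)) {y} lo hi = flip-OnSeg {unshear s y} {B} {A} (on-up s (eb , et) lo hi)

    end-height : ∀ s {A B} → Up s A B ⊎ Down s A B → ∀ {p} → p ≡ A ⊎ p ≡ B → H l p ≡ Seg.bh s ⊎ H l p ≡ Seg.th s
    end-height s (inj₁ (eb , et)) (inj₁ refl) = inj₁ (≡sym (cong proj₂ eb))
    end-height s (inj₁ (eb , et)) (inj₂ refl) = inj₂ (≡sym (cong proj₂ et))
    end-height s (inj₂ (eb , et)) (inj₁ refl) = inj₂ (≡sym (cong proj₂ et))
    end-height s (inj₂ (eb , et)) (inj₂ refl) = inj₁ (≡sym (cong proj₂ eb))

    disjoint : ∀ s s' {A B A' B'} → Up s A B ⊎ Down s A B → Up s' A' B' ⊎ Down s' A' B' →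
      (∀ {P R} → P ≡ A ⊎ P ≡ B → R ≡ A' ⊎ R ≡ B' → H l P ≡ H l R → P ≡ R) →
      (∀ p → OnSeg p A B → OnSeg p A' B' → (p ≡ A ⊎ p ≡ B) × (p ≡ A' ⊎ p ≡ B')) → Disjoint s s'
    disjoint s s' {A} {B} {A'} {B'} d d' generic meets = record { no-cross = no-cross ; same-bot = same-bot d d' ; same-top = same-top d d' }
      where
      no-cross : ∀ {y} → Seg.bh s ≤ y → y ≤ Seg.th s → Seg.bh s' ≤ y → y ≤ Seg.th s' → X s y ≡ X s' y →
                 (y ≡ Seg.bh s ⊎ y ≡ Seg.th s) × (y ≡ Seg.bh s' ⊎ y ≡ Seg.th s')
      no-cross {y} a b a' b' eq =
        subst (λ z → z ≡ Seg.bh s ⊎ z ≡ Seg.th s) (H-unshear s y) (end-height s d (proj₁ meet)) ,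
        subst (λ z → z ≡ Seg.bh s' ⊎ z ≡ Seg.th s') (H-unshear s y) (end-height s' d' (proj₂ meet))
        where
        meet = meets (unshear s y) (on-directed s d a b)
              (subst (λ p → OnSeg p A' B') (cong (λ z → z , y - l * z) (≡sym eq)) (on-directed s' d' a' b'))
      pick : ∀ {P R : Point} {p r : Pt} → p ≡ sh P → r ≡ sh R → (H l P ≡ H l R → P ≡ R) → proj₂ p ≡ proj₂ r → proj₁ p ≡ proj₁ r
      pick e f g h = trans (cong proj₁ e) (trans (cong proj₁ (g (trans (≡sym (cong proj₂ e)) (trans h (cong proj₂ f))))) (≡sym (cong proj₁ f)))
      same-bot : Up s A B ⊎ Down s A B → Up s' A' B' ⊎ Down s' A' B' → Seg.bh s ≡ Seg.bh s' → Seg.bx s ≡ Seg.bx s'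
      same-bot (inj₁ (e , _)) (inj₁ (f , _)) = pick e f (generic (inj₁ refl) (inj₁ refl))
      same-bot (inj₁ (e , _)) (inj₂ (f , _)) = pick e f (generic (inj₁ refl) (inj₂ refl))
      same-bot (inj₂ (e , _)) (inj₁ (f , _)) = pick e f (generic (inj₂ refl) (inj₁ refl))
      same-bot (inj₂ (e , _)) (inj₂ (f , _)) = pick e f (generic (inj₂ refl) (inj₂ refl))
      same-top : Up s A B ⊎ Down s A B → Up s' A' B' ⊎ Down s' A' B' → Seg.th s ≡ Seg.th s' → Seg.tx s ≡ Seg.tx s'
      same-top (inj₁ (_ , e)) (inj₁ (_ , f)) = pick e f (generic (inj₂ refl) (inj₂ refl))
      same-top (inj₁ (_ , e)) (inj₂ (_ , f)) = pick e f (generic (inj₂ refl) (inj₁ refl))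
      same-top (inj₂ (_ , e)) (inj₁ (_ , f)) = pick e f (generic (inj₁ refl) (inj₂ refl))
      same-top (inj₂ (_ , e)) (inj₂ (_ , f)) = pick e f (generic (inj₁ refl) (inj₁ refl))

-- Edge lists, neighbour lists and sums over darts.

module Edges where

  open import Defs hiding (V)
  open Sums
  open Contraction using (⟦_⟧; ⟦⟧-yes; ⟦⟧-no)
  open ComplementVPG using (edge-≡)
  open import Data.Bool using (Bool; true)
  import Data.Bool as Bool
  open import Data.Nat using (zero; suc)
  open import Data.Fin as F using (Fin; zero; suc; fromℕ; inject₁)
  import Data.Fin.Properties as FP
  open import Data.Integer using (ℤ; _+_; _*_; _-_; -_)
  import Data.Integer.Properties as ℤP
  open import Data.Integer.Tactic.RingSolver using (solve-∀)
  open import Data.List using (List; []; _∷_; map; filter; concatMap; allFin)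
  import Data.List.Properties as LP
  open import Data.List.Membership.Propositional using (_∈_)
  open import Data.List.Membership.Propositional.Properties using (∈-allFin; ∈-concatMap⁺)
  open import Data.List.Relation.Unary.Any as Any using (here)
  import Data.List.Relation.Unary.Unique.Propositional.Properties as UniqueP
  open import Relation.Nullary.Decidable using (_×-dec_)
  open import Relation.Binary using (Tri; tri<; tri≈; tri>)

  Σ-concatMap : ∀ {A B : Set} (f : A → List B) xs (g : B → ℤ) → Σˡ (concatMap f xs) g ≡ Σˡ xs (λ x → Σˡ (f x) g)
  Σ-concatMap f [] g = refl
  Σ-concatMap f (x ∷ xs) g = trans (Σ-++ (f x) (concatMap f xs) g) (cong (Σˡ (f x) g +_) (Σ-concatMap f xs g))

  Σ-⟦⟧ : ∀ {A : Set} {P : A → Set} (P? : ∀ x → Dec (P x)) (xs : List A) f → Σˡ (filter P? xs) f ≡ Σˡ xs (λ x → ⟦ P? x ⟧ * f x)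
  Σ-⟦⟧ P? [] f = refl
  Σ-⟦⟧ P? (x ∷ xs) f with P? x
  ... | yes _ = cong₂ _+_ (≡sym (ℤP.*-identityˡ (f x))) (Σ-⟦⟧ P? xs f)
  ... | no _ = trans (Σ-⟦⟧ P? xs f) (≡sym (ℤP.+-identityˡ _))

  Σ-allFin-suc : ∀ m (f : Fin (suc m) → ℤ) → Σˡ (allFin (suc m)) f ≡ f zero + Σˡ (allFin m) (λ i → f (suc i))
  Σ-allFin-suc m f = cong (f zero +_) (trans (cong (λ l → Σˡ l f) (≡sym (LP.map-tabulate (λ i → i) suc))) (Σ-map (allFin m) suc f))

  Σ-telescope : ∀ m (f : Fin (suc (suc m)) → ℤ) →
                Σˡ (allFin (suc m)) (λ i → f (inject₁ i) - f (suc i)) ≡ f zero - f (fromℕ (suc m))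
  Σ-telescope zero f = ℤP.+-identityʳ _
  Σ-telescope (suc m) f =
    trans (Σ-allFin-suc (suc m) (λ i → f (inject₁ i) - f (suc i)))
      (trans (cong (f zero - f (suc zero) +_) (Σ-telescope m (λ i → f (suc i)))) (l (f zero) (f (suc zero)) (f (suc (fromℕ (suc m))))))
    where
    l : ∀ a b c → a - b + (b - c) ≡ a - c
    l = solve-∀

  module EdgeList (G : SimpleGraph) where

    V = Fin (n G)
    E = Edge G

    edge? : ∀ u v → Dec ((u F.< v) × (adj G u v ≡ true))
    edge? u v = (u F.<? v) ×-dec (adj G u v Bool.≟ true)

    singleton : ∀ {u v} → Dec ((u F.< v) × (adj G u v ≡ true)) → List E
    singleton {u} {v} (yes (p , q)) = ((u , v) , p , q) ∷ []
    singleton (no _) = []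

    edges : List E
    edges = concatMap (λ u → concatMap (λ v → singleton (edge? u v)) (allFin (n G))) (allFin (n G))

    ∈edges : ∀ e → e ∈ edges
    ∈edges e@((u , v) , p , q) = ∈-concatMap⁺ _ {xs = allFin (n G)}
      (Any.map (λ { refl → ∈-concatMap⁺ (λ v → singleton (edge? u v)) {xs = allFin (n G)} (Any.map (λ { refl → mem (edge? u v) }) (∈-allFin v)) }) (∈-allFin u))
      where
      mem : ∀ (d : Dec ((u F.< v) × (adj G u v ≡ true))) → e ∈ singleton d
      mem (yes (p' , q')) = here (edge-≡ {G} e _ refl refl)
      mem (no np) = ⊥-elim (np (p , q))

    ΣV : (V → ℤ) → ℤ
    ΣV = Σˡ (allFin (n G))

    nbrs : V → List V
    nbrs v = filter (λ w → adj G v w Bool.≟ true) (allFin (n G))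

    private
      weight : V → V → ℤ
      weight u v = ⟦ edge? u v ⟧

      Σ-singleton : ∀ {u v} (d : Dec ((u F.< v) × (adj G u v ≡ true))) (f : V → V → ℤ) →
                    Σˡ (singleton d) (λ e → f (src {G} e) (tgt {G} e)) ≡ ⟦ d ⟧ * f u v
      Σ-singleton (yes _) f = trans (ℤP.+-identityʳ _) (≡sym (ℤP.*-identityˡ _))
      Σ-singleton (no _) f = refl

      Σ-edges : ∀ f → Σˡ edges (λ e → f (src {G} e) (tgt {G} e)) ≡ ΣV (λ u → ΣV (λ v → weight u v * f u v))
      Σ-edges f = trans (Σ-concatMap _ (allFin (n G)) _) (Σ-cong (allFin (n G)) (λ {u} _ →
        trans (Σ-concatMap (λ v → singleton (edge? u v)) (allFin (n G)) _) (Σ-cong (allFin (n G)) (λ {v} _ → Σ-singleton (edge? u v) f))))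

      weights : ∀ u v → weight u v + weight v u ≡ ⟦ adj G u v Bool.≟ true ⟧
      weights u v = go (adj G u v Bool.≟ true) (FP.<-cmp u v)
        where
        go : (d : Dec (adj G u v ≡ true)) → Tri (u F.< v) (u ≡ v) (v F.< u) → weight u v + weight v u ≡ ⟦ d ⟧
        go (no np) _ = cong₂ _+_ (⟦⟧-no (edge? u v) (λ (_ , q) → np q)) (⟦⟧-no (edge? v u) (λ (_ , q) → np (trans (SimpleGraph.sym G u v) q)))
        go (yes p) (tri< lt _ ngt) = cong₂ _+_ (⟦⟧-yes (edge? u v) (lt , p)) (⟦⟧-no (edge? v u) (λ (q , _) → ngt q))
        go (yes p) (tri> nlt _ gt) = cong₂ _+_ (⟦⟧-no (edge? u v) (λ (q , _) → nlt q)) (⟦⟧-yes (edge? v u) (gt , trans (SimpleGraph.sym G v u) p))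
        go (yes p) (tri≈ _ refl _) with trans (≡sym p) (irrefl G u)
        ... | ()

    -- Double counting: of the two ordered pairs of adjacent vertices exactly one is increasing, so
    -- the two weights add up to the adjacency indicator.
    Σ-darts : ∀ f → Σˡ edges (λ e → f (src {G} e) (tgt {G} e) + f (tgt {G} e) (src {G} e)) ≡ ΣV (λ v → Σˡ (nbrs v) (f v))
    Σ-darts f = begin
      Σˡ edges (λ e → f (src {G} e) (tgt {G} e) + f (tgt {G} e) (src {G} e))
        ≡⟨ Σ-+ edges _ _ ⟩
      Σˡ edges (λ e → f (src {G} e) (tgt {G} e)) + Σˡ edges (λ e → f (tgt {G} e) (src {G} e))
        ≡⟨ cong₂ _+_ (Σ-edges f) (trans (Σ-edges (λ u v → f v u)) (Σ-swap (allFin (n G)) (allFin (n G)) _)) ⟩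
      ΣV (λ u → ΣV (λ v → weight u v * f u v)) + ΣV (λ u → ΣV (λ v → weight v u * f u v))
        ≡⟨ Σ-+ (allFin (n G)) _ _ ⟨
      ΣV (λ u → ΣV (λ v → weight u v * f u v) + ΣV (λ v → weight v u * f u v))
        ≡⟨ Σ-cong (allFin (n G)) (λ {u} _ → trans (≡sym (Σ-+ (allFin (n G)) _ _)) (Σ-cong (allFin (n G)) (λ {v} _ →
             trans (≡sym (ℤP.*-distribʳ-+ (f u v) (weight u v) (weight v u))) (cong (_* f u v) (weights u v))))) ⟩
      ΣV (λ u → ΣV (λ v → ⟦ adj G u v Bool.≟ true ⟧ * f u v))
        ≡⟨ Σ-cong (allFin (n G)) (λ {u} _ → ≡sym (Σ-⟦⟧ (λ w → adj G u w Bool.≟ true) (allFin (n G)) (f u))) ⟩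
      ΣV (λ v → Σˡ (nbrs v) (f v)) ∎
      where open ≡-Reasoning

    Σ-at : ∀ v (f : V → ℤ) → ΣV (λ w → ⟦ v F.≟ w ⟧ * f w) ≡ f v
    Σ-at v f = trans (Σ-single (UniqueP.allFin⁺ (n G)) (∈-allFin v)
                  (λ {y} _ ne → cong (_* f y) (⟦⟧-no (v F.≟ y) (λ e → ne (≡sym e)))))
                (trans (cong (_* f v) (⟦⟧-yes (v F.≟ v) refl)) (ℤP.*-identityˡ (f v)))

-- Sides of the arcs of a plane drawing as segments that do not cross.

module PlaneArcs where

  open import Defs hiding (V)
  open Rationals
  open Contraction using (⟦_⟧)
  open ComplementVPG using (edge-≡)
  open Segments
  open Shears
  open Edges
  open import Data.Nat as ℕ using (ℕ; zero; suc; s≤s)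
  import Data.Nat.Properties as ℕP
  open import Data.Fin as F using (Fin; zero; suc; toℕ; fromℕ; inject₁)
  import Data.Fin.Properties as FP
  open import Data.Integer using (ℤ; 0ℤ; _+_; _*_; _-_; -_)
  import Data.Integer.Properties as ℤP
  open import Data.Integer.Tactic.RingSolver using (solve-∀)
  open import Data.Rational as Q using (ℚ; 0ℚ; 1ℚ)
  import Data.Rational.Properties as QP
  import Tactic.RingSolver as RS
  open import Data.List using (List; map; concatMap; tabulate)
  open import Data.List.Membership.Propositional using (_∈_)
  open import Data.List.Membership.Propositional.Properties using (∈-concatMap⁺; ∈-tabulate⁺)
  import Data.List.Relation.Unary.Any as Any
  open import Data.Product.Properties using (≡-dec)
  open import Relation.Nullary.Decidable using (_×-dec_; map′)
  open import Relation.Binary using (tri<; tri≈; tri>)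

  start-OnSeg : ∀ A B → OnSeg A A B
  start-OnSeg (x , y) (x' , y') = 0ℚ , QP.≤-refl , QP.<⇒≤ (QP.positive⁻¹ 1ℚ) , e x x' , e y y'
    where
    e : ∀ a b → a ≡ a Q.+ 0ℚ Q.* (b Q.- a)
    e = RS.solve-∀ ℚ-ring

  end-OnSeg : ∀ A B → OnSeg B A B
  end-OnSeg (x , y) (x' , y') = 1ℚ , QP.<⇒≤ (QP.positive⁻¹ 1ℚ) , QP.≤-refl , e x x' , e y y'
    where
    e : ∀ a b → b ≡ a Q.+ 1ℚ Q.* (b Q.- a)
    e = RS.solve-∀ ℚ-ring

  module Polygonal (P : Polyline) (simple : SimplePoly P) where

    OnSide : Point → Fin (suc (m P)) → Set
    OnSide p i = OnSeg p (segA P i) (segB P i)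

    IsEnd : Point → Fin (suc (m P)) → Set
    IsEnd p i = p ≡ segA P i ⊎ p ≡ segB P i

    private
      ordered : ∀ i j → toℕ i ℕ.< toℕ j → ∀ p → OnSide p i → OnSide p j → IsEnd p i × IsEnd p j
      ordered i j lt p on on' with ℕP.m≤n⇒m<n∨m≡n lt
      ... | inj₁ far = ⊥-elim (proj₂ (proj₂ simple) i j far p on on')
      ... | inj₂ eq = inj₂ e , inj₁ (trans e (cong (pt P) (FP.toℕ-injective (trans eq (≡sym (FP.toℕ-inject₁ j))))))
        where e = proj₁ (proj₂ simple) i j eq p on on'

    sides-meet : ∀ i j → i ≢ j → ∀ p → OnSide p i → OnSide p j → IsEnd p i × IsEnd p j
    sides-meet i j ne p on on' with ℕP.<-cmp (toℕ i) (toℕ j)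
    ... | tri< lt _ _ = ordered i j lt p on on'
    ... | tri> _ _ gt = let (a , b) = ordered j i gt p on' on in b , a
    ... | tri≈ _ eq _ = ⊥-elim (ne (FP.toℕ-injective eq))

    last : Fin (suc (m P))
    last = fromℕ (m P)

    start-IsEnd : ∀ i → OnSide (startP P) i → IsEnd (startP P) i
    start-IsEnd zero _ = inj₁ refl
    start-IsEnd i@(suc _) on = proj₂ (sides-meet zero i (λ ()) (startP P) (start-OnSeg (segA P zero) (segB P zero)) on)

    end-IsEnd : ∀ i → OnSide (endP P) i → IsEnd (endP P) i
    end-IsEnd i on with i F.≟ last
    ... | yes refl = inj₂ refl
    ... | no ne = proj₂ (sides-meet last i (λ e → ne (≡sym e)) (endP P) (end-OnSeg (segA P last) (segB P last)) on)

    private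
      -- Simplicity speaks of sides only, so the earlier point is taken as the start of its side and
      -- the later one as the end of the side before it. These sides are equal, consecutive or
      -- apart, and in each case a coincidence makes a side degenerate or violates simplicity.
      pt-inj-< : ∀ i j → toℕ i ℕ.< toℕ j → pt P i ≢ pt P j
      pt-inj-< i (suc j) (s≤s le) eq = go (ℕP.m≤n⇒m<n∨m≡n le)
        where
        i' : Fin (suc (m P))
        i' = F.lower₁ i (λ e → ℕP.<-irrefl (≡sym e) (ℕP.≤-trans (s≤s le) (ℕP.≤-pred (FP.toℕ<n (suc j)))))
        i'≡ : inject₁ i' ≡ i
        i'≡ = FP.inject₁-lower₁ i _
        toℕ-i' : toℕ i' ≡ toℕ i
        toℕ-i' = trans (≡sym (FP.toℕ-inject₁ i')) (cong toℕ i'≡)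
        on-i' : OnSide (pt P i) i'
        on-i' = subst (λ k → OnSide (pt P k) i') i'≡ (start-OnSeg (segA P i') (segB P i'))
        on-j : OnSide (pt P i) j
        on-j = subst (λ z → OnSide z j) (≡sym eq) (end-OnSeg (segA P j) (segB P j))
        later : suc (toℕ i) ℕ.< toℕ j ⊎ suc (toℕ i) ≡ toℕ j → ⊥
        later (inj₁ far) = proj₂ (proj₂ simple) i' j (subst (λ k → suc k ℕ.< toℕ j) (≡sym toℕ-i') far) (pt P i) on-i' on-j
        later (inj₂ e) = proj₁ simple i' (trans (cong (pt P) i'≡) (proj₁ (proj₂ simple) i' j (trans (cong suc toℕ-i') e) (pt P i) on-i' on-j))
        go : toℕ i ℕ.< toℕ j ⊎ toℕ i ≡ toℕ j → ⊥
        go (inj₂ e) = proj₁ simple j (trans (cong (pt P) (≡sym (trans (≡sym i'≡) (cong inject₁ (FP.toℕ-injective (trans toℕ-i' e)))))) eq)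
        go (inj₁ lt) = later (ℕP.m≤n⇒m<n∨m≡n lt)

    pt-inj : ∀ i j → pt P i ≡ pt P j → i ≡ j
    pt-inj i j eq with ℕP.<-cmp (toℕ i) (toℕ j)
    ... | tri< lt _ _ = ⊥-elim (pt-inj-< i j lt eq)
    ... | tri≈ _ e _ = FP.toℕ-injective e
    ... | tri> _ _ gt = ⊥-elim (pt-inj-< j i gt (≡sym eq))

  module Drawn {G : SimpleGraph} (D : PlaneDrawing G) where

    open PlaneDrawing D
    open EdgeList G

    Sides : E → Set
    Sides e = Fin (suc (m (arc e)))

    private
      module Arc (e : E) = Polygonal (arc e) (arc-simple e)

    allPoints : List Point
    allPoints = concatMap (λ e → tabulate (pt (arc e))) edges

    ∈allPoints : ∀ e j → pt (arc e) j ∈ allPoints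
    ∈allPoints e j = ∈-concatMap⁺ (λ e → tabulate (pt (arc e))) {xs = edges} (Any.map (λ { refl → ∈-tabulate⁺ {f = pt (arc e)} j }) (∈edges e))

    λ₀ : ℚ
    λ₀ = proj₁ (generic-shear allPoints)

    open Sheared λ₀

    A B : ∀ e → Sides e → Point
    A e i = segA (arc e) i
    B e i = segB (arc e) i

    opaque
      oriented : ∀ e i → Σ[ s ∈ Seg ] (Up s (A e i) (B e i) ⊎ Down s (A e i) (B e i))
      oriented e i = directed (A e i) (B e i) (λ eq → proj₁ (arc-simple e) i
        (proj₂ (generic-shear allPoints) (∈allPoints e (inject₁ i)) (∈allPoints e (suc i)) eq))

    seg : ∀ e → Sides e → Seg
    seg e i = proj₁ (oriented e i)

    ori : ∀ e i → Up (seg e i) (A e i) (B e i) ⊎ Down (seg e i) (A e i) (B e i)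
    ori e i = proj₂ (oriented e i)

    edge-≟ : (e f : E) → Dec (e ≡ f)
    edge-≟ e f = map′ (λ (p , q) → edge-≡ {G} e f p q) (λ { refl → refl , refl }) ((src {G} e F.≟ src {G} f) ×-dec (tgt {G} e F.≟ tgt {G} f))

    point-≟ : (p q : Point) → Dec (p ≡ q)
    point-≟ = ≡-dec QP._≟_ QP._≟_

    shared-point : ∀ e f → e ≢ f → ∀ p → OnPoly p (arc e) → OnPoly p (arc f) → p ≡ startP (arc e) ⊎ p ≡ endP (arc e)
    shared-point e f ne p on on' with point-≟ p (startP (arc e)) | point-≟ p (endP (arc e))
    ... | yes q | _ = inj₁ q
    ... | no _ | yes q = inj₂ q
    ... | no q | no r = ⊥-elim (no-cross e f (λ (a , b) → ne (edge-≡ {G} e f a b)) p (on , q , r) on')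

    -- By `no-cross` a common point is an end of the arc, and in a simple polyline an end of the arc
    -- lies on a side only as an end of that side.
    arcs-meet : ∀ e f → e ≢ f → ∀ i j p → Arc.OnSide e p i → Arc.OnSide f p j → Arc.IsEnd e p i
    arcs-meet e f ne i j p on on' with shared-point e f ne p (i , on) (j , on')
    ... | inj₁ refl = Arc.start-IsEnd e i on
    ... | inj₂ refl = Arc.end-IsEnd e i on

    private
      endpoint∈ : ∀ e i {p} → p ≡ A e i ⊎ p ≡ B e i → p ∈ allPoints
      endpoint∈ e i (inj₁ refl) = ∈allPoints e (inject₁ i)
      endpoint∈ e i (inj₂ refl) = ∈allPoints e (suc i)

      disjoint-segs : ∀ e i f j →
        (∀ p → OnSeg p (A e i) (B e i) → OnSeg p (A f j) (B f j) → (p ≡ A e i ⊎ p ≡ B e i) × (p ≡ A f j ⊎ p ≡ B f j)) →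
        Disjoint (seg e i) (seg f j)
      disjoint-segs e i f j = disjoint (seg e i) (seg f j) (ori e i) (ori f j)
        (λ p r eq → proj₂ (generic-shear allPoints) (endpoint∈ e i p) (endpoint∈ f j r) eq)

    other-arc : ∀ e i f j → e ≢ f → Disjoint (seg e i) (seg f j)
    other-arc e i f j ne = disjoint-segs e i f j (λ p on on' →
      arcs-meet e f ne i j p on on' , arcs-meet f e (λ q → ne (≡sym q)) j i p on' on)

    same-arc : ∀ e i j → i ≢ j → Disjoint (seg e i) (seg e j)
    same-arc e i j ne = disjoint-segs e i e j (Arc.sides-meet e i j ne)

    κ-expr : Seg → Seg → ℤ
    κ-expr s s' = (side s' (bot s) - side s' (top s)) - (side s (bot s') - side s (top s')) + θ s s'

    κ-self : ∀ s → κ-expr s s ≡ 0ℤ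
    κ-self s = cong₂ _+_ (ℤP.+-inverseʳ (side s (bot s) - side s (top s)))
      (trans (cong ((⟦ Seg.bh s QP.≟ Seg.bh s ⟧ + ⟦ Seg.th s QP.≟ Seg.th s ⟧) *_) (sg-≡ refl)) (ℤP.*-zeroʳ (⟦ Seg.bh s QP.≟ Seg.bh s ⟧ + ⟦ Seg.th s QP.≟ Seg.th s ⟧)))

    κ-all : ∀ e i f j → κ-expr (seg e i) (seg f j) ≡ 0ℤ
    κ-all e i f j = go (edge-≟ e f) i j
      where
      same : ∀ i j → Dec (i ≡ j) → κ-expr (seg e i) (seg e j) ≡ 0ℤ
      same i j (yes refl) = κ-self (seg e i)
      same i j (no ne) = Pair.κ (same-arc e i j ne)
      go : ∀ {f} → Dec (e ≡ f) → ∀ i (j : Sides f) → κ-expr (seg e i) (seg f j) ≡ 0ℤ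
      go {f} (no ne) i j = Pair.κ (other-arc e i f j ne)
      go (yes refl) i j = same i j (i F.≟ j)

-- Summation over all pairs of segments and localisation at the vertices.

module DartSums where

  open import Defs hiding (V)
  open Sums
  open Contraction using (⟦_⟧; ⟦⟧-yes; ⟦⟧-no)
  open ComplementVPG using (edge-≡)
  open Segments
  open Shears
  open Edges
  open PlaneArcs
  open import Data.Bool using (Bool; true; false)
  import Data.Bool as Bool
  open import Data.Nat using (zero; suc)
  open import Data.Fin as F using (Fin; zero; suc; fromℕ; inject₁)
  import Data.Fin.Properties as FP
  open import Data.Integer as ℤ using (ℤ; 0ℤ; 1ℤ; _+_; _*_; _-_; -_)
  import Data.Integer.Properties as ℤP
  open import Data.Integer.Tactic.RingSolver using (solve-∀)
  open import Data.Rational using (ℚ; 0ℚ)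
  import Data.Rational.Properties as QP
  open import Data.List using (List; map; concatMap; allFin)
  open import Data.List.Membership.Propositional using (_∈_)
  open import Data.List.Membership.Propositional.Properties using (∈-allFin; ∈-filter⁻)
  open import Data.List.Relation.Unary.Unique.Propositional using (Unique)
  import Data.List.Relation.Unary.Unique.Propositional.Properties as UniqueP
  open import Data.Sum using ([_,_]′)
  open import Relation.Binary using (Tri; tri<; tri≈; tri>)

  self-negative : ∀ (x : ℤ) → x ≡ - x → x ≡ 0ℤ
  self-negative (ℤ.+ zero) _ = refl
  self-negative (ℤ.+ suc _) ()
  self-negative (ℤ.-[1+ _ ]) ()

  Σ-antisym : ∀ {A : Set} (xs : List A) (k : A → A → ℤ) → (∀ x y → k x y ≡ - k y x) → Σˡ xs (λ x → Σˡ xs (k x)) ≡ 0ℤ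
  Σ-antisym xs k anti = self-negative _ (trans
    (Σ-cong xs (λ {x} _ → trans (Σ-cong xs (λ {y} _ → anti x y)) (Σ-neg xs (λ y → k y x))))
    (trans (Σ-neg xs (λ x → Σˡ xs (λ y → k y x))) (cong -_ (Σ-swap xs xs (λ x y → k y x)))))

  Σ-corner : ∀ {A B : Set} {xs : List A} {ys : List B} (a : A → B → ℤ) {i₀ j₀} → Unique xs → i₀ ∈ xs → Unique ys → j₀ ∈ ys →
             (∀ i j → i ≢ i₀ ⊎ j ≢ j₀ → a i j ≡ 0ℤ) → Σˡ xs (λ i → Σˡ ys (a i)) ≡ a i₀ j₀
  Σ-corner {ys = ys} a {i₀} ux ix uy iy z = trans
    (Σ-single ux ix (λ {i} _ ne → Σ-0 ys (λ {j} _ → z i j (inj₁ ne))))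
    (Σ-single uy iy (λ {j} _ ne → z i₀ j (inj₂ ne)))

  -- an end of a segment, seen from its endpoint; lev says whether it is the bottom end
  record Half : Set where
    field
      hgt   : ℚ
      lev   : Bool
      slope : ℚ
  open Half

  lv : Bool → Bool → ℤ
  lv true true = 1ℤ
  lv true false = 0ℤ
  lv false true = 0ℤ
  lv false false = 1ℤ

  -- Slopes are compared only between two ends that both go up or both go down. How an upward end
  -- lies relative to a downward one is not recorded; conservation later makes up for these pairs.
  ψ halfθ : Half → Half → ℤ
  ψ h h' = lv (lev h) (lev h') * sg (slope h) (slope h')
  halfθ h h' = ⟦ hgt h QP.≟ hgt h' ⟧ * ψ h h'

  lv-sym : ∀ a b → lv a b ≡ lv b a
  lv-sym true true = refl
  lv-sym true false = refl
  lv-sym false true = refl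
  lv-sym false false = refl

  ⟦⟧-⇔ : ∀ {P R : Set} (p : Dec P) (r : Dec R) → (P → R) → (R → P) → ⟦ p ⟧ ≡ ⟦ r ⟧
  ⟦⟧-⇔ (yes p) r f g = ≡sym (⟦⟧-yes r (f p))
  ⟦⟧-⇔ (no np) r f g = ≡sym (⟦⟧-no r (λ q → np (g q)))

  halfθ-anti : ∀ h h' → halfθ h h' ≡ - halfθ h' h
  halfθ-anti h h' = trans (cong₂ _*_ (⟦⟧-⇔ (hgt h QP.≟ hgt h') (hgt h' QP.≟ hgt h) ≡sym ≡sym)
      (cong₂ _*_ (lv-sym (lev h) (lev h')) (sg-anti (slope h) (slope h'))))
    (l ⟦ hgt h' QP.≟ hgt h ⟧ (lv (lev h') (lev h)) (sg (slope h') (slope h)))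
    where
    l : ∀ a b c → a * (b * - c) ≡ - (a * (b * c))
    l = solve-∀

  θ-anti : ∀ s s' → θ s s' ≡ - θ s' s
  θ-anti s s' = trans (cong₂ _*_ (cong₂ _+_ (⟦⟧-⇔ (Seg.bh s QP.≟ Seg.bh s') (Seg.bh s' QP.≟ Seg.bh s) ≡sym ≡sym)
                                             (⟦⟧-⇔ (Seg.th s QP.≟ Seg.th s') (Seg.th s' QP.≟ Seg.th s) ≡sym ≡sym))
                       (sg-anti (Seg.sl s) (Seg.sl s')))
    (l (⟦ Seg.bh s' QP.≟ Seg.bh s ⟧ + ⟦ Seg.th s' QP.≟ Seg.th s ⟧) (sg (Seg.sl s') (Seg.sl s)))
    where
    l : ∀ a c → a * - c ≡ - (a * c)
    l = solve-∀

  bottom-half top-half : Seg → Half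
  bottom-half s = record { hgt = Seg.bh s ; lev = true ; slope = Seg.sl s }
  top-half s = record { hgt = Seg.th s ; lev = false ; slope = Seg.sl s }

  fst-half snd-half : Bool → Seg → Half
  fst-half true = bottom-half
  fst-half false = top-half
  snd-half true = top-half
  snd-half false = bottom-half

  sign : Bool → ℤ
  sign true = 1ℤ
  sign false = - 1ℤ

  -- Along the arc the first end of a side counts positively and the second negatively. In θ bottoms
  -- meet only bottoms and tops only tops, and the factor `lv` removes the mixed pairs.
  expand : ∀ u u' s s' → sign u * sign u' * θ s s' ≡
    halfθ (fst-half u s) (fst-half u' s') - halfθ (fst-half u s) (snd-half u' s')
    - halfθ (snd-half u s) (fst-half u' s') + halfθ (snd-half u s) (snd-half u' s')
  expand u u' s s' = go u u'
    where
    bb = ⟦ Seg.bh s QP.≟ Seg.bh s' ⟧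
    bt = ⟦ Seg.bh s QP.≟ Seg.th s' ⟧
    tb = ⟦ Seg.th s QP.≟ Seg.bh s' ⟧
    tt = ⟦ Seg.th s QP.≟ Seg.th s' ⟧
    k = sg (Seg.sl s) (Seg.sl s')
    l₁ : ∀ bb bt tb tt k → 1ℤ * 1ℤ * ((bb + tt) * k) ≡ bb * (1ℤ * k) - bt * (0ℤ * k) - tb * (0ℤ * k) + tt * (1ℤ * k)
    l₁ = solve-∀
    l₂ : ∀ bb bt tb tt k → 1ℤ * - 1ℤ * ((bb + tt) * k) ≡ bt * (0ℤ * k) - bb * (1ℤ * k) - tt * (1ℤ * k) + tb * (0ℤ * k)
    l₂ = solve-∀
    l₃ : ∀ bb bt tb tt k → - 1ℤ * 1ℤ * ((bb + tt) * k) ≡ tb * (0ℤ * k) - tt * (1ℤ * k) - bb * (1ℤ * k) + bt * (0ℤ * k)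
    l₃ = solve-∀
    l₄ : ∀ bb bt tb tt k → - 1ℤ * - 1ℤ * ((bb + tt) * k) ≡ tt * (1ℤ * k) - tb * (0ℤ * k) - bt * (0ℤ * k) + bb * (1ℤ * k)
    l₄ = solve-∀
    go : ∀ u u' → sign u * sign u' * θ s s' ≡
      halfθ (fst-half u s) (fst-half u' s') - halfθ (fst-half u s) (snd-half u' s')
      - halfθ (snd-half u s) (fst-half u' s') + halfθ (snd-half u s) (snd-half u' s')
    go true true = l₁ bb bt tb tt k
    go true false = l₂ bb bt tb tt k
    go false true = l₃ bb bt tb tt k
    go false false = l₄ bb bt tb tt k

  module DartSum {G : SimpleGraph} (D : PlaneDrawing G) where

    open PlaneDrawing D
    open EdgeList G
    open Drawn D
    open Sheared λ₀

    opaque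
      sides : ∀ e → List (Sides e)
      sides e = allFin (suc (m (arc e)))

      ∈sides : ∀ e i → i ∈ sides e
      ∈sides e = ∈-allFin

      sides-unique : ∀ e → Unique (sides e)
      sides-unique e = UniqueP.allFin⁺ (suc (m (arc e)))

      telescope : ∀ e (f : Fin (suc (suc (m (arc e)))) → ℤ) →
                  Σˡ (sides e) (λ i → f (inject₁ i) - f (suc i)) ≡ f zero - f (fromℕ (suc (m (arc e))))
      telescope e = Σ-telescope (m (arc e))

    up? : ∀ e → Sides e → Bool
    up? e i with ori e i
    ... | inj₁ _ = true
    ... | inj₂ _ = false

    o : ∀ e → Sides e → ℤ
    o e i = sign (up? e i)

    halfA halfB : ∀ e → Sides e → Half
    halfA e i = fst-half (up? e i) (seg e i)
    halfB e i = snd-half (up? e i) (seg e i)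

    hgt-A : ∀ e i → hgt (halfA e i) ≡ H λ₀ (A e i)
    hgt-A e i with ori e i
    ... | inj₁ (p , _) = cong proj₂ p
    ... | inj₂ (_ , p) = cong proj₂ p

    hgt-B : ∀ e i → hgt (halfB e i) ≡ H λ₀ (B e i)
    hgt-B e i with ori e i
    ... | inj₁ (_ , p) = cong proj₂ p
    ... | inj₂ (p , _) = cong proj₂ p

    o-diff : ∀ e i (g : Pt → ℤ) → o e i * (g (bot (seg e i)) - g (top (seg e i))) ≡ g (sh (A e i)) - g (sh (B e i))
    o-diff e i g with ori e i
    ... | inj₁ (p , q) = trans (ℤP.*-identityˡ _) (cong₂ (λ a b → g a - g b) p q)
    ... | inj₂ (p , q) = trans (cong₂ (λ a b → - 1ℤ * (g a - g b)) p q) (l (g (sh (A e i))) (g (sh (B e i))))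
      where
      l : ∀ a b → - 1ℤ * (b - a) ≡ a - b
      l = solve-∀

    last : ∀ e → Sides e
    last e = fromℕ (m (arc e))

    first-half last-half : E → Half
    first-half e = halfA e zero
    last-half e = halfB e (last e)

    -- `Φ` runs over all sides of the two arcs, `T` over the first and last ends of the arcs alone.
    Φ T : E → E → ℤ
    Φ e f = Σˡ (sides e) (λ i → Σˡ (sides f) (λ j → o e i * o f j * θ (seg e i) (seg f j)))
    T e f = halfθ (first-half e) (first-half f) - halfθ (first-half e) (last-half f)
          - halfθ (last-half e) (first-half f) + halfθ (last-half e) (last-half f)

    gen : ∀ {p r} → p ∈ allPoints → r ∈ allPoints → H λ₀ p ≡ H λ₀ r → p ≡ r
    gen = proj₂ (generic-shear allPoints)

    private
      data Away (e : E) (h : Half) : Set where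
        away : ∀ j → hgt h ≡ H λ₀ (pt (arc e) j) → j ≢ zero → j ≢ fromℕ (suc (m (arc e))) → Away e h

      data At (e : E) (h : Half) : Set where
        at : ∀ j → hgt h ≡ H λ₀ (pt (arc e) j) → At e h

      on-arc : ∀ e j → OnPoly (pt (arc e) j) (arc e)
      on-arc e zero = zero , start-OnSeg (segA (arc e) zero) (segB (arc e) zero)
      on-arc e (suc j) = j , end-OnSeg (segA (arc e) j) (segB (arc e) j)

      module Arc (e : E) = Polygonal (arc e) (arc-simple e)

      no-share : ∀ {e f h h'} → e ≢ f → Away e h → At f h' → hgt h ≢ hgt h'
      no-share {e} {f} ne (away i p i≢0 i≢l) (at j q) eq =
        [ (λ s → i≢0 (Arc.pt-inj e i zero s)) , (λ s → i≢l (Arc.pt-inj e i (fromℕ (suc (m (arc e)))) s)) ]′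
          (shared-point e f ne (pt (arc e) i) (on-arc e i) (subst (λ z → OnPoly z (arc f)) (≡sym same) (on-arc f j)))
        where
        same : pt (arc e) i ≡ pt (arc f) j
        same = gen (∈allPoints e i) (∈allPoints f j) (trans (≡sym p) (trans eq q))

      at-A : ∀ e i → At e (halfA e i)
      at-A e i = at (inject₁ i) (hgt-A e i)
      at-B : ∀ e i → At e (halfB e i)
      at-B e i = at (suc i) (hgt-B e i)

      away-A : ∀ e i → i ≢ zero → Away e (halfA e i)
      away-A e i ne = away (inject₁ i) (hgt-A e i) (λ p → ne (FP.inject₁-injective p)) (λ p → FP.fromℕ≢inject₁ (≡sym p))

      away-B : ∀ e i → i ≢ last e → Away e (halfB e i)
      away-B e i ne = away (suc i) (hgt-B e i) (λ ()) (λ p → ne (FP.suc-injective p))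

      vanish : ∀ h h' → hgt h ≢ hgt h' → halfθ h h' ≡ 0ℤ
      vanish h h' ne = cong (_* ψ h h') (⟦⟧-no (hgt h QP.≟ hgt h') ne)

      module _ {e f : E} (ne : e ≢ f) where

        corner-sum : (h : Sides e → Half) (h' : Sides f → Half) (i₀ : Sides e) (j₀ : Sides f) →
          (∀ i → At e (h i)) → (∀ j → At f (h' j)) → (∀ i → i ≢ i₀ → Away e (h i)) → (∀ j → j ≢ j₀ → Away f (h' j)) →
          Σˡ (sides e) (λ i → Σˡ (sides f) (λ j → halfθ (h i) (h' j))) ≡ halfθ (h i₀) (h' j₀)
        corner-sum h h' i₀ j₀ at₁ at₂ aw₁ aw₂ = Σ-corner (λ i j → halfθ (h i) (h' j)) (sides-unique e) (∈sides e i₀) (sides-unique f) (∈sides f j₀)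
          (λ { i j (inj₁ q) → vanish (h i) (h' j) (no-share ne (aw₁ i q) (at₂ j))
             ; i j (inj₂ q) → vanish (h i) (h' j) (λ eq → no-share (λ r → ne (≡sym r)) (aw₂ j q) (at₁ i) (≡sym eq)) })

        -- A bend of one arc does not lie on the other arc, so after the generic shear it shares no
        -- height with the corners of the other. In each of the four sums only the pair of extreme
        -- ends remains.
        Φ≡T-distinct : Φ e f ≡ T e f
        Φ≡T-distinct = begin
          Φ e f ≡⟨ Σ-cong (sides e) (λ {i} _ → Σ-cong (sides f) (λ {j} _ → expand (up? e i) (up? f j) (seg e i) (seg f j))) ⟩
          ΣΣ (λ i j → a i j - b i j - c i j + d i j) ≡⟨ split (λ i j → a i j - b i j - c i j) d ⟩
          ΣΣ (λ i j → a i j - b i j - c i j) + ΣΣ d ≡⟨ cong (_+ ΣΣ d) (splitm (λ i j → a i j - b i j) c) ⟩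
          ΣΣ (λ i j → a i j - b i j) - ΣΣ c + ΣΣ d ≡⟨ cong (λ z → z - ΣΣ c + ΣΣ d) (splitm a b) ⟩
          ΣΣ a - ΣΣ b - ΣΣ c + ΣΣ d ≡⟨ cong₂ _+_ (cong₂ _-_ (cong₂ _-_
              (corner-sum (halfA e) (halfA f) zero zero (at-A e) (at-A f) (away-A e) (away-A f))
              (corner-sum (halfA e) (halfB f) zero (last f) (at-A e) (at-B f) (away-A e) (away-B f)))
              (corner-sum (halfB e) (halfA f) (last e) zero (at-B e) (at-A f) (away-B e) (away-A f)))
              (corner-sum (halfB e) (halfB f) (last e) (last f) (at-B e) (at-B f) (away-B e) (away-B f)) ⟩
          T e f ∎
          where
          open ≡-Reasoning
          ΣΣ : (Sides e → Sides f → ℤ) → ℤ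
          ΣΣ k = Σˡ (sides e) (λ i → Σˡ (sides f) (k i))
          a b c d : Sides e → Sides f → ℤ
          a i j = halfθ (halfA e i) (halfA f j)
          b i j = halfθ (halfA e i) (halfB f j)
          c i j = halfθ (halfB e i) (halfA f j)
          d i j = halfθ (halfB e i) (halfB f j)
          split : ∀ p q → ΣΣ (λ i j → p i j + q i j) ≡ ΣΣ p + ΣΣ q
          split p q = trans (Σ-cong (sides e) (λ {i} _ → Σ-+ (sides f) (p i) (q i))) (Σ-+ (sides e) _ _)
          splitm : ∀ p q → ΣΣ (λ i j → p i j - q i j) ≡ ΣΣ p - ΣΣ q
          splitm p q = trans (Σ-cong (sides e) (λ {i} _ → Σ-- (sides f) (p i) (q i))) (Σ-- (sides e) _ _)

    Φ≡T : ∀ e f → Φ e f ≡ T e f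
    Φ≡T e f = go (edge-≟ e f)
      where
      l : ∀ a b k → a * b * k ≡ - (b * a * - k)
      l = solve-∀
      self : ∀ h → halfθ h h ≡ 0ℤ
      self h = self-negative _ (halfθ-anti h h)
      l₂ : ∀ {a d} b → a ≡ 0ℤ → d ≡ 0ℤ → a - - b - b + d ≡ 0ℤ
      l₂ b refl refl = l₃ b
        where
        l₃ : ∀ b → 0ℤ - - b - b + 0ℤ ≡ 0ℤ
        l₃ = solve-∀
      go : ∀ {f} → Dec (e ≡ f) → Φ e f ≡ T e f
      go (no ne) = Φ≡T-distinct ne
      -- On a single arc consecutive sides do share their bend, but both expressions are
      -- antisymmetric and vanish without a local analysis.
      go (yes refl) = trans
        (Σ-antisym (sides e) (λ i j → o e i * o e j * θ (seg e i) (seg e j))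
          (λ i j → trans (l (o e i) (o e j) (θ (seg e i) (seg e j))) (cong (λ z → - (o e j * o e i * z)) (≡sym (θ-anti (seg e j) (seg e i))))))
        (≡sym (trans (cong (λ z → halfθ (first-half e) (first-half e) - z - halfθ (last-half e) (first-half e) + halfθ (last-half e) (last-half e))
                            (halfθ-anti (first-half e) (last-half e)))
                (l₂ (halfθ (last-half e) (first-half e)) (self (first-half e)) (self (last-half e)))))

    Ix : Set
    Ix = Σ E Sides

    ixs : List Ix
    ixs = concatMap (λ e → map (e ,_) (sides e)) edges

    Σ-ixs : ∀ f → Σˡ ixs f ≡ Σˡ edges (λ e → Σˡ (sides e) (λ i → f (e , i)))
    Σ-ixs f = trans (Σ-concatMap (λ e → map (e ,_) (sides e)) edges f) (Σ-cong edges (λ {e} _ → Σ-map (sides e) (e ,_) f))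

    record Circ (c : V → V → ℤ) : Set where
      field
        anti : ∀ a b → c a b ≡ - c b a
        cons : ∀ v → Σˡ (nbrs v) (c v) ≡ 0ℤ

    module Weighted {c : V → V → ℤ} (cc : Circ c) where

      open Circ cc

      c[_] : E → ℤ
      c[ e ] = c (src {G} e) (tgt {G} e)

      -- The flow through a side, counted upwards.
      F : Ix → ℤ
      F (e , i) = c[ e ] * o e i

      -- A circulation has no boundary: the differences of `g` telescope along each arc, and what is
      -- left at the vertices cancels by conservation. Taking `side` of a fixed segment for `g`
      -- disposes of all ends lying beside that segment.
      closed : ∀ (g : Pt → ℤ) → Σˡ ixs (λ x → F x * (g (bot (seg (proj₁ x) (proj₂ x))) - g (top (seg (proj₁ x) (proj₂ x))))) ≡ 0ℤ
      closed g = begin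
        Σˡ ixs (λ x → F x * (g (bot (seg (proj₁ x) (proj₂ x))) - g (top (seg (proj₁ x) (proj₂ x)))))
          ≡⟨ Σ-ixs (λ x → F x * (g (bot (seg (proj₁ x) (proj₂ x))) - g (top (seg (proj₁ x) (proj₂ x))))) ⟩
        Σˡ edges (λ e → Σˡ (sides e) (λ i → c[ e ] * o e i * (g (bot (seg e i)) - g (top (seg e i)))))
          ≡⟨ Σ-cong edges (λ {e} _ → along e) ⟩
        Σˡ edges (λ e → γ (src {G} e) (tgt {G} e) + γ (tgt {G} e) (src {G} e))
          ≡⟨ Σ-darts γ ⟩
        ΣV (λ v → Σˡ (nbrs v) (γ v))
          ≡⟨ Σ-0 (allFin (n G)) (λ {v} _ → trans (Σ-*ʳ (nbrs v) (g (sh (pos v))) (c v)) (cong (_* g (sh (pos v))) (cons v))) ⟩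
        0ℤ ∎
        where
        open ≡-Reasoning
        γ : V → V → ℤ
        γ v w = c v w * g (sh (pos v))
        l : ∀ k a b → k * (a - b) ≡ k * a + - k * b
        l = solve-∀
        along : ∀ e → Σˡ (sides e) (λ i → c[ e ] * o e i * (g (bot (seg e i)) - g (top (seg e i)))) ≡
                      γ (src {G} e) (tgt {G} e) + γ (tgt {G} e) (src {G} e)
        along e = begin
          Σˡ (sides e) (λ i → c[ e ] * o e i * (g (bot (seg e i)) - g (top (seg e i))))
            ≡⟨ Σ-cong (sides e) (λ {i} _ → trans (ℤP.*-assoc c[ e ] (o e i) _) (cong (c[ e ] *_) (o-diff e i g))) ⟩
          Σˡ (sides e) (λ i → c[ e ] * (g (sh (A e i)) - g (sh (B e i))))
            ≡⟨ Σ-*ˡ (sides e) c[ e ] _ ⟩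
          c[ e ] * Σˡ (sides e) (λ i → g (sh (A e i)) - g (sh (B e i)))
            ≡⟨ cong (c[ e ] *_) (telescope e (λ j → g (sh (pt (arc e) j)))) ⟩
          c[ e ] * (g (sh (startP (arc e))) - g (sh (endP (arc e))))
            ≡⟨ cong₂ (λ p q → c[ e ] * (g (sh p) - g (sh q))) (arc-start e) (arc-end e) ⟩
          c[ e ] * (g (sh (pos (src {G} e))) - g (sh (pos (tgt {G} e))))
            ≡⟨ l c[ e ] _ _ ⟩
          c[ e ] * g (sh (pos (src {G} e))) + - c[ e ] * g (sh (pos (tgt {G} e)))
            ≡⟨ cong (λ z → c[ e ] * g (sh (pos (src {G} e))) + z * g (sh (pos (tgt {G} e)))) (≡sym (anti (tgt {G} e) (src {G} e))) ⟩
          γ (src {G} e) (tgt {G} e) + γ (tgt {G} e) (src {G} e) ∎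

    -- The end at `v` of the arc between `v` and `w`, whichever way the edge is stored.
    hd : V → V → Half
    hd v w with edge? v w
    ... | yes (p , q) = first-half ((v , w) , p , q)
    ... | no _ with edge? w v
    ...   | yes (p , q) = last-half ((w , v) , p , q)
    -- An arbitrary value for non-adjacent pairs; sums only range over neighbours.
    ...   | no _ = record { hgt = 0ℚ ; lev = true ; slope = 0ℚ }

    hd-first : ∀ e → hd (src {G} e) (tgt {G} e) ≡ first-half e
    hd-first e@((u , v) , p , q) with edge? u v
    ... | yes (p' , q') = cong first-half (edge-≡ {G} ((u , v) , p' , q') e refl refl)
    ... | no np = ⊥-elim (np (p , q))

    hd-last : ∀ e → hd (tgt {G} e) (src {G} e) ≡ last-half e
    hd-last e@((u , v) , p , q) with edge? v u
    ... | yes (p' , _) = ⊥-elim (FP.<-asym p p')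
    ... | no _ with edge? u v
    ...   | yes (p' , q') = cong last-half (edge-≡ {G} ((u , v) , p' , q') e refl refl)
    ...   | no np = ⊥-elim (np (p , q))

    dart-edge : ∀ v {w} → w ∈ nbrs v → ∃[ e ] ((src {G} e ≡ v × tgt {G} e ≡ w) ⊎ (tgt {G} e ≡ v × src {G} e ≡ w))
    dart-edge v {w} i = go (FP.<-cmp v w) (proj₂ (∈-filter⁻ (λ w → adj G v w Bool.≟ true) {xs = allFin _} i))
      where
      go : Tri (v F.< w) (v ≡ w) (w F.< v) → adj G v w ≡ true → ∃[ e ] ((src {G} e ≡ v × tgt {G} e ≡ w) ⊎ (tgt {G} e ≡ v × src {G} e ≡ w))
      go (tri< lt _ _) a = ((v , w) , lt , a) , inj₁ (refl , refl)
      go (tri> _ _ gt) a = ((w , v) , gt , trans (SimpleGraph.sym G w v) a) , inj₂ (refl , refl)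
      go (tri≈ _ refl _) a with trans (≡sym a) (irrefl G v)
      ... | ()

    pos∈ : ∀ v {w} → w ∈ nbrs v → pos v ∈ allPoints
    pos∈ v i = go (dart-edge v i)
      where
      go : ∀ {w} → ∃[ e ] ((src {G} e ≡ v × tgt {G} e ≡ w) ⊎ (tgt {G} e ≡ v × src {G} e ≡ w)) → pos v ∈ allPoints
      go (e , inj₁ (refl , _)) = subst (_∈ allPoints) (arc-start e) (∈allPoints e zero)
      go (e , inj₂ (refl , _)) = subst (_∈ allPoints) (arc-end e) (∈allPoints e (fromℕ (suc (m (arc e)))))

    hgt-hd : ∀ v {w} → w ∈ nbrs v → hgt (hd v w) ≡ H λ₀ (pos v)
    hgt-hd v i = go (dart-edge v i)
      where
      go : ∀ {w} → ∃[ e ] ((src {G} e ≡ v × tgt {G} e ≡ w) ⊎ (tgt {G} e ≡ v × src {G} e ≡ w)) → hgt (hd v w) ≡ H λ₀ (pos v)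
      go (e , inj₁ (refl , refl)) = trans (cong hgt (hd-first e)) (trans (hgt-A e zero) (cong (H λ₀) (arc-start e)))
      go (e , inj₂ (refl , refl)) = trans (cong hgt (hd-last e)) (trans (hgt-B e (last e)) (cong (H λ₀) (arc-end e)))

    record HalfOf (h : Half) (s : Seg) : Set where
      field
        slope≡ : slope h ≡ Seg.sl s
        end    : (lev h ≡ true × hgt h ≡ Seg.bh s) ⊎ (lev h ≡ false × hgt h ≡ Seg.th s)

    fst-HalfOf : ∀ u s → HalfOf (fst-half u s) s
    fst-HalfOf true s = record { slope≡ = refl ; end = inj₁ (refl , refl) }
    fst-HalfOf false s = record { slope≡ = refl ; end = inj₂ (refl , refl) }

    snd-HalfOf : ∀ u s → HalfOf (snd-half u s) s
    snd-HalfOf true s = record { slope≡ = refl ; end = inj₂ (refl , refl) }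
    snd-HalfOf false s = record { slope≡ = refl ; end = inj₁ (refl , refl) }

    -- Two arcs leaving `v` on the same level with the same slope would overlap near `v`. Distinct
    -- slopes make the order of the neighbours by slope strict.
    slopes-differ : ∀ v {w w'} → w ∈ nbrs v → w' ∈ nbrs v → w ≢ w' → lev (hd v w) ≡ lev (hd v w') → slope (hd v w) ≢ slope (hd v w')
    slopes-differ v {w} {w'} i j ne lev≡ slope≡ = go (dart-edge v i) (dart-edge v j)
      where
      hd-of : ∀ {w} e → (src {G} e ≡ v × tgt {G} e ≡ w) ⊎ (tgt {G} e ≡ v × src {G} e ≡ w) → ∃[ k ] HalfOf (hd v w) (seg e k)
      hd-of e (inj₁ (refl , refl)) = zero , subst (λ h → HalfOf h (seg e zero)) (≡sym (hd-first e)) (fst-HalfOf (up? e zero) (seg e zero))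
      hd-of e (inj₂ (refl , refl)) = last e , subst (λ h → HalfOf h (seg e (last e))) (≡sym (hd-last e)) (snd-HalfOf (up? e (last e)) (seg e (last e)))
      other : ∀ e → (src {G} e ≡ v × tgt {G} e ≡ w) ⊎ (tgt {G} e ≡ v × src {G} e ≡ w) →
                    (src {G} e ≡ v × tgt {G} e ≡ w') ⊎ (tgt {G} e ≡ v × src {G} e ≡ w') → ⊥
      other e (inj₁ (_ , p)) (inj₁ (_ , q)) = ne (trans (≡sym p) q)
      other e (inj₂ (_ , p)) (inj₂ (_ , q)) = ne (trans (≡sym p) q)
      other e (inj₁ (p , _)) (inj₂ (q , _)) = FP.<-irrefl (trans p (≡sym q)) (proj₁ (proj₂ e))
      other e (inj₂ (p , _)) (inj₁ (q , _)) = FP.<-irrefl (trans q (≡sym p)) (proj₁ (proj₂ e))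
      hgt≡ : hgt (hd v w) ≡ hgt (hd v w')
      hgt≡ = trans (hgt-hd v i) (≡sym (hgt-hd v j))
      clash : ∀ {h h' s s'} → Disjoint s s' → HalfOf h s → HalfOf h' s' → hgt h ≡ hgt h' → lev h ≡ lev h' → slope h ≡ slope h' → ⊥
      clash {h} {h'} {s} {s'} d x y eh el es = at-end (HalfOf.end x) (HalfOf.end y)
        where
        sl≡ = trans (≡sym (HalfOf.slope≡ x)) (trans es (HalfOf.slope≡ y))
        AtEnd : Half → Seg → Set
        AtEnd h s = (lev h ≡ true × hgt h ≡ Seg.bh s) ⊎ (lev h ≡ false × hgt h ≡ Seg.th s)
        at-end : AtEnd h s → AtEnd h' s' → ⊥
        at-end (inj₁ (_ , p)) (inj₁ (_ , q)) = Pair.bottom-slopes d (trans (≡sym p) (trans eh q)) sl≡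
        at-end (inj₂ (_ , p)) (inj₂ (_ , q)) = Pair.top-slopes d (trans (≡sym p) (trans eh q)) sl≡
        at-end (inj₁ (p , _)) (inj₂ (q , _)) with trans (≡sym p) (trans el q)
        ... | ()
        at-end (inj₂ (p , _)) (inj₁ (q , _)) with trans (≡sym p) (trans el q)
        ... | ()
      Ends : V → E → Set
      Ends w e = (src {G} e ≡ v × tgt {G} e ≡ w) ⊎ (tgt {G} e ≡ v × src {G} e ≡ w)
      go : ∃ (Ends w) → ∃ (Ends w') → ⊥
      go (e , x) (f , y) = clash (other-arc e (proj₁ (hd-of e x)) f (proj₁ (hd-of f y)) (λ { refl → other e x y }))
        (proj₂ (hd-of e x)) (proj₂ (hd-of f y)) hgt≡ lev≡ slope≡

    module _ {c c' : V → V → ℤ} (cc : Circ c) (cc' : Circ c') where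
      private
        module C = Weighted cc
        module C' = Weighted cc'

        sg′ : Ix → Seg
        sg′ (e , i) = seg e i

        -- By `κ-all` every θ is a difference of two terms, one a difference of `side` between the
        -- ends of the first segment, the other between those of the second. Summed with the flow of
        -- the respective segment, each gives 0 by `closed`.
        Σθ : Σˡ ixs (λ x → Σˡ ixs (λ y → C.F x * C'.F y * θ (sg′ x) (sg′ y))) ≡ 0ℤ
        Σθ = begin
          ΣΣ (λ x y → C.F x * C'.F y * θ (sg′ x) (sg′ y))
            ≡⟨ Σ-cong ixs (λ {x} _ → Σ-cong ixs (λ {y} _ → pointwise x y)) ⟩
          ΣΣ (λ x y → b x y - a x y)
            ≡⟨ Σ-cong ixs (λ {x} _ → Σ-- ixs (b x) (a x)) ⟩
          Σˡ ixs (λ x → Σˡ ixs (b x) - Σˡ ixs (a x))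
            ≡⟨ Σ-- ixs _ _ ⟩
          ΣΣ b - ΣΣ a
            ≡⟨ cong₂ _-_ Σb (trans (Σ-swap ixs ixs a) Σa) ⟩
          0ℤ ∎
          where
          open ≡-Reasoning
          ΣΣ : (Ix → Ix → ℤ) → ℤ
          ΣΣ k = Σˡ ixs (λ x → Σˡ ixs (k x))
          a b : Ix → Ix → ℤ
          a x y = C'.F y * (C.F x * (side (sg′ y) (bot (sg′ x)) - side (sg′ y) (top (sg′ x))))
          b x y = C.F x * (C'.F y * (side (sg′ x) (bot (sg′ y)) - side (sg′ x) (top (sg′ y))))
          l : ∀ f g p q t → p - q + t ≡ 0ℤ → f * g * t ≡ f * (g * q) - g * (f * p)
          l f g p q t eq = trans (l₁ f g p q t) (trans (cong (λ z → f * g * z + (f * (g * q) - g * (f * p))) eq) (l₂ f g _))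
            where
            l₁ : ∀ f g p q t → f * g * t ≡ f * g * (p - q + t) + (f * (g * q) - g * (f * p))
            l₁ = solve-∀
            l₂ : ∀ f g z → f * g * 0ℤ + z ≡ z
            l₂ = solve-∀
          pointwise : ∀ x y → C.F x * C'.F y * θ (sg′ x) (sg′ y) ≡ b x y - a x y
          pointwise x@(e , i) y@(f , j) = l (C.F x) (C'.F y) _ _ _ (κ-all e i f j)
          Σa : Σˡ ixs (λ y → Σˡ ixs (λ x → a x y)) ≡ 0ℤ
          Σa = Σ-0 ixs (λ {y} _ → trans (Σ-*ˡ ixs (C'.F y) _) (trans (cong (C'.F y *_) (C.closed (side (sg′ y)))) (ℤP.*-zeroʳ (C'.F y))))
          Σb : Σˡ ixs (λ x → Σˡ ixs (b x)) ≡ 0ℤ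
          Σb = Σ-0 ixs (λ {x} _ → trans (Σ-*ˡ ixs (C.F x) _) (trans (cong (C.F x *_) (C'.closed (side (sg′ x)))) (ℤP.*-zeroʳ (C.F x))))

        ΣT : Σˡ edges (λ e → Σˡ edges (λ f → C.c[ e ] * C'.c[ f ] * T e f)) ≡ 0ℤ
        ΣT = trans (Σ-cong edges (λ {e} _ → by-edge e)) (trans (≡sym (Σ-ixs (λ x → Σˡ ixs (λ y → C.F x * C'.F y * θ (sg′ x) (sg′ y))))) Σθ)
          where
          open ≡-Reasoning
          l : ∀ a b p q t → a * b * (p * q * t) ≡ a * p * (b * q) * t
          l = solve-∀
          by-edge : ∀ e → Σˡ edges (λ f → C.c[ e ] * C'.c[ f ] * T e f) ≡
                          Σˡ (sides e) (λ i → Σˡ ixs (λ y → C.F (e , i) * C'.F y * θ (seg e i) (sg′ y)))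
          by-edge e = begin
            Σˡ edges (λ f → C.c[ e ] * C'.c[ f ] * T e f)
              ≡⟨ Σ-cong edges (λ {f} _ → begin
                   C.c[ e ] * C'.c[ f ] * T e f ≡⟨ cong (C.c[ e ] * C'.c[ f ] *_) (Φ≡T e f) ⟨
                   C.c[ e ] * C'.c[ f ] * Φ e f ≡⟨ Σ-*ˡ (sides e) (C.c[ e ] * C'.c[ f ]) _ ⟨
                   Σˡ (sides e) (λ i → C.c[ e ] * C'.c[ f ] * Σˡ (sides f) (λ j → o e i * o f j * θ (seg e i) (seg f j)))
                     ≡⟨ Σ-cong (sides e) (λ {i} _ → trans (≡sym (Σ-*ˡ (sides f) (C.c[ e ] * C'.c[ f ]) _))
                          (Σ-cong (sides f) (λ {j} _ → l C.c[ e ] C'.c[ f ] (o e i) (o f j) (θ (seg e i) (seg f j))))) ⟩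
                   Σˡ (sides e) (λ i → Σˡ (sides f) (λ j → C.F (e , i) * C'.F (f , j) * θ (seg e i) (seg f j))) ∎) ⟩
            Σˡ edges (λ f → Σˡ (sides e) (λ i → Σˡ (sides f) (λ j → C.F (e , i) * C'.F (f , j) * θ (seg e i) (seg f j))))
              ≡⟨ Σ-swap edges (sides e) _ ⟩
            Σˡ (sides e) (λ i → Σˡ edges (λ f → Σˡ (sides f) (λ j → C.F (e , i) * C'.F (f , j) * θ (seg e i) (seg f j))))
              ≡⟨ Σ-cong (sides e) (λ {i} _ → ≡sym (Σ-ixs (λ y → C.F (e , i) * C'.F y * θ (seg e i) (sg′ y)))) ⟩
            Σˡ (sides e) (λ i → Σˡ ixs (λ y → C.F (e , i) * C'.F y * θ (seg e i) (sg′ y))) ∎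

        J : V → V → V → V → ℤ
        J v w v' w' = c v w * c' v' w' * halfθ (hd v w) (hd v' w')

        R : V → V → ℤ
        R v w = ΣV (λ v' → Σˡ (nbrs v') (J v w v'))

        ΣJ : ΣV (λ v → Σˡ (nbrs v) (R v)) ≡ 0ℤ
        ΣJ = trans (≡sym (Σ-darts R)) (trans (Σ-cong edges (λ {e} _ → by-edge e)) ΣT)
          where
          l : ∀ a b p q r t → a * b * p + a * - b * q + (- a * b * r + - a * - b * t) ≡ a * b * (p - q - r + t)
          l = solve-∀
          cong₄ : ∀ {a a' b b' p p' q q' r r' t t' : ℤ} → a ≡ a' → b ≡ b' → p ≡ p' → q ≡ q' → r ≡ r' → t ≡ t' → ∀ x y →
            x * y * p + x * b * q + (a * y * r + a * b * t) ≡ x * y * p' + x * b' * q' + (a' * y * r' + a' * b' * t')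
          cong₄ refl refl refl refl refl refl x y = refl
          by-edge : ∀ e → R (src {G} e) (tgt {G} e) + R (tgt {G} e) (src {G} e) ≡ Σˡ edges (λ f → C.c[ e ] * C'.c[ f ] * T e f)
          by-edge e = trans (cong₂ _+_ (≡sym (Σ-darts (J s t))) (≡sym (Σ-darts (J t s)))) (trans (≡sym (Σ-+ edges _ _))
            (Σ-cong edges (λ {f} _ → trans
              (cong₄ (Circ.anti cc t s) (Circ.anti cc' (tgt {G} f) (src {G} f))
                (cong₂ halfθ (hd-first e) (hd-first f)) (cong₂ halfθ (hd-first e) (hd-last f))
                (cong₂ halfθ (hd-last e) (hd-first f)) (cong₂ halfθ (hd-last e) (hd-last f)) C.c[ e ] C'.c[ f ])
              (l C.c[ e ] C'.c[ f ] _ _ _ _))))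
            where
            s = src {G} e
            t = tgt {G} e

      -- Ends of arcs at equal heights belong to the same vertex, because the shear is generic and
      -- `pos` is injective. So the sum over all pairs of darts reduces to pairs with a common
      -- origin.
      vertex-sum : ΣV (λ v → Σˡ (nbrs v) (λ w → Σˡ (nbrs v) (λ w' → c v w * c' v w' * ψ (hd v w) (hd v w')))) ≡ 0ℤ
      vertex-sum = trans (Σ-cong (allFin (n G)) (λ {v} _ → Σ-cong (nbrs v) (λ {w} i → ≡sym (local v w i)))) ΣJ
        where
        l : ∀ a b i p → a * b * (i * p) ≡ i * (a * b * p)
        l = solve-∀
        local : ∀ v w → w ∈ nbrs v → R v w ≡ Σˡ (nbrs v) (λ w' → c v w * c' v w' * ψ (hd v w) (hd v w'))
        local v w i = trans (Σ-cong (allFin (n G)) (λ {v'} _ → trans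
            (Σ-cong (nbrs v') (λ {w'} j → trans (cong (λ z → c v w * c' v' w' * (z * ψ (hd v w) (hd v' w'))) (same-vertex v' j))
                                             (l (c v w) (c' v' w') ⟦ v F.≟ v' ⟧ (ψ (hd v w) (hd v' w')))))
            (Σ-*ˡ (nbrs v') ⟦ v F.≟ v' ⟧ _)))
          (Σ-at v (λ v' → Σˡ (nbrs v') (λ w' → c v w * c' v' w' * ψ (hd v w) (hd v' w'))))
          where
          same-vertex : ∀ v' {w'} → w' ∈ nbrs v' → ⟦ hgt (hd v w) QP.≟ hgt (hd v' w') ⟧ ≡ ⟦ v F.≟ v' ⟧
          same-vertex v' {w'} j = ⟦⟧-⇔ (hgt (hd v w) QP.≟ hgt (hd v' w')) (v F.≟ v')
            (λ eq → pos-inj v v' (gen (pos∈ v i) (pos∈ v' j) (trans (≡sym (hgt-hd v i)) (trans eq (hgt-hd v' j)))))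
            (λ eq → trans (hgt-hd v i) (trans (cong (λ u → H λ₀ (pos u)) eq) (≡sym (hgt-hd v' j))))

-- The rotation at a vertex, obtained by sorting slopes.

module RotationSystems where

  open import Defs hiding (V)
  open Sums
  open Segments using (sg; sg-<; sg->; sg-≡)
  open Edges
  open DartSums
  open Assembly using (Circulation; layout)
  open Layouts using (Layout)
  open import Data.Bool using (Bool; true; false)
  import Data.Bool as Bool
  open import Data.Integer using (ℤ; 0ℤ; 1ℤ; _+_; _*_; _-_; -_)
  import Data.Integer.Properties as ℤP
  open import Data.Integer.Tactic.RingSolver using (solve-∀)
  open import Data.Rational using (ℚ; _≤_; _<_)
  import Data.Rational.Properties as QP
  open import Data.List using (List; []; _∷_; _++_; filter; allFin)
  open import Data.List.Membership.Propositional using (_∈_)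
  open import Data.List.Membership.Propositional.Properties using (∈-allFin; ∈-filter⁻; ∈-filter⁺; ∈-++⁺ˡ; ∈-++⁺ʳ; ∈-++⁻)
  open import Data.List.Relation.Unary.Any using (here; there)
  open import Data.List.Relation.Unary.All as All using (All; []; _∷_)
  open import Data.List.Relation.Unary.AllPairs using (AllPairs; []; _∷_)
  open import Data.List.Relation.Unary.Linked.Properties using (Linked⇒AllPairs)
  open import Data.List.Relation.Unary.Unique.Propositional using (Unique)
  import Data.List.Relation.Unary.Unique.Propositional.Properties as UniqueP
  open import Data.List.Relation.Binary.Permutation.Propositional using (_↭_; ↭-sym; ↭⇒↭ₛ)
  open import Data.List.Relation.Binary.Permutation.Propositional.Properties using (∈-resp-↭)
  import Data.List.Relation.Binary.Permutation.Setoid.Properties as PermS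
  import Data.List.Sort as Sort
  open import Relation.Binary using (DecTotalOrder)
  import Relation.Binary.Construct.On as On
  open import Relation.Binary.PropositionalEquality using (setoid)

  Unique-resp-↭ : ∀ {A : Set} {xs ys : List A} → xs ↭ ys → Unique xs → Unique ys
  Unique-resp-↭ {A} p = PermS.Unique-resp-↭ (setoid A) (↭⇒↭ₛ p)

  ≤∧≢⇒< : ∀ {p q : ℚ} → p ≤ q → p ≢ q → p < q
  ≤∧≢⇒< p≤q p≢q = QP.≰⇒> (λ q≤p → p≢q (QP.≤-antisym p≤q q≤p))

  -- In a strictly increasing list `sg` is the sign of the difference of positions, and the diagonal
  -- contributes 0. The double sum is symmetric in form and can therefore be permuted back to the
  -- unsorted list.
  ω-sorted : ∀ {A : Set} (k : A → ℚ) (f g : A → ℤ) {xs} → AllPairs (λ a b → k a < k b) xs →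
             ω f g xs ≡ Σˡ xs (λ a → Σˡ xs (λ b → f a * g b * sg (k a) (k b)))
  ω-sorted k f g [] = refl
  ω-sorted {A} k f g {x ∷ xs} (d ∷ u) = begin
    f x * Σˡ xs g - g x * Σˡ xs f + ω f g xs
      ≡⟨ cong (λ z → f x * Σˡ xs g - g x * Σˡ xs f + z) (ω-sorted k f g u) ⟩
    f x * Σˡ xs g - g x * Σˡ xs f + ΣΣ
      ≡⟨ l (f x) (Σˡ xs g) (g x) (Σˡ xs f) ΣΣ ⟩
    f x * g x * 0ℤ + f x * Σˡ xs g + (- g x * Σˡ xs f + ΣΣ)
      ≡⟨ cong₂ _+_ (cong₂ _+_ (cong (f x * g x *_) (≡sym (sg-≡ refl))) (≡sym right)) (cong (_+ ΣΣ) (≡sym left)) ⟩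
    (t x x + Σˡ xs (t x)) + (Σˡ xs (λ a → t a x) + ΣΣ)
      ≡⟨ cong ((t x x + Σˡ xs (t x)) +_) (Σ-+ xs (λ a → t a x) (λ a → Σˡ xs (t a))) ⟨
    (t x x + Σˡ xs (t x)) + Σˡ xs (λ a → t a x + Σˡ xs (t a)) ∎
    where
    open ≡-Reasoning
    t : A → A → ℤ
    t a b = f a * g b * sg (k a) (k b)
    ΣΣ = Σˡ xs (λ a → Σˡ xs (t a))
    l : ∀ a b c d e → a * b - c * d + e ≡ a * c * 0ℤ + a * b + (- c * d + e)
    l = solve-∀
    l₁ : ∀ a b → a * b * 1ℤ ≡ a * b
    l₁ = solve-∀
    l₂ : ∀ a b → a * b * - 1ℤ ≡ - b * a
    l₂ = solve-∀
    right : Σˡ xs (t x) ≡ f x * Σˡ xs g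
    right = trans (Σ-cong xs (λ {b} i → trans (cong (f x * g b *_) (sg-< (All.lookup d i))) (l₁ (f x) (g b)))) (Σ-*ˡ xs (f x) g)
    left : Σˡ xs (λ a → t a x) ≡ - g x * Σˡ xs f
    left = trans (Σ-cong xs (λ {a} i → trans (cong (f a * g x *_) (sg-> (All.lookup d i))) (l₂ (f a) (g x)))) (Σ-*ˡ xs (- g x) f)

  module _ {G : SimpleGraph} (D : PlaneDrawing G) where

    open EdgeList G
    open DartSum D
    open Half

    private
      upward? : ∀ v w → Dec (lev (hd v w) ≡ true)
      upward? v w = lev (hd v w) Bool.≟ true
      downward? : ∀ v w → Dec (lev (hd v w) ≡ false)
      downward? v w = lev (hd v w) Bool.≟ false

      ups downs : V → List V
      ups v = filter (upward? v) (nbrs v)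
      downs v = filter (downward? v) (nbrs v)

      by-slope : V → DecTotalOrder _ _ _
      by-slope v = On.decTotalOrder QP.≤-decTotalOrder (λ w → slope (hd v w))

      module S (v : V) = Sort (by-slope v)

      nbrs-unique : ∀ v → Unique (nbrs v)
      nbrs-unique v = UniqueP.filter⁺ (λ w → adj G v w Bool.≟ true) (UniqueP.allFin⁺ (n G))

      ups-unique : ∀ v → Unique (ups v)
      ups-unique v = UniqueP.filter⁺ (upward? v) (nbrs-unique v)

      downs-unique : ∀ v → Unique (downs v)
      downs-unique v = UniqueP.filter⁺ (downward? v) (nbrs-unique v)

      ∈ups : ∀ v {w} → w ∈ ups v → w ∈ nbrs v × lev (hd v w) ≡ true
      ∈ups v = ∈-filter⁻ (upward? v)

      ∈downs : ∀ v {w} → w ∈ downs v → w ∈ nbrs v × lev (hd v w) ≡ false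
      ∈downs v = ∈-filter⁻ (downward? v)

      strict : ∀ v {xs} → Unique xs → AllPairs (λ a b → slope (hd v a) ≤ slope (hd v b)) xs →
               (∀ {a b} → a ∈ xs → b ∈ xs → a ≢ b → slope (hd v a) ≢ slope (hd v b)) →
               AllPairs (λ a b → slope (hd v a) < slope (hd v b)) xs
      strict v [] [] _ = []
      strict v (d ∷ u) (e ∷ s) ne =
        All.tabulate (λ i → ≤∧≢⇒< (All.lookup e i) (ne (here refl) (there i) (All.lookup d i)))
        ∷ strict v u s (λ i j → ne (there i) (there j))

      sorted : ∀ v xs → Unique xs → (∀ {a b} → a ∈ xs → b ∈ xs → a ≢ b → slope (hd v a) ≢ slope (hd v b)) →
               AllPairs (λ a b → slope (hd v a) < slope (hd v b)) (S.sort v xs)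
      sorted v xs u ne = strict v (Unique-resp-↭ (↭-sym p) u)
        (Linked⇒AllPairs QP.≤-trans (S.sort-↗ v xs)) (λ i j → ne (∈-resp-↭ p i) (∈-resp-↭ p j))
        where p = S.sort-↭ v xs

      -- Clockwise order: a slope is horizontal displacement per unit of height, so increasing
      -- slopes run from left to right above `v` but from right to left below it.
      rot : V → List V
      rot v = S.sort v (ups v) ++ S.sort v (downs v)

      up∈ : ∀ v {w} → w ∈ S.sort v (ups v) → w ∈ nbrs v × lev (hd v w) ≡ true
      up∈ v i = ∈ups v (∈-resp-↭ (S.sort-↭ v (ups v)) i)

      down∈ : ∀ v {w} → w ∈ S.sort v (downs v) → w ∈ nbrs v × lev (hd v w) ≡ false
      down∈ v i = ∈downs v (∈-resp-↭ (S.sort-↭ v (downs v)) i)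

      rot-unique : ∀ v → Unique (rot v)
      rot-unique v = UniqueP.++⁺ (Unique-resp-↭ (↭-sym (S.sort-↭ v (ups v))) (ups-unique v))
        (Unique-resp-↭ (↭-sym (S.sort-↭ v (downs v))) (downs-unique v))
        (λ (i , j) → true≢false (trans (≡sym (proj₂ (up∈ v i))) (proj₂ (down∈ v j))))
        where
        true≢false : true ≢ false
        true≢false ()

      rot-adj : ∀ {v w} → w ∈ rot v → adj G v w ≡ true
      rot-adj {v} {w} i = proj₂ (∈-filter⁻ (λ w → adj G v w Bool.≟ true) {xs = allFin (n G)} (in-nbrs (∈-++⁻ (S.sort v (ups v)) i)))
        where
        in-nbrs : w ∈ S.sort v (ups v) ⊎ w ∈ S.sort v (downs v) → w ∈ nbrs v
        in-nbrs (inj₁ j) = proj₁ (up∈ v j)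
        in-nbrs (inj₂ j) = proj₁ (down∈ v j)

      adj-rot : ∀ {v w} → adj G v w ≡ true → w ∈ rot v
      adj-rot {v} {w} a = by-level (lev (hd v w)) refl
        where
        w∈ : w ∈ nbrs v
        w∈ = ∈-filter⁺ (λ w → adj G v w Bool.≟ true) (∈-allFin w) a
        by-level : ∀ b → lev (hd v w) ≡ b → w ∈ rot v
        by-level true e = ∈-++⁺ˡ (∈-resp-↭ (↭-sym (S.sort-↭ v (ups v))) (∈-filter⁺ (upward? v) w∈ e))
        by-level false e = ∈-++⁺ʳ (S.sort v (ups v)) (∈-resp-↭ (↭-sym (S.sort-↭ v (downs v))) (∈-filter⁺ (downward? v) w∈ e))

      Σ-levels : ∀ v (f : V → ℤ) → ∀ xs → Σˡ xs f ≡ Σˡ (filter (upward? v) xs) f + Σˡ (filter (downward? v) xs) f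
      Σ-levels v f [] = refl
      Σ-levels v f (w ∷ xs) with lev (hd v w)
      ... | true = trans (cong (f w +_) (Σ-levels v f xs)) (≡sym (ℤP.+-assoc (f w) _ _))
      ... | false = trans (cong (f w +_) (Σ-levels v f xs)) (l (f w) (Σˡ (filter (upward? v) xs) f) (Σˡ (filter (downward? v) xs) f))
        where
        l : ∀ a b c → a + (b + c) ≡ b + (a + c)
        l = solve-∀

      Σ-rot : ∀ v (f : V → ℤ) → Σˡ (rot v) f ≡ Σˡ (nbrs v) f
      Σ-rot v f = trans (Σ-++ (S.sort v (ups v)) _ f)
        (trans (cong₂ _+_ (Σ-↭ f (S.sort-↭ v (ups v))) (Σ-↭ f (S.sort-↭ v (downs v)))) (≡sym (Σ-levels v f (nbrs v))))

      module _ {c c'} (k : Circulation rot c) (k' : Circulation rot c') where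
        private
          circ : ∀ {c} → Circulation rot c → Circ c
          circ k = record { anti = Circulation.anti k ; cons = λ v → trans (≡sym (Σ-rot v _)) (Circulation.cons k v) }

          module _ (v : V) where
            f g : V → ℤ
            f = c v
            g = c' v
            U = ups v
            L = downs v
            term : V → V → ℤ
            term w w' = f w * g w' * ψ (hd v w) (hd v w')

            ψ-same : ∀ {w w'} b → lev (hd v w) ≡ b → lev (hd v w') ≡ b → term w w' ≡ f w * g w' * sg (slope (hd v w)) (slope (hd v w'))
            ψ-same {w} {w'} b p q = cong (f w * g w' *_) (trans (cong₂ (λ x y → lv x y * _) p q) (one b))
              where
              one : ∀ b {z} → lv b b * z ≡ z
              one true = ℤP.*-identityˡ _
              one false = ℤP.*-identityˡ _

            ψ-diff : ∀ {w w'} a b → lv a b ≡ 0ℤ → lev (hd v w) ≡ a → lev (hd v w') ≡ b → term w w' ≡ 0ℤ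
            ψ-diff {w} {w'} a b z p q = trans (cong (λ y → f w * g w' * (y * sg (slope (hd v w)) (slope (hd v w')))) (trans (cong₂ lv p q) z)) (ℤP.*-zeroʳ (f w * g w'))

            ω-level : ∀ b xs → Unique xs → (∀ {w} → w ∈ xs → w ∈ nbrs v × lev (hd v w) ≡ b) →
                      ω f g (S.sort v xs) ≡ Σˡ xs (λ w → Σˡ xs (term w))
            ω-level b xs u lv≡ = trans
              (ω-sorted (λ w → slope (hd v w)) f g (sorted v xs u (λ i j ne → slopes-differ v (proj₁ (lv≡ i)) (proj₁ (lv≡ j)) ne
                (trans (proj₂ (lv≡ i)) (≡sym (proj₂ (lv≡ j)))))))
              (trans (Σ-↭ _ (S.sort-↭ v xs)) (Σ-cong xs (λ {w} i → trans (Σ-↭ _ (S.sort-↭ v xs))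
                (Σ-cong xs (λ {w'} j → ≡sym (ψ-same b (proj₂ (lv≡ i)) (proj₂ (lv≡ j))))))))

            balance : ∀ {c} → Circulation rot c → Σˡ (S.sort v U) (c v) + Σˡ (S.sort v L) (c v) ≡ 0ℤ
            balance {c} k = trans (≡sym (Σ-++ (S.sort v U) _ (c v))) (Circulation.cons k v)

            -- The sums over the downward ends are the negatives of those over the upward ends, for
            -- both circulations; hence the mixed term of ω between the two halves of the rotation
            -- vanishes, as it does in `ψ`.
            cross-0 : ∀ a b p q → a + p ≡ 0ℤ → b + q ≡ 0ℤ → a * q - b * p ≡ 0ℤ
            cross-0 a b p q x y = trans (l a b p q) (trans (cong₂ (λ s t → a * s - b * t) y x) (z a b))
              where
              l : ∀ a b p q → a * q - b * p ≡ a * (b + q) - b * (a + p)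
              l = solve-∀
              z : ∀ a b → a * 0ℤ - b * 0ℤ ≡ 0ℤ
              z = solve-∀

            at-vertex : ω f g (rot v) ≡ Σˡ (nbrs v) (λ w → Σˡ (nbrs v) (term w))
            at-vertex = begin
              ω f g (rot v)
                ≡⟨ ω-++ f g (S.sort v U) (S.sort v L) ⟩
              ω f g (S.sort v U) + ω f g (S.sort v L) +
                (Σˡ (S.sort v U) f * Σˡ (S.sort v L) g - Σˡ (S.sort v U) g * Σˡ (S.sort v L) f)
                ≡⟨ cong₂ _+_ (cong₂ _+_ (ω-level true U (ups-unique v) (∈ups v)) (ω-level false L (downs-unique v) (∈downs v)))
                     (cross-0 (Σˡ (S.sort v U) f) (Σˡ (S.sort v U) g) (Σˡ (S.sort v L) f) (Σˡ (S.sort v L) g) (balance k) (balance k')) ⟩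
              Σˡ U (λ w → Σˡ U (term w)) + Σˡ L (λ w → Σˡ L (term w)) + 0ℤ
                ≡⟨ ℤP.+-identityʳ _ ⟩
              Σˡ U (λ w → Σˡ U (term w)) + Σˡ L (λ w → Σˡ L (term w))
                ≡⟨ cong₂ _+_
                     (Σ-cong U (λ {w} i → trans (≡sym (ℤP.+-identityʳ _)) (trans (cong (Σˡ U (term w) +_)
                       (≡sym (Σ-0 L (λ j → ψ-diff true false refl (proj₂ (∈ups v i)) (proj₂ (∈downs v j))))))
                       (≡sym (Σ-levels v (term w) (nbrs v))))))
                     (Σ-cong L (λ {w} i → trans (≡sym (ℤP.+-identityˡ _)) (trans (cong (_+ Σˡ L (term w))
                       (≡sym (Σ-0 U (λ j → ψ-diff false true refl (proj₂ (∈downs v i)) (proj₂ (∈ups v j))))))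
                       (≡sym (Σ-levels v (term w) (nbrs v)))))) ⟩
              Σˡ U (λ w → Σˡ (nbrs v) (term w)) + Σˡ L (λ w → Σˡ (nbrs v) (term w))
                ≡⟨ Σ-levels v (λ w → Σˡ (nbrs v) (term w)) (nbrs v) ⟨
              Σˡ (nbrs v) (λ w → Σˡ (nbrs v) (term w)) ∎
              where open ≡-Reasoning

        crossings : Σˡ (allFin (n G)) (λ v → ω (c v) (c' v) (rot v)) ≡ 0ℤ
        crossings = trans (Σ-cong (allFin (n G)) (λ {v} _ → at-vertex v)) (vertex-sum (circ k) (circ k'))

    drawing⇒layout : Layout G
    drawing⇒layout = layout rot rot-unique rot-adj adj-rot crossings

open import Defs
open import Data.Nat using (ℕ; _≤_)
open import Data.Product using (_×_)

theorem5 : (G : SimpleGraph) (k : Edge G → ℕ) → (∀ e → 1 ≤ k e) →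
    (Planar G → IsLGraph (Subdivision G k))
    × IsBkVPG 2 (Complement (Subdivision G k))
theorem5 G k 1≤k =
  (λ D → Layouts.layout⇒L (RotationSystems.drawing⇒layout D) k 1≤k) , ComplementVPG.complement-B₂VPG G k
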